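{- For each integer $d \geq 3$, there exist a $(d+1)$-dimensional polytope $P \subset \mathbb{R}^{d+1}$ with $(2d+1)(d+1)+1$ facets and a nonzero linear objective function $\mathbf{w} \in \mathbb{R}^{d+1}$ such that for every nonzero $\mathbf{c} \in \mathbb{R}^{d+1}$ orthogonal to $\mathbf{w}$, the shadow simplex path from $\mathbf{w}$ to $\mathbf{c}$ on $P$ has length at least $2^{d-1}-1$.
   Context: The shadow simplex path from $\mathbf{w}$ to $\mathbf{c}$ on a polytope $P$ consists of the vertices of $P$ that are the unique maximizer over $P$ of $(\mathbf{w}+\lambda \mathbf{c})^{\top}\mathbf{x}$ for some $\lambda \geq 0$, in order of increasing $\lambda$ (if $\mathbf w,\mathbf c$ are not generic, ties may have to be broken, which can only add vertices to the path). Its length is the number of its edges, which is at least the number of such vertices minus one. -}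

module Defs where

open import Level using (Level; _⊔_) renaming (suc to lsuc)
open import Algebra.Bundles using (CommutativeRing)
open import Data.Fin.Base using (Fin; zero; suc; inject₁; fromℕ)
open import Data.Nat.Base using (ℕ; zero; suc)
open import Data.Product.Base using (Σ; ∃; ∃-syntax; _×_)
open import Data.Vec.Functional using (Vector)
open import Function.Bundles using (Bijection)
open import Relation.Binary.Bundles using (Setoid)
open import Relation.Binary.Core using (Rel)
import Relation.Binary.Construct.On as On
open import Relation.Binary.PropositionalEquality as ≡ using (_≡_)
open import Relation.Binary.Structures using (IsDecTotalOrder)
open import Relation.Nullary.Negation using (¬_)
open import Relation.Unary using (Pred; _∈_)
open import Relation.Unary.Relation.Binary.Equality using (≐-setoid)

-- The real numbers, given axiomatically (and uniquely up to isomorphism) as the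
-- (Dedekind-)complete ordered field, with a classical (decidable) order.
record CompleteOrderedField a ℓ₁ ℓ₂ : Set (lsuc (a ⊔ ℓ₁ ⊔ ℓ₂)) where
  field
    commutativeRing : CommutativeRing a ℓ₁

  open CommutativeRing commutativeRing public

  infix 4 _≤_

  field
    _≤_             : Rel Carrier ℓ₂
    isDecTotalOrder : IsDecTotalOrder _≈_ _≤_
    0≉1             : ¬ (0# ≈ 1#)
    inverse         : ∀ x → ¬ (x ≈ 0#) → ∃[ y ] (x * y ≈ 1#)
    +-monoˡ-≤       : ∀ z {x y} → x ≤ y → x + z ≤ y + z
    *-nonneg        : ∀ {x y} → 0# ≤ x → 0# ≤ y → 0# ≤ x * y

  UpperBound : ∀ {ℓ} → Pred Carrier ℓ → Carrier → Set (a ⊔ ℓ₂ ⊔ ℓ)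
  UpperBound S u = ∀ x → x ∈ S → x ≤ u

  field
    supremum : (S : Pred Carrier (a ⊔ ℓ₁ ⊔ ℓ₂)) →
               (∃[ x ] (x ∈ S)) → (∃[ u ] UpperBound S u) →
               ∃[ s ] (UpperBound S s × (∀ u → UpperBound S u → s ≤ u))

module Geometry {a ℓ₁ ℓ₂} (ℝ : CompleteOrderedField a ℓ₁ ℓ₂) where

  open CompleteOrderedField ℝ hiding (zero)
  open import Algebra.Properties.CommutativeMonoid.Sum +-commutativeMonoid
    public using (sum)
  open import Data.Vec.Functional.Relation.Binary.Equality.Setoid
    setoid public using (_≋_)

  private
    ℓ : Level
    ℓ = a ⊔ ℓ₁ ⊔ ℓ₂

  ℝ^_ : ℕ → Set a
  ℝ^ n = Vector Carrier n

  𝟎 : ∀ {n} → ℝ^ n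
  𝟎 _ = 0#

  infix 8 _·_

  _·_ : ∀ {n} → ℝ^ n → ℝ^ n → Carrier
  u · x = sum λ i → u i * x i

  Orthogonal : ∀ {n} → Rel (ℝ^ n) ℓ₁
  Orthogonal u x = u · x ≈ 0#

  combination : ∀ {k n} → (Fin k → Carrier) → (Fin k → ℝ^ n) → ℝ^ n
  combination μ p i = sum λ j → μ j * p j i

  AffinelyIndependent : ∀ {k n} → (Fin k → ℝ^ n) → Set (a ⊔ ℓ₁)
  AffinelyIndependent p =
    ∀ μ → sum μ ≈ 0# → combination μ p ≋ 𝟎 → ∀ j → μ j ≈ 0#

  AffineCombination : ∀ {k n} → (Fin k → ℝ^ n) → Pred (ℝ^ n) (a ⊔ ℓ₁)
  AffineCombination p x = ∃[ μ ] (sum μ ≈ 1# × x ≋ combination μ p)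

  -- The affine hull of S has dimension k: S contains k + 1 affinely
  -- independent points whose affine hull contains S.
  HasDimension : ∀ {n p} → Pred (ℝ^ n) p → ℕ → Set (a ⊔ ℓ₁ ⊔ p)
  HasDimension {n} S k =
    Σ (Fin (suc k) → ℝ^ n) λ p →
      (∀ j → p j ∈ S) × AffinelyIndependent p ×
      (∀ x → x ∈ S → x ∈ AffineCombination p)

  -- A polytope is a bounded intersection of finitely many closed half-spaces.
  -- The presentation may be redundant: facets are counted as faces of the
  -- point set, not as inequalities.
  record Polytope (n : ℕ) : Set ℓ where
    field
      size   : ℕ
      normal : Fin size → ℝ^ n
      offset : Fin size → Carrier

    ⟦_⟧ : Pred (ℝ^ n) ℓ₂
    ⟦_⟧ x = ∀ i → normal i · x ≤ offset i

    field
      bounded : ∃[ M ] (∀ x → x ∈ ⟦_⟧ → ∀ i → (- M ≤ x i) × (x i ≤ M))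

  open Polytope public using (⟦_⟧)

  module _ {n} (P : Polytope n) where

    record Face (k : ℕ) : Set ℓ where
      field
        functional : ℝ^ n
        value      : Carrier
        valid      : ∀ x → x ∈ ⟦ P ⟧ → functional · x ≤ value

      FacePoints : Pred (ℝ^ n) (ℓ₁ ⊔ ℓ₂)
      FacePoints x = x ∈ ⟦ P ⟧ × functional · x ≈ value

      field
        dimension : HasDimension FacePoints k

    -- Faces are identified when they are equal as point sets.
    faces : ℕ → Setoid ℓ ℓ
    faces k = On.setoid (≐-setoid (ℝ^ n) (ℓ₁ ⊔ ℓ₂)) (Face.FacePoints {k})

    NumberOfFaces : (k N : ℕ) → Set ℓ
    NumberOfFaces k N = Bijection (≡.setoid (Fin N)) (faces k)

    IsVertex : Pred (ℝ^ n) ℓ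
    IsVertex v = Σ (Face 0) λ F → v ∈ Face.FacePoints F

    JoinedByEdge : Rel (ℝ^ n) ℓ
    JoinedByEdge u v = Σ (Face 1) λ E →
      u ∈ Face.FacePoints E × v ∈ Face.FacePoints E

    Maximizer : ℝ^ n → Pred (ℝ^ n) (a ⊔ ℓ₂)
    Maximizer u v = v ∈ ⟦ P ⟧ × (∀ x → x ∈ ⟦ P ⟧ → u · x ≤ u · v)

    UniqueMaximizer : ℝ^ n → Pred (ℝ^ n) ℓ
    UniqueMaximizer u v =
      v ∈ Maximizer u × (∀ x → x ∈ Maximizer u → x ≋ v)

    module _ (w c : ℝ^ n) where

      objective : Carrier → ℝ^ n
      objective t i = w i + t * c i

      -- A shadow simplex path with `len` edges, under an arbitrary tie-breaking.
      -- `breakpoint i` is the parameter at which the path arrives at vertex i,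
      -- so vertex i is optimal from `breakpoint i` to the next breakpoint, and
      -- forever if it is the last one.  The breakpoints need not be distinct:
      -- edges traversed at the same parameter come from ties, and these still
      -- never decrease c.  A vertex that is the unique maximizer for some
      -- parameter t ≥ 0 is always on the path.
      record ShadowPath (len : ℕ) : Set ℓ where
        field
          vertex     : Fin (suc len) → ℝ^ n
          breakpoint : Fin (suc len) → Carrier
          isVertex   : ∀ i → vertex i ∈ IsVertex
          distinct   : ∀ i j → vertex i ≋ vertex j → i ≡ j
          edge       : ∀ (i : Fin len) →
                       JoinedByEdge (vertex (inject₁ i)) (vertex (suc i))
          start      : breakpoint zero ≈ 0#
          increasing : ∀ (i : Fin len) →
                       breakpoint (inject₁ i) ≤ breakpoint (suc i)
          ascending  : ∀ (i : Fin len) →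
                       c · vertex (inject₁ i) ≤ c · vertex (suc i)
          arrive     : ∀ i → vertex i ∈ Maximizer (objective (breakpoint i))
          leave      : ∀ (i : Fin len) →
                       vertex (inject₁ i) ∈ Maximizer (objective (breakpoint (suc i)))
          finish     : ∀ t → breakpoint (fromℕ len) ≤ t →
                       vertex (fromℕ len) ∈ Maximizer (objective t)
          complete   : ∀ t v → 0# ≤ t → v ∈ UniqueMaximizer (objective t) →
                       ∃[ i ] (vertex i ≋ v)

{-# OPTIONS --safe #-}

-- The inequalities ± X k + 7 X (k + 1) + X∗ ≤ b k and X∗ ≤ 0, with b k decreasing
-- fast enough in k, cut out a vertex cluster with one corner for each of the 2 ^ d
-- sequences of signs σ.  Writing an objective X∗ + Σ g k X k as a combination of the
-- normals at the corner σ amounts to r 0 = g 0, r (k + 1) = g (k + 1) - 7 ∣r k∣ with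
-- sign (r k) = σ k, the iteration of a tent map.  So while g 0 sweeps [-1 , 1] and the
-- other g k stay in [2 , 6], every corner becomes the unique maximizer once.
--
-- Take w = (1 , … , 1).  A direction c orthogonal to w has a positive largest
-- coordinate c j, and the other coordinates are at most of the same order.  Hence
-- d + 1 clusters suffice, one for each j, in which g 0 is governed by c j and the
-- lateral g k vary slowly.  The j-th cluster is scaled by B ^ j and shrunk to a small
-- neighbourhood of an apex; as B ^ 2i + B ^ 2j is much larger than B ^ (i + j) for
-- i ≠ j, the apexes can be placed so that each is strictly inside the cones of the
-- others.  Each cluster has 2d + 1 inequalities, and one more bounds the polytope from
-- below.  Each inequality is, at some point, the only tight one, so all are facets.
module Submission where

open import Defs
open import Level using (_⊔_)
open import Algebra.Bundles using (CommutativeRing)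
open import Data.Empty using (⊥; ⊥-elim)
open import Data.Fin.Base as Fin using (Fin; zero; suc; inject₁; punchIn; punchOut; toℕ)
open import Data.Fin.Permutation
  using (Permutation′; _⟨$⟩ʳ_; _⟨$⟩ˡ_; inverseˡ; inverseʳ; transpose)
import Data.Fin.Properties as Fin
open import Data.Integer.Base as ℤ using (ℤ)
import Data.Integer.Properties as ℤ
open import Data.Maybe.Base using (Maybe; just; nothing)
open import Data.Nat.Base as ℕ using (ℕ; zero; suc)
import Data.Nat.Properties as ℕ
open import Data.Product.Base using (Σ; ∃; ∃-syntax; _×_; _,_; proj₁; proj₂)
open import Data.Product.Function.NonDependent.Propositional using (_×-↔_)
import Data.Sign.Base as Sign
open import Data.Sum.Base using (_⊎_; inj₁; inj₂)
open import Data.Sum.Function.Propositional using (_⊎-↔_)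
open import Data.Vec.Functional using (_∷_; removeAt)
open import Function.Base using (_∘_)
open import Function.Bundles using (_↔_; mk↔ₛ′; Inverse)
open import Function.Construct.Composition using (_↔-∘_)
open import Function.Construct.Identity using (↔-id)
open import Relation.Binary.Core using (Rel)
open import Relation.Binary.Definitions using (tri<; tri≈; tri>)
open import Relation.Binary.PropositionalEquality as ≡ using (_≡_; _≢_)
open import Relation.Binary.Structures using (IsDecTotalOrder)
open import Relation.Nullary.Decidable using (Dec; yes; no)
open import Relation.Nullary.Negation using (¬_)
open import Relation.Unary using (Pred)

-- The slope 7 and the window [2 , 6] fit together: g - 7 ∣r∣ is at least 1 at r = 0 and at most -1
-- at ∣r∣ = 1. For a fixed σ only one branch of each tent map is followed, so every residual is
-- affine in the parameter and its crossings are explicit. The obstacle to the placement is that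
-- each cluster must leave the others intact although c is arbitrary. Let P j be the scale of the
-- cluster j and n the dimension. The radial coefficient starts at -4 n and the coordinates of the
-- apex j sum to -2 n (P j)². Going from the apex i to the apex j then changes the X∗ of the cluster
-- i by at most -2 n ((P i)² + (P j)²) plus a multiple of P i P j. The main term is negative and
-- symmetric in i and j, so separated scales suffice. The length is bounded by counting: a shadow
-- path passes through every vertex that is the unique maximizer at some nonnegative parameter. The
-- same optimality, in the directions ± (n δ i - 𝟏), supplies the upper bounds that make the
-- polyhedron a polytope.

module Development {a ℓ₁ ℓ₂} (ℝ : CompleteOrderedField a ℓ₁ ℓ₂) where

  open Geometry ℝ

  -- Ordered fields

  open CompleteOrderedField ℝ hiding (zero) renaming (*-nonneg to 0≤-*)
  open IsDecTotalOrder isDecTotalOrder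
    using (antisym; total; _≟_; _≤?_; ≤-resp-≈)
    renaming (refl to ≤-refl; trans to ≤-trans; reflexive to ≤-reflexive)
  open import Algebra.Properties.Semiring.Mult.TCOptimised semiring
    using (×-homo-+; ×1-homo-*) renaming (_×_ to _•_)
  open import Algebra.Properties.Ring ring
    using (-‿involutive; -‿distribˡ-*; -‿distribʳ-*; -‿+-comm; -0#≈0#)
  open import Algebra.Solver.Ring.AlmostCommutativeRing
    using (fromCommutativeRing; _-Raw-AlmostCommutative⟶_)
  open import Relation.Binary.Reasoning.Setoid setoid

  private
    -- Integer coefficients make numerals such as 7 and 12 part of the normal forms of the ring
    -- solver, with equality of coefficients decided in the integers.
    ⟦_⟧ᶻ : ℤ → Carrier
    ⟦ ℤ.+ n ⟧ᶻ = n • 1#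
    ⟦ ℤ.-[1+ n ] ⟧ᶻ = - (suc n • 1#)

    ×1-suc : ∀ n → suc n • 1# ≈ 1# + n • 1#
    ×1-suc n = ×-homo-+ 1# 1 n

    ⊖-homo : ∀ m n → ⟦ m ℤ.⊖ n ⟧ᶻ ≈ m • 1# - n • 1#
    ⊖-homo m zero = sym (trans (+-congˡ -0#≈0#) (+-identityʳ _))
    ⊖-homo zero (suc n) = sym (+-identityˡ _)
    ⊖-homo (suc m) (suc n) = begin
      ⟦ suc m ℤ.⊖ suc n ⟧ᶻ             ≡⟨ ≡.cong ⟦_⟧ᶻ (ℤ.[1+m]⊖[1+n]≡m⊖n m n) ⟩
      ⟦ m ℤ.⊖ n ⟧ᶻ                     ≈⟨ ⊖-homo m n ⟩
      m • 1# - n • 1#                  ≈⟨ +-congʳ (sym (+-identityˡ _)) ⟩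
      0# + m • 1# - n • 1#             ≈⟨ +-congʳ (+-congʳ (sym (-‿inverseʳ 1#))) ⟩
      1# - 1# + m • 1# - n • 1#        ≈⟨ +-congʳ (trans (+-assoc _ _ _) (trans (+-congˡ (+-comm _ _)) (sym (+-assoc _ _ _)))) ⟩
      1# + m • 1# - 1# - n • 1#        ≈⟨ +-assoc _ _ _ ⟩
      1# + m • 1# + (- 1# - n • 1#)    ≈⟨ +-cong (sym (×1-suc m)) (trans (-‿+-comm _ _) (-‿cong (sym (×1-suc n)))) ⟩
      suc m • 1# - suc n • 1#          ∎

    +-homo : ∀ i j → ⟦ i ℤ.+ j ⟧ᶻ ≈ ⟦ i ⟧ᶻ + ⟦ j ⟧ᶻ
    +-homo (ℤ.+ m) (ℤ.+ n) = ×-homo-+ 1# m n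
    +-homo (ℤ.+ m) (ℤ.-[1+ n ]) = ⊖-homo m (suc n)
    +-homo (ℤ.-[1+ m ]) (ℤ.+ n) = trans (⊖-homo n (suc m)) (+-comm _ _)
    +-homo (ℤ.-[1+ m ]) (ℤ.-[1+ n ]) = begin
      - (suc (suc (m ℕ.+ n)) • 1#)        ≡⟨ ≡.cong (λ k → - (suc k • 1#)) (≡.sym (ℕ.+-suc m n)) ⟩
      - ((suc m ℕ.+ suc n) • 1#)          ≈⟨ -‿cong (×-homo-+ 1# (suc m) (suc n)) ⟩
      - (suc m • 1# + suc n • 1#)         ≈⟨ sym (-‿+-comm _ _) ⟩
      - (suc m • 1#) - suc n • 1#         ∎

    neg-homo : ∀ i → ⟦ ℤ.- i ⟧ᶻ ≈ - ⟦ i ⟧ᶻ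
    neg-homo (ℤ.+ zero) = sym -0#≈0#
    neg-homo (ℤ.+ (suc n)) = refl
    neg-homo (ℤ.-[1+ n ]) = sym (-‿involutive _)

    neg-pos : ∀ n → ⟦ Sign.- ℤ.◃ n ⟧ᶻ ≈ - (n • 1#)
    neg-pos zero = sym -0#≈0#
    neg-pos (suc n) = refl

    *-homo : ∀ i j → ⟦ i ℤ.* j ⟧ᶻ ≈ ⟦ i ⟧ᶻ * ⟦ j ⟧ᶻ
    *-homo (ℤ.+ m) (ℤ.+ n) =
      trans (reflexive (≡.cong ⟦_⟧ᶻ (ℤ.+◃n≡+n (m ℕ.* n)))) (×1-homo-* m n)
    *-homo (ℤ.+ m) (ℤ.-[1+ n ]) =
      trans (neg-pos (m ℕ.* suc n)) (trans (-‿cong (×1-homo-* m (suc n))) (-‿distribʳ-* _ _))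
    *-homo (ℤ.-[1+ m ]) (ℤ.+ n) =
      trans (neg-pos (suc m ℕ.* n)) (trans (-‿cong (×1-homo-* (suc m) n)) (-‿distribˡ-* _ _))
    *-homo (ℤ.-[1+ m ]) (ℤ.-[1+ n ]) = begin
      (suc m ℕ.* suc n) • 1#            ≈⟨ ×1-homo-* (suc m) (suc n) ⟩
      suc m • 1# * (suc n • 1#)         ≈⟨ sym (-‿involutive _) ⟩
      - - (suc m • 1# * (suc n • 1#))   ≈⟨ -‿cong (-‿distribˡ-* _ _) ⟩
      - (- (suc m • 1#) * (suc n • 1#)) ≈⟨ -‿distribʳ-* _ _ ⟩
      - (suc m • 1#) * - (suc n • 1#)   ∎

    homomorphism : CommutativeRing.rawRing ℤ.+-*-commutativeRing -Raw-AlmostCommutative⟶ fromCommutativeRing commutativeRing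
    homomorphism = record
      { ⟦_⟧ = ⟦_⟧ᶻ ; +-homo = +-homo ; *-homo = *-homo ; -‿homo = neg-homo
      ; 0-homo = refl ; 1-homo = refl }

    coeff-≟ : ∀ i j → Maybe (⟦ i ⟧ᶻ ≈ ⟦ j ⟧ᶻ)
    coeff-≟ i j with i ℤ.≟ j
    ... | yes i≡j = just (reflexive (≡.cong ⟦_⟧ᶻ i≡j))
    ... | no  _   = nothing

  open import Algebra.Solver.Ring _ _ homomorphism coeff-≟
    using (Polynomial; solve; con; _:+_; _:*_; _:-_; :-_; _:=_)

  :0 :1 : ∀ {n} → Polynomial n
  :0 = con (ℤ.+ 0)
  :1 = con (ℤ.+ 1)

  -- Strict order and linear arithmetic

  infix 4 _<_

  _<_ : Rel Carrier ℓ₂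
  x < y = ¬ (y ≤ x)

  abstract
    ≤-cong : ∀ {x x′ y y′} → x ≈ x′ → y ≈ y′ → x ≤ y → x′ ≤ y′
    ≤-cong p q h = proj₁ ≤-resp-≈ q (proj₂ ≤-resp-≈ p h)

    <-cong : ∀ {x x′ y y′} → x ≈ x′ → y ≈ y′ → x < y → x′ < y′
    <-cong p q h y′≤x′ = h (≤-cong (sym q) (sym p) y′≤x′)

    <⇒≤ : ∀ {x y} → x < y → x ≤ y
    <⇒≤ {x} {y} x<y with total x y
    ... | inj₁ x≤y = x≤y
    ... | inj₂ y≤x = ⊥-elim (x<y y≤x)

    <-≤-trans : ∀ {x y z} → x < y → y ≤ z → x < z
    <-≤-trans x<y y≤z z≤x = x<y (≤-trans y≤z z≤x)

    ≤-<-trans : ∀ {x y z} → x ≤ y → y < z → x < z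
    ≤-<-trans x≤y y<z z≤x = y<z (≤-trans z≤x x≤y)

    ≤∧≉⇒< : ∀ {x y} → x ≤ y → ¬ (x ≈ y) → x < y
    ≤∧≉⇒< x≤y x≉y y≤x = x≉y (antisym x≤y y≤x)

    ≮⇒≥ : ∀ {x y} → ¬ (x < y) → y ≤ x
    ≮⇒≥ {x} {y} h with y ≤? x
    ... | yes y≤x = y≤x
    ... | no  y≰x = ⊥-elim (h y≰x)

    -- Linear arithmetic: an inequality is proved by exhibiting the difference of
    -- its sides as a visibly nonnegative expression.
    by-≤ : ∀ {x y} e → 0# ≤ e → y - x ≈ e → x ≤ y
    by-≤ {x} {y} e 0≤e eq =
      ≤-cong (+-identityˡ x) (trans (+-congʳ (sym eq)) (solve 2 (λ x y → y :- x :+ x := y) refl x y))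
        (+-monoˡ-≤ x 0≤e)

    diff-≤ : ∀ {x y} → x ≤ y → 0# ≤ y - x
    diff-≤ {x} x≤y = ≤-cong (-‿inverseʳ x) refl (+-monoˡ-≤ (- x) x≤y)

    by-< : ∀ {x y} e → 0# < e → y - x ≈ e → x < y
    by-< {x} {y} e 0<e eq y≤x = 0<e (by-≤ (x - y) (diff-≤ y≤x)
      (trans (+-congˡ (-‿cong (sym eq))) (solve 2 (λ x y → :0 :- (y :- x) := x :- y) refl x y)))

    diff-< : ∀ {x y} → x < y → 0# < y - x
    diff-< {x} {y} x<y h = x<y (by-≤ _ (diff-≤ h)
      (solve 2 (λ x y → x :- y := :0 :- (y :- x)) refl x y))

    0≤-+ : ∀ {x y} → 0# ≤ x → 0# ≤ y → 0# ≤ x + y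
    0≤-+ {x} {y} 0≤x 0≤y = ≤-trans 0≤y (≤-cong (+-identityˡ y) refl (+-monoˡ-≤ y 0≤x))

    0<-+ : ∀ {x y} → 0# < x → 0# ≤ y → 0# < x + y
    0<-+ {x} {y} 0<x 0≤y = <-≤-trans 0<x (by-≤ y 0≤y (solve 2 (λ x y → x :+ y :- x := y) refl x y))

    0<-+ʳ : ∀ {x y} → 0# ≤ x → 0# < y → 0# < x + y
    0<-+ʳ {x} {y} 0≤x 0<y = <-cong refl (+-comm y x) (0<-+ 0<y 0≤x)

    <⇒≉ : ∀ {x y} → x < y → ¬ (y ≈ x)
    <⇒≉ x<y y≈x = x<y (≤-reflexive y≈x)

    *-cancel-0 : ∀ {x y} → ¬ (x ≈ 0#) → x * y ≈ 0# → y ≈ 0#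
    *-cancel-0 {x} {y} x≉0 xy≈0 with inverse x x≉0
    ... | x⁻¹ , xx⁻¹≈1 = begin
      y              ≈⟨ sym (*-identityˡ y) ⟩
      1# * y         ≈⟨ *-congʳ (sym xx⁻¹≈1) ⟩
      x * x⁻¹ * y    ≈⟨ solve 3 (λ x i y → x :* i :* y := i :* (x :* y)) refl x x⁻¹ y ⟩
      x⁻¹ * (x * y)  ≈⟨ *-congˡ xy≈0 ⟩
      x⁻¹ * 0#       ≈⟨ zeroʳ x⁻¹ ⟩
      0#             ∎

    0<-* : ∀ {x y} → 0# < x → 0# < y → 0# < x * y
    0<-* 0<x 0<y xy≤0 =
      <⇒≉ 0<y (*-cancel-0 (<⇒≉ 0<x) (antisym xy≤0 (0≤-* (<⇒≤ 0<x) (<⇒≤ 0<y))))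

    0≤-neg : ∀ {x} → x ≤ 0# → 0# ≤ - x
    0≤-neg {x} x≤0 = ≤-cong refl (+-identityˡ (- x)) (diff-≤ x≤0)

    0≤x*x : ∀ x → 0# ≤ x * x
    0≤x*x x with total 0# x
    ... | inj₁ 0≤x = 0≤-* 0≤x 0≤x
    ... | inj₂ x≤0 = ≤-cong refl (solve 1 (λ x → :- x :* :- x := x :* x) refl x)
                       (0≤-* (0≤-neg x≤0) (0≤-neg x≤0))

    0≤1 : 0# ≤ 1#
    0≤1 = ≤-cong refl (*-identityˡ 1#) (0≤x*x 1#)

    0<1 : 0# < 1#
    0<1 1≤0 = 0≉1 (antisym 0≤1 1≤0)

    *-cancelˡ-0≤ : ∀ {x y} → 0# < x → 0# ≤ x * y → 0# ≤ y
    *-cancelˡ-0≤ {x} {y} 0<x 0≤xy = ≮⇒≥ λ y<0 →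
      0<-* 0<x (<-cong refl (+-identityˡ (- y)) (diff-< y<0))
        (by-≤ _ 0≤xy (solve 2 (λ x y → :0 :- x :* :- y := x :* y) refl x y))

    reciprocal : ∀ x → 0# < x → ∃[ y ] (0# < y × x * y ≈ 1#)
    reciprocal x 0<x with inverse x (<⇒≉ 0<x)
    ... | y , xy≈1 = y , ≤∧≉⇒< (*-cancelˡ-0≤ 0<x (≤-cong refl (sym xy≈1) 0≤1))
                           (λ 0≈y → 0≉1 (trans (sym (trans (*-congˡ (sym 0≈y)) (zeroʳ x))) xy≈1)) , xy≈1

  -- Linear algebra

  open import Algebra.Properties.Semiring.Sum semiring
    using (sum-permute; sum-remove)
  open import Algebra.Properties.Semiring.Sum semiring
    using (sum-cong-≋; ∑-distrib-+; ∑-comm; *-distribˡ-sum; sum-replicate-zero)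

  infixl 6 _+ᵥ_
  infixr 7 _*ᵥ_

  _+ᵥ_ : ∀ {n} → ℝ^ n → ℝ^ n → ℝ^ n
  (u +ᵥ v) i = u i + v i

  _*ᵥ_ : ∀ {n} → Carrier → ℝ^ n → ℝ^ n
  (k *ᵥ u) i = k * u i

  δ : ∀ {n} → Fin n → ℝ^ n
  δ zero    zero    = 1#
  δ zero    (suc _) = 0#
  δ (suc _) zero    = 0#
  δ (suc i) (suc j) = δ i j

  abstract
    δ-diag : ∀ {n} (i : Fin n) → δ i i ≈ 1#
    δ-diag zero    = refl
    δ-diag (suc i) = δ-diag i

    δ-off : ∀ {n} {i j : Fin n} → i ≢ j → δ i j ≈ 0#
    δ-off {i = zero}  {zero}  i≢j = ⊥-elim (i≢j ≡.refl)
    δ-off {i = zero}  {suc j} i≢j = refl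
    δ-off {i = suc i} {zero}  i≢j = refl
    δ-off {i = suc i} {suc j} i≢j = δ-off (i≢j ∘ ≡.cong suc)

    δ-sym : ∀ {n} (i j : Fin n) → δ i j ≈ δ j i
    δ-sym zero    zero    = refl
    δ-sym zero    (suc j) = refl
    δ-sym (suc i) zero    = refl
    δ-sym (suc i) (suc j) = δ-sym i j

    sum-cong : ∀ {n} {u v : ℝ^ n} → u ≋ v → sum u ≈ sum v
    sum-cong = sum-cong-≋

    sum-+ : ∀ {n} (u v : ℝ^ n) → sum (λ i → u i + v i) ≈ sum u + sum v
    sum-+ = ∑-distrib-+

    sum-* : ∀ {n} k (u : ℝ^ n) → sum (λ i → k * u i) ≈ k * sum u
    sum-* k u = sym (*-distribˡ-sum k u)

    sum-swap : ∀ {m n} (f : Fin m → ℝ^ n) →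
               sum (λ i → sum (f i)) ≈ sum (λ j → sum λ i → f i j)
    sum-swap = ∑-comm

    sum-0 : ∀ {n} {u : ℝ^ n} → u ≋ 𝟎 → sum u ≈ 0#
    sum-0 {n} u≋0 = trans (sum-cong u≋0) (sum-replicate-zero n)

    ·-cong : ∀ {n} {u u′ x x′ : ℝ^ n} → u ≋ u′ → x ≋ x′ → u · x ≈ u′ · x′
    ·-cong p q = sum-cong λ i → *-cong (p i) (q i)

    ·-congʳ : ∀ {n} (u : ℝ^ n) {x x′ : ℝ^ n} → x ≋ x′ → u · x ≈ u · x′
    ·-congʳ u = ·-cong {u = u} (λ _ → refl)

    ·-comm : ∀ {n} (u x : ℝ^ n) → u · x ≈ x · u
    ·-comm u x = sum-cong λ i → *-comm (u i) (x i)

    ·-+ˡ : ∀ {n} (u v x : ℝ^ n) → (u +ᵥ v) · x ≈ u · x + v · x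
    ·-+ˡ u v x = trans (sum-cong λ i → distribʳ (x i) (u i) (v i)) (sum-+ (λ i → u i * x i) (λ i → v i * x i))

    ·-*ˡ : ∀ {n} k (u x : ℝ^ n) → (k *ᵥ u) · x ≈ k * (u · x)
    ·-*ˡ k u x = trans (sum-cong λ i → *-assoc k (u i) (x i)) (sum-* k (λ i → u i * x i))

    ·-+ʳ : ∀ {n} (u x y : ℝ^ n) → u · (x +ᵥ y) ≈ u · x + u · y
    ·-+ʳ u x y = trans (·-comm u _) (trans (·-+ˡ x y u) (+-cong (·-comm x u) (·-comm y u)))

    ·-*ʳ : ∀ {n} k (u x : ℝ^ n) → u · (k *ᵥ x) ≈ k * (u · x)
    ·-*ʳ k u x = trans (·-comm u _) (trans (·-*ˡ k x u) (*-congˡ (·-comm x u)))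

    ·-𝟎ʳ : ∀ {n} (u : ℝ^ n) → u · 𝟎 ≈ 0#
    ·-𝟎ʳ u = sum-0 λ i → zeroʳ (u i)

    ·-𝟎ˡ : ∀ {n} (u : ℝ^ n) → 𝟎 · u ≈ 0#
    ·-𝟎ˡ u = sum-0 λ i → zeroˡ (u i)

    δ-· : ∀ {n} i (x : ℝ^ n) → δ i · x ≈ x i
    δ-· zero x = trans (+-cong (*-identityˡ _) (sum-0 λ i → zeroˡ (x (suc i)))) (+-identityʳ _)
    δ-· (suc i) x = trans (+-cong (zeroˡ _) (δ-· i (x ∘ suc))) (+-identityˡ _)

    ·-δ : ∀ {n} i (x : ℝ^ n) → x · δ i ≈ x i
    ·-δ i x = trans (·-comm x (δ i)) (δ-· i x)

    ·-combination : ∀ {k n} (u : ℝ^ n) (μ : Fin k → Carrier) (p : Fin k → ℝ^ n) →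
                    u · combination μ p ≈ sum λ j → μ j * (u · p j)
    ·-combination u μ p = begin
      sum (λ i → u i * sum λ j → μ j * p j i)     ≈⟨ sum-cong (λ i → sym (sum-* (u i) (λ j → μ j * p j i))) ⟩
      sum (λ i → sum λ j → u i * (μ j * p j i))   ≈⟨ sum-swap (λ i j → u i * (μ j * p j i)) ⟩
      sum (λ j → sum λ i → u i * (μ j * p j i))   ≈⟨ sum-cong (λ j → trans
          (sum-cong λ i → solve 3 (λ u m p → u :* (m :* p) := m :* (u :* p)) refl (u i) (μ j) (p j i))
          (sum-* (μ j) (λ i → u i * p j i))) ⟩
      sum (λ j → μ j * (u · p j))                 ∎

    ≋𝟎-or-nonzero : ∀ {n} (x : ℝ^ n) → ¬ (x ≋ 𝟎) → ∃[ i ] ¬ (x i ≈ 0#)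
    ≋𝟎-or-nonzero x = Fin.¬∀⟶∃¬ _ _ (λ i → x i ≟ 0#)

    0≤sum : ∀ {n} {x : ℝ^ n} → (∀ i → 0# ≤ x i) → 0# ≤ sum x
    0≤sum {zero}  h = ≤-refl
    0≤sum {suc n} h = 0≤-+ (h zero) (0≤sum (h ∘ suc))

    sum-mono : ∀ {n} {x y : ℝ^ n} → (∀ i → x i ≤ y i) → sum x ≤ sum y
    sum-mono {zero}  h = ≤-refl
    sum-mono {suc n} {x} {y} h = by-≤ _ (0≤-+ (diff-≤ (h zero)) (diff-≤ (sum-mono (h ∘ suc))))
      (solve 4 (λ a b c d → (b :+ d) :- (a :+ c) := (b :- a) :+ (d :- c)) refl (x zero) (y zero) (sum (x ∘ suc)) (sum (y ∘ suc)))

    term≤sum : ∀ {n} {x : ℝ^ n} → (∀ i → 0# ≤ x i) → ∀ i → x i ≤ sum x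
    term≤sum {x = x} h zero = by-≤ _ (0≤sum (h ∘ suc))
      (solve 2 (λ a b → a :+ b :- a := b) refl (x zero) (sum (x ∘ suc)))
    term≤sum {x = x} h (suc i) = ≤-trans (term≤sum (h ∘ suc) i)
      (by-≤ _ (h zero) (solve 2 (λ a b → a :+ b :- b := a) refl (x zero) (sum (x ∘ suc))))

    x·x≈0⇒x≋𝟎 : ∀ {n} (x : ℝ^ n) → x · x ≤ 0# → x ≋ 𝟎
    x·x≈0⇒x≋𝟎 x h i with x i ≟ 0#
    ... | yes xᵢ≈0 = xᵢ≈0
    ... | no  xᵢ≉0 = ⊥-elim (xᵢ≉0 (*-cancel-0 xᵢ≉0
      (antisym (≤-trans (term≤sum (λ j → 0≤x*x (x j)) i) h) (0≤x*x (x i)))))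

  ι : ℕ → Carrier
  ι n = sum {n} λ _ → 1#

  abstract
    sum-const : ∀ n x → sum {n} (λ _ → x) ≈ ι n * x
    sum-const n x = begin
      sum {n} (λ _ → x)       ≈⟨ sum-cong {n} (λ _ → sym (*-identityʳ x)) ⟩
      sum {n} (λ _ → x * 1#)  ≈⟨ sum-* {n} x (λ _ → 1#) ⟩
      x * ι n                 ≈⟨ *-comm x (ι n) ⟩
      ι n * x                 ∎

    1≤ι : ∀ n → 1# ≤ ι (suc n)
    1≤ι n = term≤sum {suc n} (λ _ → 0≤1) zero

    -- Gaussian elimination on the first unknown. If it occurs in no equation, it can be 1 and all
    -- others 0. Otherwise a pivot row p removes it from the other m rows, and a solution of these
    -- extends by solving the row p for it.
    nontrivial-solution : ∀ m (A : Fin m → ℝ^ (suc m)) →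
                          ∃[ x ] (¬ (x ≋ 𝟎) × ∀ i → Orthogonal (A i) x)
    nontrivial-solution zero A = (λ _ → 1#) , (λ h → 0≉1 (sym (h zero))) , λ ()
    nontrivial-solution (suc m) A with Fin.all? (λ i → A i zero ≟ 0#)
    ... | yes col≈0 = δ zero , (λ h → 0≉1 (sym (h zero))) , λ i → trans (·-δ zero (A i)) (col≈0 i)
    ... | no  col≉0 with Fin.¬∀⟶∃¬ _ _ (λ i → A i zero ≟ 0#) col≉0
    ... | p , Ap≉0 with inverse (A p zero) Ap≉0
    ... | r , Apr≈1 = x , (λ h → y≉0 (h ∘ suc)) , orthogonal
      where
      reduced : Fin m → ℝ^ (suc m)
      multiple : Carrier → ℝ^ (suc m)
      multiple b = (- (b * r)) *ᵥ (A p ∘ suc)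
      reduced k = A (punchIn p k) ∘ suc +ᵥ multiple (A (punchIn p k) zero)
      ih : ∃[ x ] (¬ (x ≋ 𝟎) × ∀ i → Orthogonal (reduced i) x)
      ih = nontrivial-solution m reduced
      y : ℝ^ (suc m)
      y = proj₁ ih
      y≉0 : ¬ (y ≋ 𝟎)
      y≉0 = proj₁ (proj₂ ih)
      s : Carrier
      s = (A p ∘ suc) · y
      x : ℝ^ (suc (suc m))
      x = (- (r * s)) ∷ y
      orthogonal : ∀ i → Orthogonal (A i) x
      orthogonal i with p Fin.≟ i
      ... | yes ≡.refl = begin
        A p zero * - (r * s) + s  ≈⟨ solve 3 (λ a r s → a :* :- (r :* s) :+ s := s :* (:1 :- a :* r)) refl (A p zero) r s ⟩
        s * (1# - A p zero * r)   ≈⟨ *-congˡ (trans (+-congˡ (-‿cong Apr≈1)) (-‿inverseʳ 1#)) ⟩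
        s * 0#                    ≈⟨ zeroʳ s ⟩
        0#                        ∎
      ... | no p≢i = ≡.subst (λ i → Orthogonal (A i) x) (Fin.punchIn-punchOut p≢i) (begin
        b * - (r * s) + t                      ≈⟨ solve 4 (λ b r s t → b :* :- (r :* s) :+ t := t :+ :- (b :* r) :* s) refl b r s t ⟩
        t + - (b * r) * s                      ≈⟨ +-congˡ (sym (·-*ˡ (- (b * r)) (A p ∘ suc) y)) ⟩
        t + multiple b · y                     ≈⟨ sym (·-+ˡ (A (punchIn p k) ∘ suc) (multiple b) y) ⟩
        reduced k · y                          ≈⟨ proj₂ (proj₂ ih) k ⟩
        0#                                     ∎)
        where
        k : Fin m
        k = punchOut p≢i
        b t : Carrier
        b = A (punchIn p k) zero
        t = (A (punchIn p k) ∘ suc) · y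

    -- Homogenise: A x = τ y is a system of n equations in the n + 1 unknowns (τ , x). In a
    -- nontrivial solution τ is nonzero, since otherwise x would be a nonzero element of the kernel;
    -- divide by τ.
    injective⇒surjective : ∀ {n} (A : Fin n → ℝ^ n) →
                           (∀ x → (∀ i → A i · x ≈ 0#) → x ≋ 𝟎) →
                           ∀ (y : ℝ^ n) → ∃[ x ] (∀ i → A i · x ≈ y i)
    injective⇒surjective {n} A injective y
      with nontrivial-solution n (λ i → (- y i) ∷ A i)
    ... | x , x≉0 , orthogonal with inverse (x zero) τ≉0
      where
      τ≉0 : ¬ (x zero ≈ 0#)
      τ≉0 τ≈0 = x≉0 λ { zero → τ≈0 ; (suc i) → injective (x ∘ suc) (λ i → begin
        A i · (x ∘ suc)                       ≈⟨ sym (+-identityˡ _) ⟩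
        0# + A i · (x ∘ suc)                  ≈⟨ +-congʳ (sym (trans (*-congˡ τ≈0) (zeroʳ _))) ⟩
        - y i * x zero + A i · (x ∘ suc)      ≈⟨ orthogonal i ⟩
        0#                                    ∎) i }
    ... | r , τr≈1 = r *ᵥ (x ∘ suc) , λ i → begin
        A i · (r *ᵥ (x ∘ suc))  ≈⟨ ·-*ʳ r (A i) (x ∘ suc) ⟩
        r * (A i · (x ∘ suc))   ≈⟨ solve 4 (λ r s y t → r :* s := r :* ((:- y) :* t :+ s) :+ t :* r :* y) refl r (A i · (x ∘ suc)) (y i) (x zero) ⟩
        r * (- y i * x zero + A i · (x ∘ suc)) + x zero * r * y i ≈⟨ +-cong (trans (*-congˡ (orthogonal i)) (zeroʳ r)) (trans (*-congʳ τr≈1) (*-identityˡ _)) ⟩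
        0# + y i                ≈⟨ +-identityˡ _ ⟩
        y i                     ∎

  -- Facets of an irredundant system of inequalities

  -- Truth for all sufficiently small positive ε. Finitely many such requirements have a common ε,
  -- which replaces explicit estimates of how far the clusters have to shrink.
  Eventually : ∀ {q} → Pred Carrier q → Set (a ⊔ ℓ₂ ⊔ q)
  Eventually Q = ∃[ ε₀ ] (0# < ε₀ × ∀ ε → 0# < ε → ε ≤ ε₀ → Q ε)

  abstract
    eventually-∀ : ∀ {q n} {Q : Fin n → Pred Carrier q} →
                   (∀ i → Eventually (Q i)) → Eventually (λ ε → ∀ i → Q i ε)
    eventually-∀ {n = zero} h = 1# , 0<1 , λ _ _ _ ()
    eventually-∀ {n = suc n} h with h zero | eventually-∀ (h ∘ suc)
    ... | ε₁ , 0<ε₁ , h₁ | ε₂ , 0<ε₂ , h₂ with total ε₁ ε₂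
    ... | inj₁ ε₁≤ε₂ = ε₁ , 0<ε₁ , λ { ε 0<ε ε≤ zero → h₁ ε 0<ε ε≤
                                     ; ε 0<ε ε≤ (suc i) → h₂ ε 0<ε (≤-trans ε≤ ε₁≤ε₂) i }
    ... | inj₂ ε₂≤ε₁ = ε₂ , 0<ε₂ , λ { ε 0<ε ε≤ zero → h₁ ε 0<ε (≤-trans ε≤ ε₂≤ε₁)
                                     ; ε 0<ε ε≤ (suc i) → h₂ ε 0<ε ε≤ i }

    eventually-pure : ∀ {q} {Q : Pred Carrier q} → (∀ ε → 0# < ε → Q ε) → Eventually Q
    eventually-pure h = 1# , 0<1 , λ ε 0<ε _ → h ε 0<ε

    eventually-∃ : ∀ {q} {Q : Pred Carrier q} → Eventually Q → ∃[ ε ] (0# < ε × Q ε)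
    eventually-∃ (ε , 0<ε , h) = ε , 0<ε , h ε 0<ε ≤-refl

    eventually-linear : ∀ {g} u → 0# < g → Eventually (λ ε → ε * u < g)
    eventually-linear {g} u 0<g with u ≤? 0#
    ... | yes u≤0 = eventually-pure λ ε 0<ε → by-< (g + ε * (- u))
      (0<-+ 0<g (0≤-* (<⇒≤ 0<ε) (0≤-neg u≤0)))
      (solve 3 (λ g e u → g :- e :* u := g :+ e :* :- u) refl g ε u)
    ... | no u≰0 = small (reciprocal (u + 1#) 0<u+1)
      where
      0<u+1 : 0# < u + 1#
      0<u+1 = 0<-+ u≰0 0≤1
      small : ∃[ r ] (0# < r × (u + 1#) * r ≈ 1#) → Eventually (λ ε → ε * u < g)
      -- For ε ≤ g / (u + 1) one gets ε u ≤ g - ε; the added 1 makes the inequality strict.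
      small (r , 0<r , [u+1]r≈1) = g * r , 0<-* 0<g 0<r , λ ε 0<ε ε≤gr →
        by-< ((u + 1#) * (g * r - ε) + ε)
          (0<-+ʳ (0≤-* (<⇒≤ 0<u+1) (diff-≤ ε≤gr)) 0<ε)
          (begin
            g - ε * u                                     ≈⟨ +-congʳ (sym (trans (*-congˡ [u+1]r≈1) (*-identityʳ g))) ⟩
            g * ((u + 1#) * r) - ε * u                    ≈⟨ solve 4 (λ g u r e → g :* ((u :+ :1) :* r) :- e :* u := (u :+ :1) :* (g :* r :- e) :+ e) refl g u r ε ⟩
            (u + 1#) * (g * r - ε) + ε                    ∎)

    sum-single : ∀ {n} (t : ℝ^ n) i → (∀ j → j ≢ i → t j ≈ 0#) → sum t ≈ t i
    sum-single t i h = begin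
      sum t                 ≈⟨ sum-cong (λ j → term j (i Fin.≟ j)) ⟩
      sum (λ j → δ i j * t j) ≈⟨ δ-· i t ⟩
      t i                   ∎
      where
      term : ∀ j → Dec (i ≡ j) → t j ≈ δ i j * t j
      term j (yes ≡.refl) = sym (trans (*-congʳ (δ-diag i)) (*-identityˡ _))
      term j (no i≢j) = trans (h j (i≢j ∘ ≡.sym)) (sym (trans (*-congʳ (δ-off i≢j)) (zeroˡ _)))

    δ-punchIn : ∀ {n} (p : Fin (suc n)) k l → δ (punchIn p k) (punchIn p l) ≈ δ k l
    δ-punchIn p k l with k Fin.≟ l
    ... | yes ≡.refl = trans (δ-diag (punchIn p k)) (sym (δ-diag k))
    ... | no  k≢l    = trans (δ-off (k≢l ∘ Fin.punchIn-injective p k l)) (sym (δ-off k≢l))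

    sum-affine : ∀ {k} (μ y : ℝ^ k) s t → (∀ j → y j ≈ s) → sum μ ≈ t → sum (λ j → μ j * y j) ≈ s * t
    sum-affine μ y s t y≈s Σμ≈t = begin
      sum (λ j → μ j * y j)  ≈⟨ sum-cong (λ j → trans (*-congˡ (y≈s j)) (*-comm (μ j) s)) ⟩
      sum (λ j → s * μ j)    ≈⟨ sum-* s μ ⟩
      s * sum μ              ≈⟨ *-congˡ Σμ≈t ⟩
      s * t                  ∎

    ·-difference : ∀ {n} (u x y : ℝ^ n) → u · (x +ᵥ (- 1#) *ᵥ y) ≈ u · x - u · y
    ·-difference u x y = trans (·-+ʳ u x ((- 1#) *ᵥ y)) (+-congˡ (trans (·-*ʳ (- 1#) u y)
      (solve 1 (λ y → :- :1 :* y := :- y) refl (u · y))))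

    ·-step : ∀ {n} (u q h : ℝ^ n) ε → u · (q +ᵥ ε *ᵥ h) ≈ u · q + ε * (u · h)
    ·-step u q h ε = trans (·-+ʳ u q (ε *ᵥ h)) (+-congˡ (·-*ʳ ε u h))

    ·-congˡ : ∀ {n} {u v : ℝ^ n} x → u ≋ v → u · x ≈ v · x
    ·-congˡ x u≋v = ·-cong {x = x} u≋v (λ _ → refl)

    ≋𝟎⇒·≈0 : ∀ {n} {u : ℝ^ n} x → u ≋ 𝟎 → u · x ≈ 0#
    ≋𝟎⇒·≈0 x u≋0 = trans (·-congˡ x u≋0) (·-𝟎ˡ x)

    -- A step along u itself raises u · q by ε (u · u), so without an increase u · u ≤ 0.
    no-increase⇒≋𝟎 : ∀ {n} (u q : ℝ^ n) ε → 0# < ε → u · (q +ᵥ ε *ᵥ u) ≤ u · q → u ≋ 𝟎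
    no-increase⇒≋𝟎 u q ε 0<ε h = x·x≈0⇒x≋𝟎 u (≮⇒≥ λ 0<u·u → 0<-* 0<ε 0<u·u (by-≤ _ (diff-≤ h)
      (trans (solve 2 (λ a b → :0 :- b := a :- (a :+ b)) refl (u · q) (ε * (u · u)))
        (+-congˡ (-‿cong (sym (·-step u q u ε)))))))

  -- The point q and its translates in the directions b l, with ε small enough in the applications
  -- to keep them inside a given set. The functionals β l, dual to the directions, read off the
  -- affine weights and so show independence.
  module AffineFrame {k n} (q : ℝ^ n) (b β : Fin k → ℝ^ n) (ε : Carrier) (0<ε : 0# < ε)
               (dual : ∀ l m → β l · b m ≈ δ l m) where

    points : Fin (suc k) → ℝ^ n
    points = q ∷ λ l → q +ᵥ ε *ᵥ b l

    abstract
      points-independent : AffinelyIndependent points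
      points-independent μ Σμ≈0 comb≈0 = μ≈0
        where
        μ-suc : ∀ l → μ (suc l) ≈ 0#
        μ-suc l = *-cancel-0 (<⇒≉ 0<ε) (sym (begin
          0#                                           ≈⟨ sym (·-𝟎ʳ (β l)) ⟩
          β l · 𝟎                                      ≈⟨ ·-congʳ (β l) (sym ∘ comb≈0) ⟩
          β l · combination μ points                   ≈⟨ ·-combination (β l) μ points ⟩
          μ zero * s + sum (λ m → μ (suc m) * (β l · points (suc m)))
            ≈⟨ +-congˡ (sum-cong λ m → *-congˡ (trans (·-+ʳ (β l) q (ε *ᵥ b m)) (+-congˡ (trans (·-*ʳ ε (β l) (b m)) (*-congˡ (dual l m)))))) ⟩
          μ zero * s + sum (λ m → μ (suc m) * (s + ε * δ l m))
            ≈⟨ +-congˡ (trans (sum-cong λ m → solve 4 (λ u s e d → u :* (s :+ e :* d) := s :* u :+ e :* (d :* u)) refl (μ (suc m)) s ε (δ l m))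
                 (trans (sum-+ (λ m → s * μ (suc m)) (λ m → ε * (δ l m * μ (suc m))))
                   (+-cong (sum-* s (μ ∘ suc)) (trans (sum-* ε (λ m → δ l m * μ (suc m))) (*-congˡ (δ-· l (μ ∘ suc))))))) ⟩
          μ zero * s + (s * sum (μ ∘ suc) + ε * μ (suc l))
            ≈⟨ solve 5 (λ u s t e v → u :* s :+ (s :* t :+ e :* v) := s :* (u :+ t) :+ e :* v) refl (μ zero) s (sum (μ ∘ suc)) ε (μ (suc l)) ⟩
          s * sum μ + ε * μ (suc l)  ≈⟨ +-congʳ (trans (*-congˡ Σμ≈0) (zeroʳ s)) ⟩
          0# + ε * μ (suc l)         ≈⟨ +-identityˡ _ ⟩
          ε * μ (suc l)              ∎))
          where
          s : Carrier
          s = β l · q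
        μ≈0 : ∀ j → μ j ≈ 0#
        μ≈0 (suc l) = μ-suc l
        μ≈0 zero = trans (sym (trans (+-congˡ (sum-0 μ-suc)) (+-identityʳ _))) Σμ≈0

      rescale : ∀ {ε r} x b → ε * r ≈ 1# → x * b ≈ x * r * (ε * b)
      rescale {ε} {r} x b εr≈1 = trans (sym (*-identityʳ _)) (trans (*-congˡ (sym εr≈1))
        (solve 4 (λ x b e r → x :* b :* (e :* r) := x :* r :* (e :* b)) refl x b ε r))

      points-span : ∀ x (c : Fin k → Carrier) → x ≋ q +ᵥ combination c b → AffineCombination points x
      points-span x c x≋ = span (reciprocal ε 0<ε)
        where
        span : ∃[ r ] (0# < r × ε * r ≈ 1#) → AffineCombination points x
        span (r , _ , εr≈1) = μ , solve 1 (λ t → (:1 :- t) :+ t := :1) refl (sum rc) , λ i → begin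
            x i                                                  ≈⟨ x≋ i ⟩
            q i + sum (λ l → c l * b l i)                        ≈⟨ +-congˡ (sum-cong λ l → rescale (c l) (b l i) εr≈1) ⟩
            q i + sum (λ l → rc l * (ε * b l i))                 ≈⟨ solve 3 (λ q t u → q :+ u := (:1 :- t) :* q :+ (q :* t :+ u)) refl (q i) (sum rc) (sum (λ l → rc l * (ε * b l i))) ⟩
            (1# - sum rc) * q i + (q i * sum rc + sum (λ l → rc l * (ε * b l i)))
              ≈⟨ +-congˡ (trans (+-congʳ (sym (sum-* (q i) rc))) (sym (sum-+ (λ l → q i * rc l) (λ l → rc l * (ε * b l i))))) ⟩
            (1# - sum rc) * q i + sum (λ l → q i * rc l + rc l * (ε * b l i))
              ≈⟨ +-congˡ (sum-cong λ l → solve 3 (λ q c e → q :* c :+ c :* e := c :* (q :+ e)) refl (q i) (rc l) (ε * b l i)) ⟩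
            combination μ points i ∎
          where
          rc : Fin k → Carrier
          rc l = c l * r
          μ : Fin (suc k) → Carrier
          μ = (1# - sum rc) ∷ rc

  -- Solving ν · y = 0 for the coordinate p leaves the other coordinates free; `basis` is the
  -- resulting basis of the hyperplane, dual to these coordinates.
  module HyperplaneBasis {d} (ν : ℝ^ (suc d)) (p : Fin (suc d)) {r} (νpr≈1 : ν p * r ≈ 1#) where

    basis : Fin d → ℝ^ suc d
    basis l = δ (punchIn p l) +ᵥ (- (ν (punchIn p l) * r)) *ᵥ δ p

    abstract
      cancel-pivot : ∀ s → s + - (s * r) * ν p ≈ 0#
      cancel-pivot s = begin
        s + - (s * r) * ν p    ≈⟨ solve 3 (λ s r v → s :+ :- (s :* r) :* v := s :* (:1 :- v :* r)) refl s r (ν p) ⟩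
        s * (1# - ν p * r)     ≈⟨ *-congˡ (trans (+-congˡ (-‿cong νpr≈1)) (-‿inverseʳ 1#)) ⟩
        s * 0#                 ≈⟨ zeroʳ s ⟩
        0#                     ∎

      orthogonal : ∀ l → Orthogonal ν (basis l)
      orthogonal l = trans (·-+ʳ ν (δ (punchIn p l)) ((- (ν (punchIn p l) * r)) *ᵥ δ p))
        (trans (+-cong (·-δ (punchIn p l) ν) (trans (·-*ʳ (- (ν (punchIn p l) * r)) ν (δ p)) (*-congˡ (·-δ p ν))))
          (cancel-pivot (ν (punchIn p l))))

      basis-p : ∀ l → basis l p ≈ - (ν (punchIn p l) * r)
      basis-p l = trans (+-cong (δ-off (Fin.punchInᵢ≢i p l)) (trans (*-congˡ (δ-diag p)) (*-identityʳ _))) (+-identityˡ _)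

      basis-punchIn : ∀ l m → basis l (punchIn p m) ≈ δ l m
      basis-punchIn l m = trans (+-cong (δ-punchIn p l m) (trans (*-congˡ (δ-off (Fin.punchInᵢ≢i p m ∘ ≡.sym))) (zeroʳ _))) (+-identityʳ _)

      dual : ∀ l m → δ (punchIn p l) · basis m ≈ δ l m
      dual l m = trans (δ-· (punchIn p l) (basis m)) (trans (basis-punchIn m l) (δ-sym m l))

      spans : ∀ y → Orthogonal ν y → ∀ m → Dec (p ≡ m) → y m ≈ combination (y ∘ punchIn p) basis m
      spans y ν·y≈0 m (yes ≡.refl) = sym (begin
        sum (λ l → y (punchIn p l) * basis l p)
          ≈⟨ sum-cong (λ l → trans (*-congˡ (basis-p l)) (solve 3 (λ y v r → y :* :- (v :* r) := :- r :* (v :* y)) refl (y (punchIn p l)) (ν (punchIn p l)) r)) ⟩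
        sum (λ l → - r * (ν (punchIn p l) * y (punchIn p l)))
          ≈⟨ sum-* (- r) (removeAt t p) ⟩
        - r * sum (removeAt t p)
          ≈⟨ solve 4 (λ r s v y → :- r :* s := (v :* r) :* y :- r :* (v :* y :+ s)) refl r (sum (removeAt t p)) (ν p) (y p) ⟩
        ν p * r * y p - r * (ν p * y p + sum (removeAt t p))
          ≈⟨ +-cong (trans (*-congʳ νpr≈1) (*-identityˡ _)) (-‿cong (trans (*-congˡ (trans (sym (sum-remove t)) ν·y≈0)) (zeroʳ r))) ⟩
        y p - 0#  ≈⟨ trans (+-congˡ -0#≈0#) (+-identityʳ _) ⟩
        y p ∎)
        where
        t : ℝ^ suc d
        t m = ν m * y m
      spans y ν·y≈0 m (no p≢m) = ≡.subst (λ m → y m ≈ combination (y ∘ punchIn p) basis m)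
        (Fin.punchIn-punchOut p≢m) (sym (trans
          (sum-cong (λ l → *-congˡ (trans (basis-punchIn l (punchOut p≢m)) (δ-sym l (punchOut p≢m)))))
          (·-δ (punchOut p≢m) (y ∘ punchIn p))))

  -- Without the coordinates m and l there are fewer equations than affine weights,
  -- so some affine dependency holds in all other coordinates; as u and g are
  -- constant, it then holds in these two as well.
  module _ {e} (p : Fin (suc (suc e)) → ℝ^ suc (suc e)) (independent : AffinelyIndependent p)
           (u g : ℝ^ suc (suc e)) (s t : Carrier) (u·p≈s : ∀ j → u · p j ≈ s) (g·p≈t : ∀ j → g · p j ≈ t)
           (m l : Fin (suc (suc e))) (m≢l : m ≢ l)
           (um≉0 : ¬ (u m ≈ 0#)) (gm≈0 : g m ≈ 0#) (gl≉0 : ¬ (g l ≈ 0#)) where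
    private
      l′ : Fin (suc e)
      l′ = punchOut m≢l

      equations : Fin (suc e) → ℝ^ suc (suc e)
      equations = (λ _ → 1#) ∷ λ k j → p j (punchIn m (punchIn l′ k))

      module _ (μ : ℝ^ suc (suc e)) (solves : ∀ i → Orthogonal (equations i) μ) where
        Y : ℝ^ suc (suc e)
        Y = combination μ p

        abstract
          Σμ≈0 : sum μ ≈ 0#
          Σμ≈0 = trans (sum-cong λ j → sym (*-identityˡ (μ j))) (solves zero)

          ·Y≈0 : ∀ u s → (∀ j → u · p j ≈ s) → u · Y ≈ 0#
          ·Y≈0 u s h = trans (·-combination u μ p) (trans (sum-affine μ (λ j → u · p j) s 0# h Σμ≈0) (zeroʳ s))

          Y-other : ∀ k → m ≢ k → l ≢ k → Y k ≈ 0#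
          Y-other k m≢k l≢k = ≡.subst (λ k → Y k ≈ 0#) eq
            (trans (sum-cong λ j → *-comm (μ j) (p j (punchIn m (punchIn l′ (punchOut l′≢k′))))) (solves (suc (punchOut l′≢k′))))
            where
            l′≢k′ : l′ ≢ punchOut m≢k
            l′≢k′ eq = l≢k (Fin.punchOut-injective m≢l m≢k eq)
            eq : punchIn m (punchIn l′ (punchOut l′≢k′)) ≡ k
            eq = ≡.trans (≡.cong (punchIn m) (Fin.punchIn-punchOut l′≢k′)) (Fin.punchIn-punchOut m≢k)

          vanish-l : ∀ k → k ≢ l → Dec (m ≡ k) → g k * Y k ≈ 0#
          vanish-l k k≢l (yes ≡.refl) = trans (*-congʳ gm≈0) (zeroˡ _)
          vanish-l k k≢l (no m≢k) = trans (*-congˡ (Y-other k m≢k (k≢l ∘ ≡.sym))) (zeroʳ _)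

          Y-l : Y l ≈ 0#
          Y-l = *-cancel-0 gl≉0 (trans (sym (sum-single (λ k → g k * Y k) l λ k k≢l → vanish-l k k≢l (m Fin.≟ k))) (·Y≈0 g t g·p≈t))

          vanish-m : ∀ k → k ≢ m → Dec (l ≡ k) → u k * Y k ≈ 0#
          vanish-m k k≢m (yes ≡.refl) = trans (*-congˡ Y-l) (zeroʳ _)
          vanish-m k k≢m (no l≢k) = trans (*-congˡ (Y-other k (k≢m ∘ ≡.sym) l≢k)) (zeroʳ _)

          Y-m : Y m ≈ 0#
          Y-m = *-cancel-0 um≉0 (trans (sym (sum-single (λ k → u k * Y k) m λ k k≢m → vanish-m k k≢m (l Fin.≟ k))) (·Y≈0 u s u·p≈s))

          Y-all : ∀ k → Dec (m ≡ k) → Dec (l ≡ k) → Y k ≈ 0#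
          Y-all k (yes ≡.refl) _ = Y-m
          Y-all k (no _) (yes ≡.refl) = Y-l
          Y-all k (no m≢k) (no l≢k) = Y-other k m≢k l≢k

          μ≋0 : μ ≋ 𝟎
          μ≋0 = independent μ Σμ≈0 λ k → Y-all k (m Fin.≟ k) (l Fin.≟ k)

    abstract
      not-both-constant : ⊥
      not-both-constant = refute (nontrivial-solution (suc e) equations)
        where
        refute : ∃[ μ ] (¬ (μ ≋ 𝟎) × ∀ i → Orthogonal (equations i) μ) → ⊥
        refute (μ , μ≉0 , solves) = μ≉0 (μ≋0 μ solves)

  abstract
    -- The gap at the centroid is the mean of the gaps at the points, all of them nonnegative and
    -- one positive.
    centroid-strict : ∀ {k n} (p : Fin (suc k) → ℝ^ n) (ν : ℝ^ n) o w → 0# < w → ι (suc k) * w ≈ 1# →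
      (∀ j → ν · p j ≤ o) → ∀ j → ¬ (ν · p j ≈ o) → ν · combination (λ _ → w) p < o
    centroid-strict {k} {n} p ν o w 0<w nw≈1 p≤ j p-slack = by-< (sum gaps)
        (<-≤-trans (0<-* 0<w (diff-< (≤∧≉⇒< (p≤ j) p-slack))) (term≤sum (λ j → 0≤-* (<⇒≤ 0<w) (diff-≤ (p≤ j))) j))
        (begin
          o - ν · combination (λ _ → w) p                   ≈⟨ +-cong (sym (trans (*-congʳ nw≈1) (*-identityˡ o))) (-‿cong (·-combination ν (λ _ → w) p)) ⟩
          ι (suc k) * w * o - sum (λ j → w * (ν · p j))     ≈⟨ +-cong (trans (*-assoc _ _ _) (sym (sum-const (suc k) (w * o)))) (trans (solve 1 (λ x → :- x := :- :1 :* x) refl (sum (λ j → w * (ν · p j)))) (sym (sum-* (- 1#) (λ j → w * (ν · p j))))) ⟩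
          sum {suc k} (λ _ → w * o) + sum (λ j → - 1# * (w * (ν · p j))) ≈⟨ sym (sum-+ (λ j → w * o) (λ j → - 1# * (w * (ν · p j)))) ⟩
          sum (λ j → w * o + - 1# * (w * (ν · p j)))        ≈⟨ sum-cong (λ j → solve 3 (λ w o v → w :* o :+ :- :1 :* (w :* v) := w :* (o :- v)) refl w o (ν · p j)) ⟩
          sum gaps ∎)
      where
      gaps : Fin (suc k) → Carrier
      gaps j = w * (o - ν · p j)

    constant-on-affine-hull : ∀ {k n} (p : Fin k → ℝ^ n) (u : ℝ^ n) s → (∀ j → u · p j ≈ s) →
      ∀ x → AffineCombination p x → u · x ≈ s
    constant-on-affine-hull p u s u·p≈s x (μ , Σμ≈1 , x≋) =
      trans (·-congʳ u x≋) (trans (·-combination u μ p)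
        (trans (sum-affine μ (λ j → u · p j) s 1# u·p≈s Σμ≈1) (*-identityʳ s)))

    -- The conditions are d homogeneous equations in the d + 1 unknowns (s , u). Nontriviality is
    -- phrased so that u = 0 contradicts s = u · p j as soon as there is a point.
    hyperplane-through : ∀ {d} (p : Fin d → ℝ^ d) →
      ∃[ u ] ∃[ s ] ((u ≋ 𝟎 → ¬ (s ≈ 0#)) × ∀ j → u · p j ≈ s)
    hyperplane-through {d} p = read (nontrivial-solution d (λ j → (- 1#) ∷ p j))
      where
      read : ∃[ x ] (¬ (x ≋ 𝟎) × ∀ j → Orthogonal ((- 1#) ∷ p j) x) →
             ∃[ u ] ∃[ s ] ((u ≋ 𝟎 → ¬ (s ≈ 0#)) × ∀ j → u · p j ≈ s)
      read (x , x≉0 , solves) = x ∘ suc , x zero ,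
        (λ u≋0 s≈0 → x≉0 λ { zero → s≈0 ; (suc k) → u≋0 k }) ,
        λ j → trans (·-comm (x ∘ suc) (p j))
          (trans (solve 2 (λ s t → t := s :+ (:- :1 :* s :+ t)) refl (x zero) (p j · (x ∘ suc)))
            (trans (+-congˡ (solves j)) (+-identityʳ _)))

  module _ {e} (P : Polytope (suc (suc e))) where
    private
      d : ℕ
      d = suc e
      N : ℕ
      N = Polytope.size P
      ν = Polytope.normal P
      o = Polytope.offset P

    StrictlyInside : Pred (ℝ^ suc d) ℓ₂
    StrictlyInside q = ∀ i → ν i · q < o i

    FacetWitness : Fin N → Pred (ℝ^ suc d) (ℓ₁ ⊔ ℓ₂)
    FacetWitness i q = ν i · q ≈ o i × ∀ k → k ≢ i → ν k · q < o k

    Tight : Fin N → Pred (ℝ^ suc d) (ℓ₁ ⊔ ℓ₂)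
    Tight i x = ⟦ P ⟧ x × ν i · x ≈ o i

    abstract
      facetWitness⇒tight : ∀ {i q} → FacetWitness i q → Tight i q
      facetWitness⇒tight {i} {q} (tight , strict) = (λ k → inside k (k Fin.≟ i)) , tight
        where
        inside : ∀ k → Dec (k ≡ i) → ν k · q ≤ o k
        inside k (yes ≡.refl) = ≤-reflexive tight
        inside k (no  k≢i)    = <⇒≤ (strict k k≢i)

      step-inside : ∀ q h k → ν k · q < o k → Eventually (λ ε → ν k · (q +ᵥ ε *ᵥ h) ≤ o k)
      step-inside q h k s = small (eventually-linear (ν k · h) (diff-< s))
        where
        small : Eventually (λ ε → ε * (ν k · h) < o k - ν k · q) → Eventually (λ ε → ν k · (q +ᵥ ε *ᵥ h) ≤ o k)
        small (ε₀ , 0<ε₀ , small) = ε₀ , 0<ε₀ , λ ε 0<ε ε≤ε₀ →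
          by-≤ _ (<⇒≤ (diff-< (small ε 0<ε ε≤ε₀))) (trans (+-congˡ (-‿cong (·-step (ν k) q h ε)))
            (solve 3 (λ o u v → o :- (u :+ v) := o :- u :- v) refl (o k) (ν k · q) (ε * (ν k · h))))

      strictlyInside-step : ∀ {q} → StrictlyInside q → ∀ h → Eventually (λ ε → ⟦ P ⟧ (q +ᵥ ε *ᵥ h))
      strictlyInside-step {q} s h = eventually-∀ λ k → step-inside q h k (s k)

      tight-step : ∀ {i q h} ε → ν i · q ≈ o i → Orthogonal (ν i) h → ν i · (q +ᵥ ε *ᵥ h) ≈ o i
      tight-step {i} {q} {h} ε tight ν·h≈0 = trans (·-step (ν i) q h ε)
        (trans (+-cong tight (trans (*-congˡ ν·h≈0) (zeroʳ ε))) (+-identityʳ _))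

      -- Steps within the hyperplane of i keep that inequality tight, and small ones keep the others
      -- slack. Hence the tight points fill a neighbourhood of q in the hyperplane.
      facetWitness-step : ∀ {i q} → FacetWitness i q → ∀ h → Orthogonal (ν i) h →
                          Eventually (λ ε → ⟦ P ⟧ (q +ᵥ ε *ᵥ h))
      facetWitness-step {i} {q} (tight , strict) h ν·h≈0 = eventually-∀ λ k → step k (k Fin.≟ i)
        where
        step : ∀ k → Dec (k ≡ i) → Eventually (λ ε → ν k · (q +ᵥ ε *ᵥ h) ≤ o k)
        step k (no k≢i) = step-inside q h k (strict k k≢i)
        step k (yes ≡.refl) = eventually-pure λ ε _ → ≤-reflexive (tight-step {i} {q} {h} ε tight ν·h≈0)

      fullDimensional : ∃ StrictlyInside → HasDimension ⟦ P ⟧ (suc d)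
      fullDimensional (q , inside) = build (eventually-∃ (eventually-∀ λ l → strictlyInside-step {q} inside (δ l)))
        where
        build : ∃[ ε ] (0# < ε × ∀ l → ⟦ P ⟧ (q +ᵥ ε *ᵥ δ l)) → HasDimension ⟦ P ⟧ (suc d)
        build (ε , 0<ε , step) = points , (λ { zero k → <⇒≤ (inside k) ; (suc l) → step l }) , points-independent ,
          λ x _ → points-span x (λ l → x l - q l) λ i → trans
            (solve 2 (λ x q → x := q :+ (x :- q)) refl (x i) (q i))
            (+-congˡ (trans (sym (·-δ i (λ l → x l - q l))) (·-congʳ (λ l → x l - q l) {δ i} {λ l → δ l i} (δ-sym i))))
          where
          open AffineFrame q δ δ ε 0<ε (λ l m → trans (δ-· l (δ m)) (δ-sym m l))

      hyperplane-dimension : ∀ {i q} → FacetWitness i q → ∀ p r → ν i p * r ≈ 1# → HasDimension (Tight i) d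
      hyperplane-dimension {i} {q} witness p r νpr≈1 =
        build (eventually-∃ (eventually-∀ λ l → facetWitness-step {i} {q} witness (basis l) (orthogonal l)))
        where
        open HyperplaneBasis (ν i) p νpr≈1
        build : ∃[ ε ] (0# < ε × ∀ l → ⟦ P ⟧ (q +ᵥ ε *ᵥ basis l)) → HasDimension (Tight i) d
        build (ε , 0<ε , step) = points ,
          (λ { zero → facetWitness⇒tight {i} {q} witness ; (suc l) → step l , tight-step {i} {q} {basis l} ε (proj₁ witness) (orthogonal l) }) ,
          points-independent , λ { x (_ , x-tight) → points-span x ((x +ᵥ (- 1#) *ᵥ q) ∘ punchIn p) λ m → trans
            (solve 2 (λ x q → x := q :+ (x :+ :- :1 :* q)) refl (x m) (q m))
            (+-congˡ (spans (x +ᵥ (- 1#) *ᵥ q)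
              (trans (·-difference (ν i) x q) (trans (+-cong x-tight (-‿cong (proj₁ witness))) (-‿inverseʳ (o i))))
              m (p Fin.≟ m))) }
          where
          open AffineFrame q basis (δ ∘ punchIn p) ε 0<ε dual

    module _ (interior : ∃ StrictlyInside) (witness : ∀ i → ∃ (FacetWitness i)) where

      abstract
        -- A zero normal would take the value 0 both at the witness, where the inequality is tight,
        -- and at the interior point, where it is strict.
        normal-nonzero : ∀ i → ∃[ p ] ¬ (ν i p ≈ 0#)
        normal-nonzero i = ≋𝟎-or-nonzero (ν i) λ ν≋0 →
          proj₂ interior i (≤-reflexive (trans (sym (proj₁ (proj₂ (witness i))))
            (trans (≋𝟎⇒·≈0 (proj₁ (witness i)) ν≋0) (sym (≋𝟎⇒·≈0 (proj₁ interior) ν≋0)))))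

        tight-dimension : ∀ i → HasDimension (Tight i) d
        tight-dimension i = hyperplane-dimension {i} {proj₁ (witness i)} (proj₂ (witness i)) _ _
          (proj₂ (inverse _ (proj₂ (normal-nonzero i))))

      facet : Fin N → Face P d
      facet i = record
        { functional = ν i ; value = o i ; valid = λ x x∈P → x∈P i ; dimension = tight-dimension i }

      module _ (f : ℝ^ suc d) (value : Carrier) (p : Fin (suc d) → ℝ^ suc d)
               (p∈F : ∀ j → ⟦ P ⟧ (p j) × f · p j ≈ value) where
        private
          FacePoints : Pred (ℝ^ suc d) (ℓ₁ ⊔ ℓ₂)
          FacePoints x = ⟦ P ⟧ x × f · x ≈ value

        abstract
          proportional : ∀ {i k} → f +ᵥ (- k) *ᵥ ν i ≋ 𝟎 → ∀ x → f · x ≈ k * (ν i · x)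
          proportional {i} {k} g≋0 x = begin
            f · x                                     ≈⟨ solve 3 (λ f k v → f := f :+ :- k :* v :+ k :* v) refl (f · x) k (ν i · x) ⟩
            f · x + - k * (ν i · x) + k * (ν i · x)   ≈⟨ +-congʳ (sym (trans (·-+ˡ f ((- k) *ᵥ ν i) x) (+-congˡ (·-*ˡ (- k) (ν i) x)))) ⟩
            (f +ᵥ (- k) *ᵥ ν i) · x + k * (ν i · x)   ≈⟨ +-congʳ (≋𝟎⇒·≈0 x g≋0) ⟩
            0# + k * (ν i · x)                        ≈⟨ +-identityˡ _ ⟩
            k * (ν i · x)                             ∎

          -- The points span a hyperplane, and functionals constant on it are multiples of one
          -- another. Concretely, the multiple of ν i that cancels the coordinate m is subtracted
          -- from f; a nonzero coordinate l of the rest would contradict `not-both-constant`.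
          difference-vanishes : AffinelyIndependent p → ∀ i → (∀ j → ν i · p j ≈ o i) →
            ∀ m → ¬ (ν i m ≈ 0#) → ∀ r → ν i m * r ≈ 1# → f +ᵥ (- (f m * r)) *ᵥ ν i ≋ 𝟎
          difference-vanishes independent i tight m νm≉0 r νmr≈1 l with (f +ᵥ (- (f m * r)) *ᵥ ν i) l ≟ 0#
          ... | yes gl≈0 = gl≈0
          ... | no  gl≉0 = ⊥-elim (not-both-constant p independent (ν i) g (o i) (value + - (f m * r) * o i) tight
            (λ j → trans (·-+ˡ f ((- (f m * r)) *ᵥ ν i) (p j)) (+-cong (proj₂ (p∈F j)) (trans (·-*ˡ (- (f m * r)) (ν i) (p j)) (*-congˡ (tight j)))))
            m l (λ m≡l → gl≉0 (≡.subst (λ l → g l ≈ 0#) m≡l gm≈0)) νm≉0 gm≈0 gl≉0)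
            where
            g : ℝ^ suc d
            g = f +ᵥ (- (f m * r)) *ᵥ ν i
            gm≈0 : g m ≈ 0#
            gm≈0 = HyperplaneBasis.cancel-pivot (ν i) m νmr≈1 (f m)

          all-tight⇒facet : AffinelyIndependent p → ∀ i → (∀ j → ν i · p j ≈ o i) → ∀ x → Tight i x → FacePoints x
          all-tight⇒facet independent i tight x (x∈P , x-tight) = x∈P ,
            trans (f≈kν x) (trans (*-congˡ (trans x-tight (sym (tight zero)))) (trans (sym (f≈kν (p zero))) (proj₂ (p∈F zero))))
            where
            m : Fin (suc d)
            m = proj₁ (normal-nonzero i)
            r : ∃[ r ] (ν i m * r ≈ 1#)
            r = inverse (ν i m) (proj₂ (normal-nonzero i))
            f≈kν : ∀ x → f · x ≈ f m * proj₁ r * (ν i · x)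
            f≈kν = proportional {i} (difference-vanishes independent i tight m (proj₂ (normal-nonzero i)) (proj₁ r) (proj₂ r))

          centroid-inside : (∀ i → ∃[ j ] ¬ (ν i · p j ≈ o i)) →
                            ∃[ q ] (StrictlyInside q × f · q ≈ value)
          centroid-inside slack = build (reciprocal (ι (suc d)) (<-≤-trans 0<1 (1≤ι d)))
            where
            build : ∃[ w ] (0# < w × ι (suc d) * w ≈ 1#) → ∃[ q ] (StrictlyInside q × f · q ≈ value)
            build (w , 0<w , nw≈1) = combination (λ _ → w) p ,
              (λ i → centroid-strict p (ν i) (o i) w 0<w nw≈1 (λ j → proj₁ (p∈F j) i) (proj₁ (slack i)) (proj₂ (slack i))) ,
              trans (·-combination f (λ _ → w) p) (trans (sum-affine (λ _ → w) (λ j → f · p j) value 1# (proj₂ ∘ p∈F)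
                (trans (sum-const (suc d) w) nw≈1)) (*-identityʳ value))

          maximal-inside⇒≋𝟎 : ∀ {q} (u : ℝ^ suc d) → StrictlyInside q → (∀ x → ⟦ P ⟧ x → u · x ≤ u · q) → u ≋ 𝟎
          maximal-inside⇒≋𝟎 {q} u inside maximal = use (eventually-∃ (strictlyInside-step {q} inside u))
            where
            use : ∃[ ε ] (0# < ε × ⟦ P ⟧ (q +ᵥ ε *ᵥ u)) → u ≋ 𝟎
            use (ε , 0<ε , moved∈P) = no-increase⇒≋𝟎 u q ε 0<ε (maximal (q +ᵥ ε *ᵥ u) moved∈P)

          -- Otherwise the face meets the interior, hence is all of P, whose
          -- affine hull is too big to be spanned by d + 1 points.
          some-tight : (∀ x → ⟦ P ⟧ x → f · x ≤ value) → (∀ x → FacePoints x → AffineCombination p x) →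
                       ¬ (∀ i → ∃[ j ] ¬ (ν i · p j ≈ o i))
          some-tight valid F⊆aff slack = refute (centroid-inside slack) (hyperplane-through p)
            where
            refute : ∃[ q ] (StrictlyInside q × f · q ≈ value) →
                     ∃[ u ] ∃[ s ] ((u ≋ 𝟎 → ¬ (s ≈ 0#)) × ∀ j → u · p j ≈ s) → ⊥
            refute (q , inside , q-value) (u , s , nonzero , u·p≈s) =
              nonzero u≋0 (trans (sym (u·p≈s zero)) (≋𝟎⇒·≈0 (p zero) u≋0))
              where
              f≋0 : f ≋ 𝟎
              f≋0 = maximal-inside⇒≋𝟎 {q} f inside λ x x∈P → ≤-cong refl (sym q-value) (valid x x∈P)
              P⊆F : ∀ x → ⟦ P ⟧ x → FacePoints x
              P⊆F x x∈P = x∈P , trans (≋𝟎⇒·≈0 x f≋0) (trans (sym (≋𝟎⇒·≈0 (p zero) f≋0)) (proj₂ (p∈F zero)))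
              constant : ∀ x → ⟦ P ⟧ x → u · x ≈ s
              constant x x∈P = constant-on-affine-hull p u s u·p≈s x (F⊆aff x (P⊆F x x∈P))
              u≋0 : u ≋ 𝟎
              u≋0 = maximal-inside⇒≋𝟎 {q} u inside λ x x∈P →
                ≤-reflexive (trans (constant x x∈P) (sym (constant q (<⇒≤ ∘ inside))))

      abstract
        -- Some inequality is tight on the whole affine frame of F, by `some-tight`. It is then
        -- tight on F, which lies in the affine hull of the frame; conversely the functional of F is
        -- a multiple of its normal, so all its tight points lie in F.
        face-is-facet : (F : Face P d) →
          ∃[ i ] ((∀ {x} → Tight i x → Face.FacePoints F x) × (∀ {x} → Face.FacePoints F x → Tight i x))
        face-is-facet F = decide (Face.dimension F) (Fin.any? λ i → Fin.all? λ j → ν i · proj₁ (Face.dimension F) j ≟ o i)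
          where
          open Face F using (functional; value; valid; FacePoints)
          decide : (D : HasDimension FacePoints d) → Dec (∃[ i ] ∀ j → ν i · proj₁ D j ≈ o i) →
                   ∃[ i ] ((∀ {x} → Tight i x → FacePoints x) × (∀ {x} → FacePoints x → Tight i x))
          decide (p , p∈F , independent , F⊆aff) (yes (i , tight)) =
            i , (λ {x} → all-tight⇒facet functional value p p∈F independent i tight x) ,
                (λ {x} x∈F → proj₁ x∈F , constant-on-affine-hull p (ν i) (o i) tight x (F⊆aff x x∈F))
          decide (p , p∈F , independent , F⊆aff) (no none) =
            ⊥-elim (some-tight functional value p p∈F valid F⊆aff λ i →
              Fin.¬∀⟶∃¬ _ _ (λ j → ν i · p j ≟ o i) λ tight → none (i , tight))

        -- The witness of i is slack in every other inequality and so tells the facets apart.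
        witness-injective : ∀ {i k} → Dec (k ≡ i) → (∀ {x} → Tight i x → Tight k x) → i ≡ k
        witness-injective (yes ≡.refl) _ = ≡.refl
        witness-injective {i} {k} (no k≢i) ⊆ = ⊥-elim (proj₂ (proj₂ (witness i)) k k≢i
          (≤-reflexive (sym (proj₂ (⊆ {proj₁ (witness i)} (facetWitness⇒tight {i} {proj₁ (witness i)} (proj₂ (witness i))))))))

      numberOfFacets : NumberOfFaces P d N
      numberOfFacets = record
        { to = facet
        ; cong = λ { ≡.refl → (λ z → z) , (λ z → z) }
        ; bijective = (λ {i} {k} eq → witness-injective (k Fin.≟ i) (λ {x} → proj₁ eq {x})) ,
                      λ F → proj₁ (face-is-facet F) , λ { ≡.refl → proj₂ (face-is-facet F) }
        }

  -- The tent map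

  ♯ : ℕ → Carrier
  ♯ n = n • 1#

  :♯ : ∀ {n} → ℕ → Polynomial n
  :♯ n = con (ℤ.+ n)

  abstract
    0<♯ : ∀ n → 0# < ♯ (suc n)
    0<♯ zero = 0<1
    0<♯ (suc n) = <-cong refl (sym (×-homo-+ 1# 1 (suc n))) (0<-+ 0<1 (<⇒≤ (0<♯ n)))

  -- Signs are elements of `Fin 2` so that `finToFun` enumerates the sign sequences by
  -- `Fin (2 ^ d)`.
  sign : Fin 2 → Carrier
  sign zero       = 1#
  sign (suc zero) = - 1#

  abstract
    sign²≈1 : ∀ s → sign s * sign s ≈ 1#
    sign²≈1 zero       = *-identityˡ 1#
    sign²≈1 (suc zero) = solve 0 (:- :1 :* :- :1 := :1) refl

    sign≤1 : ∀ s → sign s ≤ 1#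
    sign≤1 zero       = ≤-refl
    sign≤1 (suc zero) = by-≤ (♯ 2) (<⇒≤ (0<♯ 1)) (solve 0 (:1 :- :- :1 := :♯ 2) refl)

    -1≤sign : ∀ s → - 1# ≤ sign s
    -1≤sign zero       = by-≤ (♯ 2) (<⇒≤ (0<♯ 1)) (solve 0 (:1 :- :- :1 := :♯ 2) refl)
    -1≤sign (suc zero) = ≤-refl

  record Affine : Set a where
    constructor _+t*_
    field
      constant slope : Carrier

    at : Carrier → Carrier
    at t = constant + t * slope

  open Affine public using (at)

  Within : Carrier → Carrier → Pred Carrier ℓ₂
  Within lo hi t = lo ≤ t × t ≤ hi

  abstract
    -- Linear interpolation: t is the convex combination of p and q with weights κ and θ, hence
    -- between `lo` and `hi`. The order of p and q is left open because folding can reverse the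
    -- direction in which the residual moves.
    intermediate-value : ∀ {lo hi} (f : Affine) {p q} → Within lo hi p → Within lo hi q →
      1# ≤ at f p → at f q ≤ - 1# → ∀ {v} → - 1# ≤ v → v ≤ 1# →
      ∃[ t ] (Within lo hi t × at f t ≈ v)
    intermediate-value {lo} {hi} f@(A +t* B) {p} {q} (lo≤p , p≤hi) (lo≤q , q≤hi) 1≤fp fq≤-1 {v} -1≤v v≤1 =
      t , (lower , upper) , (begin
        A + t * B                        ≈⟨ solve 5 (λ A B p q θ → A :+ (p :+ θ :* (q :- p)) :* B := A :+ p :* B :- θ :* (A :+ p :* B :- (A :+ q :* B))) refl A B p q θ ⟩
        x - (x - v) * r * D              ≈⟨ solve 4 (λ x v r D → x :- (x :- v) :* r :* D := x :- (x :- v) :* (D :* r)) refl x v r D ⟩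
        x - (x - v) * (D * r)            ≈⟨ +-congˡ (-‿cong (trans (*-congˡ Dr≈1) (*-identityʳ _))) ⟩
        x - (x - v)                      ≈⟨ solve 2 (λ x v → x :- (x :- v) := v) refl x v ⟩
        v                                ∎)
      where
      x y D r θ κ t : Carrier
      x = at f p
      y = at f q
      D = x - y
      0<D : 0# < D
      0<D = by-< (♯ 2 + ((x - 1#) + (- 1# - y))) (0<-+ (0<♯ 1) (0≤-+ (diff-≤ 1≤fp) (diff-≤ fq≤-1)))
        (solve 2 (λ x y → x :- y :- :0 := :♯ 2 :+ ((x :- :1) :+ (:- :1 :- y))) refl x y)
      r = proj₁ (reciprocal D 0<D)
      0<r : 0# < r
      0<r = proj₁ (proj₂ (reciprocal D 0<D))
      Dr≈1 : D * r ≈ 1#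
      Dr≈1 = proj₂ (proj₂ (reciprocal D 0<D))
      θ = (x - v) * r
      κ = (v - y) * r
      t = p + θ * (q - p)
      0≤θ : 0# ≤ θ
      0≤θ = 0≤-* (diff-≤ (≤-trans v≤1 1≤fp)) (<⇒≤ 0<r)
      0≤κ : 0# ≤ κ
      0≤κ = 0≤-* (diff-≤ (≤-trans fq≤-1 -1≤v)) (<⇒≤ 0<r)
      1-θ≈κ : 1# - θ ≈ κ
      1-θ≈κ = trans (+-congʳ (sym Dr≈1)) (solve 4 (λ x y v r → (x :- y) :* r :- (x :- v) :* r := (v :- y) :* r) refl x y v r)
      lower : lo ≤ t
      lower = by-≤ (κ * (p - lo) + θ * (q - lo)) (0≤-+ (0≤-* 0≤κ (diff-≤ lo≤p)) (0≤-* 0≤θ (diff-≤ lo≤q)))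
        (trans (solve 4 (λ p q θ l → p :+ θ :* (q :- p) :- l := (:1 :- θ) :* (p :- l) :+ θ :* (q :- l)) refl p q θ lo) (+-congʳ (*-congʳ 1-θ≈κ)))
      upper : t ≤ hi
      upper = by-≤ (κ * (hi - p) + θ * (hi - q)) (0≤-+ (0≤-* 0≤κ (diff-≤ p≤hi)) (0≤-* 0≤θ (diff-≤ q≤hi)))
        (trans (solve 4 (λ p q θ l → l :- (p :+ θ :* (q :- p)) := (:1 :- θ) :* (l :- p) :+ θ :* (l :- q)) refl p q θ hi) (+-congʳ (*-congʳ 1-θ≈κ)))

    0<-cancel : ∀ {x y} → 0# < x → 0# < x * y → 0# < y
    0<-cancel {x} {y} 0<x 0<xy y≤0 = 0<xy (by-≤ (x * - y) (0≤-* (<⇒≤ 0<x) (0≤-neg y≤0))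
      (solve 2 (λ x y → :0 :- x :* y := x :* :- y) refl x y))

    -≤sign* : ∀ s {w} → 0# ≤ w → - w ≤ sign s * w
    -≤sign* s {w} 0≤w = by-≤ ((sign s - - 1#) * w) (0≤-* (diff-≤ (-1≤sign s)) 0≤w)
      (solve 2 (λ s w → s :* w :- :- w := (s :- :- :1) :* w) refl (sign s) w)

    sign*≤self : ∀ s {w} → 0# ≤ w → sign s * w ≤ w
    sign*≤self s {w} 0≤w = by-≤ ((1# - sign s) * w) (0≤-* (diff-≤ (sign≤1 s)) 0≤w)
      (solve 2 (λ s w → w :- s :* w := (:1 :- s) :* w) refl (sign s) w)

    sign*≤1 : ∀ s {w} → 0# ≤ w → w ≤ 1# → sign s * w ≤ 1#
    sign*≤1 s 0≤w w≤1 = ≤-trans (sign*≤self s 0≤w) w≤1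

    -1≤sign* : ∀ s {w} → 0# ≤ w → w ≤ 1# → - 1# ≤ sign s * w
    -1≤sign* s {w} 0≤w w≤1 = ≤-trans
      (by-≤ (1# - w) (diff-≤ w≤1) (solve 1 (λ w → :- w :- :- :1 := :1 :- w) refl w)) (-≤sign* s 0≤w)

    -- With y the next residual, in [-1 , 1], and g in [2 , 6], the product 7 x = g - y lies in
    -- [1 , 7]. This estimate and the next one thus keep the weights x in (0 , 1].
    0<7x+y : ∀ {x y g} → g ≈ y + ♯ 7 * x → ♯ 2 ≤ g → y ≤ 1# → 0# < x
    0<7x+y {x} {y} {g} eq 2≤g y≤1 = 0<-cancel (0<♯ 6) (by-< ((g - ♯ 2) + (1# - y) + 1#)
      (0<-+ʳ (0≤-+ (diff-≤ 2≤g) (diff-≤ y≤1)) 0<1)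
      (trans (solve 2 (λ y x → :♯ 7 :* x :- :0 := (y :+ :♯ 7 :* x :- :♯ 2) :+ (:1 :- y) :+ :1) refl y x)
        (+-congʳ (+-congʳ (+-congʳ (sym eq))))))

    7x+y≤6 : ∀ {x y g} → g ≈ y + ♯ 7 * x → g ≤ ♯ 6 → - 1# ≤ y → x ≤ 1#
    7x+y≤6 {x} {y} {g} eq g≤6 -1≤y = ≮⇒≥ λ 1<x → 0<-* (0<♯ 6) (diff-< 1<x) (by-≤ ((♯ 6 - g) + (y - - 1#))
      (0≤-+ (diff-≤ g≤6) (diff-≤ -1≤y))
      (trans (solve 2 (λ y x → :0 :- :♯ 7 :* (x :- :1) := (:♯ 6 :- (y :+ :♯ 7 :* x)) :+ (y :- :- :1)) refl y x)
        (+-congʳ (+-congˡ (-‿cong (sym eq))))))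

  -- The branch of the tent map on which ∣f∣ is s f.
  fold : Fin 2 → Affine → Affine → Affine
  fold s (G +t* H) (A +t* B) = (G - ♯ 7 * (sign s * A)) +t* (H - ♯ 7 * (sign s * B))

  abstract
    at-fold : ∀ s g f t → at (fold s g f) t ≈ at g t - ♯ 7 * (sign s * at f t)
    at-fold s (G +t* H) (A +t* B) t =
      solve 6 (λ G H s A B t → G :- :♯ 7 :* (s :* A) :+ t :* (H :- :♯ 7 :* (s :* B)) := (G :+ t :* H) :- :♯ 7 :* (s :* (A :+ t :* B)))
        refl G H (sign s) A B t

    1≤fold : ∀ s g f t → ♯ 2 ≤ at g t → at f t ≈ 0# → 1# ≤ at (fold s g f) t
    1≤fold s g f t 2≤g f≈0 = by-≤ ((at g t - ♯ 2) + 1#) (0≤-+ (diff-≤ 2≤g) 0≤1) (begin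
      at (fold s g f) t - 1#                  ≈⟨ +-congʳ (at-fold s g f t) ⟩
      at g t - ♯ 7 * (sign s * at f t) - 1#   ≈⟨ +-congʳ (+-congˡ (-‿cong (*-congˡ (trans (*-congˡ f≈0) (zeroʳ (sign s)))))) ⟩
      at g t - ♯ 7 * 0# - 1#                  ≈⟨ solve 1 (λ x → x :- :♯ 7 :* :0 :- :1 := (x :- :♯ 2) :+ :1) refl (at g t) ⟩
      (at g t - ♯ 2) + 1#                     ∎)

    fold≤-1 : ∀ s g f t → at g t ≤ ♯ 6 → at f t ≈ sign s → at (fold s g f) t ≤ - 1#
    fold≤-1 s g f t g≤6 f≈s = by-≤ (♯ 6 - at g t) (diff-≤ g≤6) (begin
      - 1# - at (fold s g f) t                      ≈⟨ +-congˡ (-‿cong (at-fold s g f t)) ⟩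
      - 1# - (at g t - ♯ 7 * (sign s * at f t))     ≈⟨ +-congˡ (-‿cong (+-congˡ (-‿cong (*-congˡ (trans (*-congˡ f≈s) (sign²≈1 s)))))) ⟩
      - 1# - (at g t - ♯ 7 * 1#)                    ≈⟨ solve 1 (λ x → :- :1 :- (x :- :♯ 7 :* :1) := :♯ 6 :- x) refl (at g t) ⟩
      ♯ 6 - at g t                                  ∎)

  -- `μ k` is the absolute value of the k-th residual. It becomes the weight of the wall (k , σ k)
  -- when the objective is written in the normal cone of the corner σ.
  record Itinerary {m} (lo hi : Carrier) (f : Affine) (g : Fin m → Affine) (σ : Fin (suc m) → Fin 2) : Set (a ⊔ ℓ₁ ⊔ ℓ₂) where
    field
      t      : Carrier
      μ      : Fin (suc m) → Carrier
      within : Within lo hi t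
      0<μ    : ∀ k → 0# < μ k
      μ≤1    : ∀ k → μ k ≤ 1#
      first  : at f t ≈ sign (σ zero) * μ zero
      next   : ∀ k → at (g k) t ≈ sign (σ (suc k)) * μ (suc k) + ♯ 7 * μ (inject₁ k)

  -- That f has the prescribed sign at t comes out of the bounds on g: they force the new weight s f
  -- to be positive.
  extend : ∀ {m lo hi f} {g : Fin (suc m) → Affine} {σ} →
    (∀ {t} → Within lo hi t → ♯ 2 ≤ at (g zero) t × at (g zero) t ≤ ♯ 6) →
    Itinerary lo hi (fold (σ zero) (g zero) f) (g ∘ suc) (σ ∘ suc) → Itinerary lo hi f g σ
  extend {m} {f = f} {g} {σ} bound I = record
    { t = I.t ; μ = μ ; within = I.within
    ; 0<μ = λ { zero → 0<7x+y eq (proj₁ (bound I.within)) (sign*≤1 (σ (suc zero)) (<⇒≤ (I.0<μ zero)) (I.μ≤1 zero)) ; (suc k) → I.0<μ k }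
    ; μ≤1 = λ { zero → 7x+y≤6 eq (proj₂ (bound I.within)) (-1≤sign* (σ (suc zero)) (<⇒≤ (I.0<μ zero)) (I.μ≤1 zero)) ; (suc k) → I.μ≤1 k }
    ; first = sym (trans (sym (*-assoc s s _)) (trans (*-congʳ (sign²≈1 (σ zero))) (*-identityˡ _)))
    ; next = λ { zero → eq ; (suc k) → I.next k }
    }
    where
    module I = Itinerary I
    s = sign (σ zero)
    μ₀ = s * at f I.t
    μ : Fin (suc (suc m)) → Carrier
    μ = μ₀ ∷ I.μ
    eq : at (g zero) I.t ≈ sign (σ (suc zero)) * I.μ zero + ♯ 7 * μ₀
    eq = trans (solve 2 (λ g u → g := (g :- u) :+ u) refl (at (g zero) I.t) (♯ 7 * μ₀))
           (+-congʳ (trans (sym (at-fold (σ zero) (g zero) f I.t)) I.first))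

  -- The residuals r₀ = f, rₖ₊₁ = gₖ - 7 ∣rₖ∣ realise every sequence of signs: the
  -- tent map r ↦ gₖ - 7 ∣r∣ stretches both [-1 , 0] and [0 , 1] over [-1 , 1].
  every-itinerary : ∀ {m lo hi} (f : Affine) (g : Fin m → Affine) →
    (∀ k {t} → Within lo hi t → ♯ 2 ≤ at (g k) t × at (g k) t ≤ ♯ 6) →
    ∀ {p q} → Within lo hi p → Within lo hi q → 1# ≤ at f p → at f q ≤ - 1# →
    ∀ σ → Itinerary lo hi f g σ
  every-itinerary {zero} f g bound wp wq 1≤fp fq≤-1 σ = record
    -- The last residual is not folded again, so it can be sent to the endpoint `sign (σ zero)`
    -- itself, with weight 1.
    { t = proj₁ hit ; μ = λ _ → 1# ; within = proj₁ (proj₂ hit) ; 0<μ = λ _ → 0<1 ; μ≤1 = λ _ → ≤-refl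
    ; first = trans (proj₂ (proj₂ hit)) (sym (*-identityʳ _)) ; next = λ () }
    where
    hit = intermediate-value f wp wq 1≤fp fq≤-1 (-1≤sign (σ zero)) (sign≤1 (σ zero))
  every-itinerary {suc m} f g bound wp wq 1≤fp fq≤-1 σ = extend (bound zero)
    (every-itinerary (fold (σ zero) (g zero) f) (g ∘ suc) (bound ∘ suc)
      (proj₁ (proj₂ at-0)) (proj₁ (proj₂ at-s))
      (1≤fold (σ zero) (g zero) f (proj₁ at-0) (proj₁ (bound zero (proj₁ (proj₂ at-0)))) (proj₂ (proj₂ at-0)))
      (fold≤-1 (σ zero) (g zero) f (proj₁ at-s) (proj₂ (bound zero (proj₁ (proj₂ at-s)))) (proj₂ (proj₂ at-s)))
      (σ ∘ suc))
    where
    -- The folded function is at least 1 where f is 0 and at most -1 where f is `sign (σ zero)`;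
    -- these two parameters take over the roles of p and q.
    at-0 = intermediate-value f wp wq 1≤fp fq≤-1 (<⇒≤ (by-< 1# 0<1 (solve 0 (:0 :- :- :1 := :1) refl))) 0≤1
    at-s = intermediate-value f wp wq 1≤fp fq≤-1 (-1≤sign (σ zero)) (sign≤1 (σ zero))

  -- Corners of a single cluster

  headOr : ∀ {b} {B : Set b} {m} → B → (Fin m → B) → B
  headOr {m = zero}  z X = z
  headOr {m = suc m} z X = X zero

  -- The default z ends the chain of couplings: the last level has no successor. The type of the
  -- entries is open, so that the shift acts on the level functionals and on their values alike.
  shift : ∀ {b} {B : Set b} {m} → B → (Fin m → B) → Fin m → B
  shift z X zero    = headOr z (X ∘ suc)
  shift z X (suc k) = shift z (X ∘ suc) k

  abstract
    shift-resp : ∀ {m} {X Y : ℝ^ m} → X ≋ Y → shift 0# X ≋ shift 0# Y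
    shift-resp {suc zero}    X≋Y zero    = refl
    shift-resp {suc (suc m)} X≋Y zero    = X≋Y (suc zero)
    shift-resp {suc m}       X≋Y (suc k) = shift-resp (X≋Y ∘ suc) k

    shift-· : ∀ {m n} (N : Fin m → ℝ^ n) x k → shift 𝟎 N k · x ≈ shift 0# (λ k → N k · x) k
    shift-· {suc zero}    N x zero    = ·-𝟎ˡ x
    shift-· {suc (suc m)} N x zero    = refl
    shift-· {suc m}       N x (suc k) = shift-· (N ∘ suc) x k

    shift-≤ : ∀ {m y} (X : ℝ^ suc m) → 0# ≤ y → (∀ k → X (suc k) ≤ y) → ∀ k → shift 0# X k ≤ y
    shift-≤ {zero}  X 0≤y X≤y zero    = 0≤y
    shift-≤ {suc m} X 0≤y X≤y zero    = X≤y zero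
    shift-≤ {suc m} X 0≤y X≤y (suc k) = shift-≤ (X ∘ suc) 0≤y (X≤y ∘ suc) k

    shift-𝟎 : ∀ {m} k → shift 0# (𝟎 {m}) k ≈ 0#
    shift-𝟎 {suc zero}    zero    = refl
    shift-𝟎 {suc (suc m)} zero    = refl
    shift-𝟎 {suc m}       (suc k) = shift-𝟎 {m} k

    sum-shift : ∀ {m} (μ X : ℝ^ suc m) →
                sum (λ k → μ k * shift 0# X k) ≈ sum (λ k → μ (inject₁ k) * X (suc k))
    sum-shift {zero}  μ X = trans (+-identityʳ _) (zeroʳ (μ zero))
    sum-shift {suc m} μ X = +-congˡ (sum-shift (μ ∘ suc) (X ∘ suc))

    sign*≤ : ∀ s {w y} → - w ≤ y → y ≤ w → sign s * y ≤ w
    sign*≤ zero       {w} {y} -w≤y y≤w = ≤-cong (sym (*-identityˡ y)) refl y≤w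
    sign*≤ (suc zero) {w} {y} -w≤y y≤w = by-≤ (y - - w) (diff-≤ -w≤y)
      (solve 2 (λ w y → w :- :- :1 :* y := y :- :- w) refl w y)

    sign-cancel : ∀ s w → sign s * (sign s * w) ≈ w
    sign-cancel s w = trans (sym (*-assoc _ _ _)) (trans (*-congʳ (sign²≈1 s)) (*-identityˡ w))

  -- Corners satisfy ∣X k∣ ≤ 2 height k, and 7 ∣X (k + 1)∣ has to stay below
  -- height k: any ratio above 2 · 7 would do.
  15^ : ℕ → Carrier
  15^ zero    = 1#
  15^ (suc m) = ♯ 15 * 15^ m

  height : ∀ m → Fin m → Carrier
  height (suc m) zero    = 15^ m
  height (suc m) (suc k) = height m k

  -- Back substitution, from the last level, in the triangular system σ k X k + 7 X (k + 1) = height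
  -- k of the walls chosen by σ.
  corner : ∀ m → (Fin m → Fin 2) → ℝ^ m
  corner (suc m) σ zero    = sign (σ zero) * (15^ m - ♯ 7 * headOr 0# (corner m (σ ∘ suc)))
  corner (suc m) σ (suc k) = corner m (σ ∘ suc) k

  abstract
    1≤15^ : ∀ m → 1# ≤ 15^ m
    1≤15^ zero = ≤-refl
    1≤15^ (suc m) = ≤-trans (1≤15^ m) (by-≤ (♯ 14 * 15^ m) (0≤-* (<⇒≤ (0<♯ 13)) (≤-trans 0≤1 (1≤15^ m)))
      (solve 1 (λ p → :♯ 15 :* p :- p := :♯ 14 :* p) refl (15^ m)))

    0<15^ : ∀ m → 0# < 15^ m
    0<15^ m = <-≤-trans 0<1 (1≤15^ m)

    1≤height : ∀ m k → 1# ≤ height m k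
    1≤height (suc m) zero    = 1≤15^ m
    1≤height (suc m) (suc k) = 1≤height m k

    7*< : ∀ {p y} → 0# < p → y ≤ ♯ 2 * p → ♯ 7 * y < ♯ 15 * p
    7*< {p} {y} 0<p y≤2p = by-< (p + ♯ 7 * (♯ 2 * p - y)) (0<-+ 0<p (0≤-* (<⇒≤ (0<♯ 6)) (diff-≤ y≤2p)))
      (solve 2 (λ p y → :♯ 15 :* p :- :♯ 7 :* y := p :+ :♯ 7 :* (:♯ 2 :* p :- y)) refl p y)

    head-bound : ∀ m σ → let y = ♯ 7 * headOr 0# (corner m σ) in (- 15^ m < y) × (y < 15^ m)
    head-bound zero σ =
      by-< 1# 0<1 (solve 0 (:♯ 7 :* :0 :- :- :1 := :1) refl) ,
      by-< 1# 0<1 (solve 0 (:1 :- :♯ 7 :* :0 := :1) refl)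
    head-bound (suc m) σ =
      by-< (♯ 15 * p - ♯ 7 * (- (s * w))) (diff-< (7*< 0<p (≤-trans (by-≤ _ (diff-≤ (-≤sign* (σ zero) 0≤w)) (solve 2 (λ w y → w :- :- y := y :- :- w) refl w (s * w))) w≤2p)))
        (solve 2 (λ p y → :♯ 7 :* y :- :- (:♯ 15 :* p) := :♯ 15 :* p :- :♯ 7 :* (:- y)) refl p (s * w)) ,
      7*< 0<p (≤-trans (sign*≤self (σ zero) 0≤w) w≤2p)
      where
      p s y w : Carrier
      p = 15^ m
      s = sign (σ zero)
      y = ♯ 7 * headOr 0# (corner m (σ ∘ suc))
      w = p - y
      0<p : 0# < p
      0<p = 0<15^ m
      0≤w : 0# ≤ w
      0≤w = diff-≤ (<⇒≤ (proj₂ (head-bound m (σ ∘ suc))))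
      w≤2p : w ≤ ♯ 2 * p
      w≤2p = by-≤ (y - - p) (diff-≤ (<⇒≤ (proj₁ (head-bound m (σ ∘ suc)))))
        (solve 2 (λ p y → :♯ 2 :* p :- (p :- y) := y :- :- p) refl p y)

    corner-shift : ∀ m σ k → ♯ 7 * shift 0# (corner m σ) k < height m k
    corner-shift (suc m) σ zero    = proj₂ (head-bound m (σ ∘ suc))
    corner-shift (suc m) σ (suc k) = corner-shift m (σ ∘ suc) k

    corner-value : ∀ m σ k → corner m σ k ≈ sign (σ k) * (height m k - ♯ 7 * shift 0# (corner m σ) k)
    corner-value (suc m) σ zero    = refl
    corner-value (suc m) σ (suc k) = corner-value m (σ ∘ suc) k

    -- The signs of its levels recover σ from the corner, so different sequences give different
    -- vertices.
    corner-positive : ∀ m σ k → 0# < sign (σ k) * corner m σ k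
    corner-positive m σ k = <-cong refl (sym (trans (*-congˡ (corner-value m σ k)) (sign-cancel (σ k) _)))
      (diff-< (corner-shift m σ k))

    corner-tight : ∀ m σ k → sign (σ k) * corner m σ k + ♯ 7 * shift 0# (corner m σ) k ≈ height m k
    corner-tight m σ k = trans (+-congʳ (trans (*-congˡ (corner-value m σ k)) (sign-cancel (σ k) _)))
      (solve 2 (λ h y → h :- y :+ y := h) refl (height m k) (♯ 7 * shift 0# (corner m σ) k))

    corner-inside : ∀ m σ k s → sign s * corner m σ k + ♯ 7 * shift 0# (corner m σ) k ≤ height m k
    corner-inside m σ k s = by-≤ _ (diff-≤ (sign*≤ s (≤-cong refl (sym (corner-value m σ k)) (-≤sign* (σ k) 0≤w))
                                             (≤-cong (sym (corner-value m σ k)) refl (sign*≤self (σ k) 0≤w))))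
      (solve 3 (λ h y z → h :- (z :+ y) := h :- y :- z) refl (height m k) (♯ 7 * shift 0# (corner m σ) k) (sign s * corner m σ k))
      where
      0≤w : 0# ≤ height m k - ♯ 7 * shift 0# (corner m σ) k
      0≤w = diff-≤ (<⇒≤ (corner-shift m σ k))

  -- Below the cap, where the walls have moved out to height + 1, this point lies
  -- on the wall (k , s) only.
  axis : ∀ m → Fin m → Fin 2 → ℝ^ m
  axis m k s i = sign s * (height m k + 1#) * δ k i

  abstract
    0<height+1 : ∀ m k → 0# < height m k + 1#
    0<height+1 m k = 0<-+ʳ (≤-trans 0≤1 (1≤height m k)) 0<1

    shift-axis-0 : ∀ {m} (k : Fin m) c → shift 0# (λ i → c * δ k i) k ≈ 0#
    shift-axis-0 {suc zero}    zero    c = refl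
    shift-axis-0 {suc (suc m)} zero    c = zeroʳ c
    shift-axis-0 {suc m}       (suc k) c = shift-axis-0 k c

    7*0< : ∀ {y h} → y ≈ 0# → 1# ≤ h → ♯ 7 * y < h + 1#
    7*0< {y} {h} y≈0 1≤h = by-< ((h - 1#) + ♯ 2) (0<-+ʳ (diff-≤ 1≤h) (0<♯ 1))
      (trans (+-congˡ (-‿cong (*-congˡ y≈0))) (solve 1 (λ h → h :+ :1 :- :♯ 7 :* :0 := (h :- :1) :+ :♯ 2) refl h))

    shift-axis : ∀ {m} (k : Fin m) c → c ≤ height m k + 1# → ∀ i → ♯ 7 * shift 0# (λ i → c * δ k i) i < height m i + 1#
    shift-axis {suc zero}    zero c _ zero = 7*0< refl (1≤height 1 zero)
    shift-axis {suc (suc m)} zero c _ zero = 7*0< (zeroʳ c) (1≤height (suc (suc m)) zero)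
    shift-axis {suc m} zero c _ (suc i) =
      7*0< (trans (shift-resp {m} (λ _ → zeroʳ c) i) (shift-𝟎 {m} i)) (1≤height m i)
    -- Only the walls one level before the axis feel it through the coupling term; there 7 (p + 1) <
    -- 15 p + 1 because p ≥ 1.
    shift-axis {suc (suc m)} (suc zero) c c≤ zero = by-< (♯ 7 * (p + 1# - c * 1#) + (♯ 8 * (p - 1#) + ♯ 2))
      (0<-+ʳ (0≤-* (<⇒≤ (0<♯ 6)) (diff-≤ (≤-cong (sym (*-identityʳ c)) refl c≤)))
        (0<-+ʳ (0≤-* (<⇒≤ (0<♯ 7)) (diff-≤ (1≤15^ m))) (0<♯ 1)))
      (solve 2 (λ p c → :♯ 15 :* p :+ :1 :- :♯ 7 :* (c :* :1) := :♯ 7 :* (p :+ :1 :- c :* :1) :+ (:♯ 8 :* (p :- :1) :+ :♯ 2)) refl p c)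
      where
      p : Carrier
      p = 15^ m
    shift-axis {suc (suc m)} (suc (suc k)) c _ zero = 7*0< (zeroʳ c) (1≤height (suc (suc m)) zero)
    shift-axis {suc m} (suc k) c c≤ (suc i) = shift-axis k c c≤ i

    axis-tight : ∀ m k s → sign s * axis m k s k + ♯ 7 * shift 0# (axis m k s) k ≈ height m k + 1#
    axis-tight m k s = trans (+-cong (trans (*-congˡ (trans (*-congˡ (δ-diag k)) (*-identityʳ _))) (sign-cancel s _))
        (*-congˡ (shift-axis-0 k (sign s * (height m k + 1#)))))
      (solve 1 (λ h → h :+ :♯ 7 :* :0 := h) refl (height m k + 1#))

    axis-opposite : ∀ m k s t → t ≢ s → sign t * axis m k s k + ♯ 7 * shift 0# (axis m k s) k < height m k + 1#
    axis-opposite m k s t t≢s = <-cong (sym (trans (+-cong (trans (*-congˡ (trans (*-congˡ (δ-diag k)) (*-identityʳ _))) (opposite t s t≢s))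
        (*-congˡ (shift-axis-0 k (sign s * (height m k + 1#)))))
        (solve 1 (λ h → :- h :+ :♯ 7 :* :0 := :- h) refl (height m k + 1#)))) refl
      (by-< _ (0<-+ (0<height+1 m k) (<⇒≤ (0<height+1 m k))) (solve 1 (λ h → h :- :- h := h :+ h) refl (height m k + 1#)))
      where
      opposite : ∀ t s → t ≢ s → ∀ {h} → sign t * (sign s * h) ≈ - h
      opposite zero zero t≢s = ⊥-elim (t≢s ≡.refl)
      opposite zero (suc zero) _ {h} = solve 1 (λ h → :1 :* (:- :1 :* h) := :- h) refl h
      opposite (suc zero) zero _ {h} = solve 1 (λ h → :- :1 :* (:1 :* h) := :- h) refl h
      opposite (suc zero) (suc zero) t≢s = ⊥-elim (t≢s ≡.refl)

    axis-other : ∀ m k s i t → i ≢ k → sign t * axis m k s i + ♯ 7 * shift 0# (axis m k s) i < height m i + 1#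
    axis-other m k s i t i≢k = <-cong (sym (trans (+-congʳ (trans (*-congˡ (trans (*-congˡ (δ-off (i≢k ∘ ≡.sym))) (zeroʳ _))) (zeroʳ _))) (+-identityˡ _))) refl
      (shift-axis k (sign s * (height m k + 1#)) (sign*≤self s (<⇒≤ (0<height+1 m k))) i)

  data Ineq (d : ℕ) : Set where
    cap  : Ineq d
    wall : Fin d → Fin 2 → Ineq d

  𝟏 : ∀ {n} → ℝ^ n
  𝟏 _ = 1#

  abstract
    𝟏-· : ∀ {n} (x : ℝ^ n) → 𝟏 · x ≈ sum x
    𝟏-· x = sum-cong λ i → *-identityˡ (x i)

    -- The sum telescopes to r₀ X₀ + Σ gₖ Xₖ₊₁, since r₀ and gₖ are s₀ μ₀ and
    -- sₖ₊₁ μₖ₊₁ + 7 μₖ.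
    itinerary-sum : ∀ {m lo hi f} {g : Fin m → Affine} {σ} (I : Itinerary lo hi f g σ) (X : ℝ^ suc m) →
      let open Itinerary I in
      at f t * X zero + sum (λ k → at (g k) t * X (suc k)) ≈
      sum (λ k → μ k * (sign (σ k) * X k + ♯ 7 * shift 0# X k))
    itinerary-sum {m} {f = f} {g} {σ} I X = sym (begin
      sum (λ k → μ k * (s k * X k + ♯ 7 * shift 0# X k))
        ≈⟨ sum-cong (λ k → solve 4 (λ u s x y → u :* (s :* x :+ :♯ 7 :* y) := s :* u :* x :+ :♯ 7 :* (u :* y)) refl (μ k) (s k) (X k) (shift 0# X k)) ⟩
      sum (λ k → s k * μ k * X k + ♯ 7 * (μ k * shift 0# X k))
        ≈⟨ sum-+ (λ k → s k * μ k * X k) (λ k → ♯ 7 * (μ k * shift 0# X k)) ⟩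
      sum (λ k → s k * μ k * X k) + sum (λ k → ♯ 7 * (μ k * shift 0# X k))
        ≈⟨ +-congˡ (trans (sum-* (♯ 7) (λ k → μ k * shift 0# X k)) (trans (*-congˡ (sum-shift μ X)) (sym (sum-* (♯ 7) (λ k → μ (inject₁ k) * X (suc k)))))) ⟩
      (s zero * μ zero * X zero + sum (λ k → s (suc k) * μ (suc k) * X (suc k))) + sum (λ k → ♯ 7 * (μ (inject₁ k) * X (suc k)))
        ≈⟨ trans (+-assoc _ _ _) (+-congˡ (sym (sum-+ (λ k → s (suc k) * μ (suc k) * X (suc k)) (λ k → ♯ 7 * (μ (inject₁ k) * X (suc k)))))) ⟩
      s zero * μ zero * X zero + sum (λ k → s (suc k) * μ (suc k) * X (suc k) + ♯ 7 * (μ (inject₁ k) * X (suc k)))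
        ≈⟨ +-cong (*-congʳ (sym first)) (sum-cong λ k → trans (+-congˡ (sym (*-assoc _ _ _))) (trans (sym (distribʳ _ _ _)) (*-congʳ (sym (next k))))) ⟩
      at f t * X zero + sum (λ k → at (g k) t * X (suc k)) ∎)
      where
      open Itinerary I
      s : Fin (suc m) → Carrier
      s k = sign (σ k)

    -- A wall normal is H V i plus the cap normal y. After multiplication by H the walls account for
    -- the multiple Σ μ of y, and the rest H - Σ μ is the weight of the cap.
    weighted-sum : ∀ {k} (H y : Carrier) (μ V : ℝ^ k) →
      H * (y + sum (λ i → μ i * V i)) ≈ sum (λ i → μ i * (H * V i + y)) + (H - sum μ) * y
    weighted-sum H y μ V = sym (begin
      sum (λ i → μ i * (H * V i + y)) + (H - sum μ) * y
        ≈⟨ +-congʳ (trans (sum-cong λ i → solve 4 (λ u h v y → u :* (h :* v :+ y) := h :* (u :* v) :+ y :* u) refl (μ i) H (V i) y)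
             (trans (sum-+ (λ i → H * (μ i * V i)) (λ i → y * μ i)) (+-cong (sum-* H (λ i → μ i * V i)) (sum-* y μ)))) ⟩
      H * sum (λ i → μ i * V i) + y * sum μ + (H - sum μ) * y
        ≈⟨ solve 4 (λ h s y u → h :* s :+ y :* u :+ (h :- u) :* y := h :* (y :+ s)) refl H (sum (λ i → μ i * V i)) y (sum μ) ⟩
      H * (y + sum (λ i → μ i * V i)) ∎)

  -- Coordinates adapted to one cluster

  module Frame (m : ℕ) where

    d : ℕ
    d = suc m

    n : ℕ
    n = suc d

    abstract
      -- H exceeds the sum of d weights in [0 , 1].  K slows the lateral coordinates
      -- down so that they vary by at most 1 while the radial one sweeps [-1 , 1].
      -- B is the ratio of consecutive scales that keeps the structures apart.
      H K B : Carrier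
      H = ι n
      K = H * (♯ 4 * H + 1#)
      B = ♯ 12 * K + 1#

      H≈ι : H ≈ ι n
      H≈ι = refl

      K≈ : K ≈ H * (♯ 4 * H + 1#)
      K≈ = refl

      B≈ : B ≈ ♯ 12 * K + 1#
      B≈ = refl

      1≤H : 1# ≤ H
      1≤H = 1≤ι d

      0<H : 0# < H
      0<H = <-≤-trans 0<1 1≤H

      1+ιd≈H : 1# + ι d ≈ H
      1+ιd≈H = refl

      0<4H+1 : 0# < ♯ 4 * H + 1#
      0<4H+1 = 0<-+ʳ (0≤-* (<⇒≤ (0<♯ 3)) (<⇒≤ 0<H)) 0<1

      0<K : 0# < K
      0<K = 0<-* 0<H 0<4H+1

      1≤K : 1# ≤ K
      1≤K = by-≤ (H * (♯ 4 * H) + (H - 1#)) (0≤-+ (0≤-* (<⇒≤ 0<H) (0≤-* (<⇒≤ (0<♯ 3)) (<⇒≤ 0<H))) (diff-≤ 1≤H))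
        (solve 1 (λ h → h :* (:♯ 4 :* h :+ :1) :- :1 := h :* (:♯ 4 :* h) :+ (h :- :1)) refl H)

      1≤B : 1# ≤ B
      1≤B = by-≤ (♯ 12 * K) (0≤-* (<⇒≤ (0<♯ 11)) (<⇒≤ 0<K)) (solve 1 (λ k → :♯ 12 :* k :+ :1 :- :1 := :♯ 12 :* k) refl K)

    -- κ holds the slowing factors, and ω the coefficients of the objective at parameter 0. Lateral
    -- ones start at 4, the middle of [2 , 6]; the radial one starts at -4 H and has to climb past
    -- -1 before the sweep begins.
    κ ω : Fin d → Carrier
    κ zero    = 1#
    κ (suc _) = K
    ω zero    = - (♯ 4 * H)
    ω (suc _) = ♯ 4

    -- Level 0 is the radial coordinate, in the direction π 1, and the other levels
    -- are lateral; all are measured from the coordinate π 0.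
    module Adapted (π : Permutation′ n) (R : Carrier) (0<R : 0# < R) where

      level : Fin d → ℝ^ n
      level k = (R * κ k) *ᵥ (δ (π ⟨$⟩ʳ suc k) +ᵥ (- 1#) *ᵥ δ (π ⟨$⟩ʳ zero))

      -- The coordinate X∗, chosen so that 𝟏 is `capNormal` plus the combination of the levels with
      -- coefficients ω.
      capNormal : ℝ^ n
      capNormal = 𝟏 +ᵥ (- 1#) *ᵥ combination ω level

      -- The factor H reserves room for the cap: d weights of at most 1 add up to less than H, so a
      -- positive weight remains for it.
      normal : Ineq d → ℝ^ n
      normal cap        = capNormal
      normal (wall k s) = H *ᵥ (sign s *ᵥ level k +ᵥ ♯ 7 *ᵥ shift 𝟎 level k) +ᵥ capNormal

      abstract
        0<κ : ∀ k → 0# < κ k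
        0<κ zero    = 0<1
        0<κ (suc _) = 0<K

        0<Rκ : ∀ k → 0# < R * κ k
        0<Rκ k = 0<-* 0<R (0<κ k)

        level-· : ∀ k x → level k · x ≈ R * κ k * (x (π ⟨$⟩ʳ suc k) - x (π ⟨$⟩ʳ zero))
        level-· k x = trans (·-*ˡ (R * κ k) (δ (π ⟨$⟩ʳ suc k) +ᵥ (- 1#) *ᵥ δ (π ⟨$⟩ʳ zero)) x) (*-congˡ
          (trans (·-+ˡ (δ (π ⟨$⟩ʳ suc k)) ((- 1#) *ᵥ δ (π ⟨$⟩ʳ zero)) x)
            (+-cong (δ-· (π ⟨$⟩ʳ suc k) x) (trans (·-*ˡ (- 1#) (δ (π ⟨$⟩ʳ zero)) x)
              (trans (*-congˡ (δ-· (π ⟨$⟩ʳ zero) x)) (solve 1 (λ y → :- :1 :* y := :- y) refl (x (π ⟨$⟩ʳ zero))))))))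

        cap-· : ∀ x → capNormal · x ≈ sum x - sum (λ k → ω k * (level k · x))
        cap-· x = trans (·-+ˡ 𝟏 ((- 1#) *ᵥ combination ω level) x) (+-cong (𝟏-· x)
          (trans (·-*ˡ (- 1#) (combination ω level) x) (trans (*-congˡ (trans (·-comm (combination ω level) x)
            (trans (·-combination x ω level) (sum-cong λ k → *-congˡ {ω k} (·-comm x (level k))))))
            (solve 1 (λ y → :- :1 :* y := :- y) refl (sum (λ k → ω k * (level k · x)))))))

        wall-· : ∀ k s x → normal (wall k s) · x ≈
          H * (sign s * (level k · x) + ♯ 7 * shift 0# (λ k → level k · x) k) + capNormal · x
        wall-· k s x = trans (·-+ˡ (H *ᵥ (sign s *ᵥ level k +ᵥ ♯ 7 *ᵥ shift 𝟎 level k)) capNormal x) (+-congʳ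
          (trans (·-*ˡ H (sign s *ᵥ level k +ᵥ ♯ 7 *ᵥ shift 𝟎 level k) x) (*-congˡ
            (trans (·-+ˡ (sign s *ᵥ level k) (♯ 7 *ᵥ shift 𝟎 level k) x)
              (+-cong (·-*ˡ (sign s) (level k) x)
                (trans (·-*ˡ (♯ 7) (shift 𝟎 level k) x) (*-congˡ (shift-· level x k))))))))

        -- If all levels vanish, the coordinates of x share one value c, and the cap then gives n c
        -- = 0.
        rows-injective : ∀ x → (∀ i → (capNormal ∷ level) i · x ≈ 0#) → x ≋ 𝟎
        rows-injective x h i = trans (x≈c i) c≈0
          where
          c : Carrier
          c = x (π ⟨$⟩ʳ zero)
          xπ≈c : ∀ k → x (π ⟨$⟩ʳ k) ≈ c
          xπ≈c zero = refl
          xπ≈c (suc k) = trans (solve 2 (λ x c → x := (x :- c) :+ c) refl (x (π ⟨$⟩ʳ suc k)) c)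
            (trans (+-congʳ (*-cancel-0 (<⇒≉ (0<Rκ k)) (trans (sym (level-· k x)) (h (suc k))))) (+-identityˡ c))
          x≈c : ∀ i → x i ≈ c
          x≈c i = trans (reflexive (≡.cong x (≡.sym (inverseʳ π)))) (xπ≈c (π ⟨$⟩ˡ i))
          Σx≈0 : sum x ≈ 0#
          Σx≈0 = trans (solve 2 (λ s u → s := (s :- u) :+ u) refl (sum x) (sum (λ k → ω k * (level k · x))))
            (trans (+-cong (trans (sym (cap-· x)) (h zero)) (sum-0 λ k → trans (*-congˡ (h (suc k))) (zeroʳ (ω k)))) (+-identityʳ 0#))
          c≈0 : c ≈ 0#
          c≈0 = *-cancel-0 (<⇒≉ 0<H) (trans (*-congʳ H≈ι) (trans (sym (sum-const n c)) (trans (sum-cong {v = x} (λ i → sym (x≈c i))) Σx≈0)))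

        point-with : ∀ (y : Carrier) (X : ℝ^ d) → ∃[ x ] (capNormal · x ≈ y × ∀ k → level k · x ≈ X k)
        point-with y X = read (injective⇒surjective (capNormal ∷ level) rows-injective (y ∷ X))
          where
          read : ∃[ x ] (∀ i → (capNormal ∷ level) i · x ≈ (y ∷ X) i) →
                 ∃[ x ] (capNormal · x ≈ y × ∀ k → level k · x ≈ X k)
          read (x , h) = x , h zero , h ∘ suc

        -- As c is orthogonal to 𝟏, it sees only differences of coordinates, and those are what the
        -- levels measure.
        sum-zero-· : ∀ (c x : ℝ^ n) → sum c ≈ 0# →
          c · x ≈ sum (λ k → c (π ⟨$⟩ʳ suc k) * (x (π ⟨$⟩ʳ suc k) - x (π ⟨$⟩ʳ zero)))
        sum-zero-· c x Σc≈0 = begin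
          c · x                                     ≈⟨ sum-permute (λ i → c i * x i) π ⟩
          c₀ * x₀ + sum (λ k → c′ k * x′ k)         ≈⟨ solve 4 (λ c x s t → c :* x :+ s := (c :+ t) :* x :+ (s :+ :- x :* t)) refl c₀ x₀ (sum (λ k → c′ k * x′ k)) (sum c′) ⟩
          (c₀ + sum c′) * x₀ + (sum (λ k → c′ k * x′ k) + - x₀ * sum c′)
            ≈⟨ +-cong (trans (*-congʳ (trans (sym (sum-permute c π)) Σc≈0)) (zeroˡ x₀)) (+-congˡ (sym (sum-* (- x₀) c′))) ⟩
          0# + (sum (λ k → c′ k * x′ k) + sum (λ k → - x₀ * c′ k))
            ≈⟨ trans (+-identityˡ _) (sym (sum-+ (λ k → c′ k * x′ k) (λ k → - x₀ * c′ k))) ⟩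
          sum (λ k → c′ k * x′ k + - x₀ * c′ k)
            ≈⟨ sum-cong (λ k → solve 3 (λ c x y → c :* x :+ :- y :* c := c :* (x :- y)) refl (c′ k) (x′ k) x₀) ⟩
          sum (λ k → c′ k * (x′ k - x₀)) ∎
          where
          c₀ x₀ : Carrier
          c₀ = c (π ⟨$⟩ʳ zero)
          x₀ = x (π ⟨$⟩ʳ zero)
          c′ x′ : Fin d → Carrier
          c′ k = c (π ⟨$⟩ʳ suc k)
          x′ k = x (π ⟨$⟩ʳ suc k)

        1/Rκ : ∀ k → ∃[ u ] (0# < u × R * κ k * u ≈ 1#)
        1/Rκ k = reciprocal (R * κ k) (0<Rκ k)

      coefficient : ℝ^ n → Fin d → Affine
      coefficient c k = ω k +t* (c (π ⟨$⟩ʳ suc k) * proj₁ (1/Rκ k))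

      Path : ℝ^ n → Carrier → Carrier → (Fin d → Fin 2) → Set _
      Path c lo hi σ = Itinerary lo hi (coefficient c zero) (coefficient c ∘ suc) σ

      abstract
        objective-· : ∀ (c x : ℝ^ n) t → sum c ≈ 0# →
          (𝟏 +ᵥ t *ᵥ c) · x ≈ capNormal · x + sum (λ k → at (coefficient c k) t * (level k · x))
        objective-· c x t Σc≈0 = begin
          (𝟏 +ᵥ t *ᵥ c) · x            ≈⟨ trans (·-+ˡ 𝟏 (t *ᵥ c) x) (+-cong (𝟏-· x) (·-*ˡ t c x)) ⟩
          sum x + t * (c · x)          ≈⟨ +-cong (solve 2 (λ s u → s := (s :- u) :+ u) refl (sum x) (sum (λ k → ω k * (level k · x))))
                                            (trans (*-congˡ (sum-zero-· c x Σc≈0)) (sym (sum-* t (λ k → c′ k * Δ k)))) ⟩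
          sum x - sum (λ k → ω k * (level k · x)) + sum (λ k → ω k * (level k · x)) + sum (λ k → t * (c′ k * Δ k))
            ≈⟨ trans (+-assoc _ _ _) (+-cong (sym (cap-· x)) (sym (sum-+ (λ k → ω k * (level k · x)) (λ k → t * (c′ k * Δ k))))) ⟩
          capNormal · x + sum (λ k → ω k * (level k · x) + t * (c′ k * Δ k))
            ≈⟨ +-congˡ (sum-cong λ k → trans (+-congˡ (term k)) (sym (distribʳ (level k · x) (ω k) (t * (c′ k * proj₁ (1/Rκ k)))))) ⟩
          capNormal · x + sum (λ k → at (coefficient c k) t * (level k · x)) ∎
          where
          c′ Δ : Fin d → Carrier
          c′ k = c (π ⟨$⟩ʳ suc k)
          Δ k = x (π ⟨$⟩ʳ suc k) - x (π ⟨$⟩ʳ zero)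
          term : ∀ k → t * (c′ k * Δ k) ≈ t * (c′ k * proj₁ (1/Rκ k)) * (level k · x)
          term k = begin
            t * (c′ k * Δ k)                                             ≈⟨ sym (*-identityʳ _) ⟩
            t * (c′ k * Δ k) * 1#                                        ≈⟨ *-congˡ (sym (proj₂ (proj₂ (1/Rκ k)))) ⟩
            t * (c′ k * Δ k) * (R * κ k * proj₁ (1/Rκ k))                ≈⟨ solve 5 (λ t c D r u → t :* (c :* D) :* (r :* u) := t :* (c :* u) :* (r :* D)) refl t (c′ k) (Δ k) (R * κ k) (proj₁ (1/Rκ k)) ⟩
            t * (c′ k * proj₁ (1/Rκ k)) * (R * κ k * Δ k)                ≈⟨ *-congˡ (sym (level-· k x)) ⟩
            t * (c′ k * proj₁ (1/Rκ k)) * (level k · x)                  ∎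

        -- The weights exhibit the objective in the normal cone of the corner σ.
        certificate : ∀ c {lo hi σ} → sum c ≈ 0# → (I : Path c lo hi σ) → ∀ x →
          let open Itinerary I in
          H * ((𝟏 +ᵥ t *ᵥ c) · x) ≈
          sum (λ k → μ k * (normal (wall k (σ k)) · x)) + (H - sum μ) * (capNormal · x)
        certificate c {σ = σ} Σc≈0 I x = begin
          H * ((𝟏 +ᵥ t *ᵥ c) · x)   ≈⟨ *-congˡ (trans (objective-· c x t Σc≈0) (+-congˡ (itinerary-sum I (λ k → level k · x)))) ⟩
          H * (capNormal · x + sum (λ k → μ k * (sign (σ k) * (level k · x) + ♯ 7 * shift 0# (λ k → level k · x) k)))
            ≈⟨ weighted-sum H (capNormal · x) μ (λ k → sign (σ k) * (level k · x) + ♯ 7 * shift 0# (λ k → level k · x) k) ⟩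
          sum (λ k → μ k * (H * (sign (σ k) * (level k · x) + ♯ 7 * shift 0# (λ k → level k · x) k) + capNormal · x)) + (H - sum μ) * (capNormal · x)
            ≈⟨ +-congʳ (sum-cong λ k → *-congˡ {μ k} (sym (wall-· k (σ k) x))) ⟩
          sum (λ k → μ k * (normal (wall k (σ k)) · x)) + (H - sum μ) * (capNormal · x) ∎
          where open Itinerary I

        0<H-Σμ : ∀ c {lo hi σ} → (I : Path c lo hi σ) → 0# < H - sum (Itinerary.μ I)
        0<H-Σμ c I = <-≤-trans 0<1 (by-≤ (ι d - sum μ) (diff-≤ (sum-mono μ≤1))
            (trans (+-congʳ (+-congʳ (sym 1+ιd≈H))) (solve 2 (λ i s → :1 :+ i :- s :- :1 := i :- s) refl (ι d) (sum μ))))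
          where open Itinerary I

      module Ray (c : ℝ^ n) (0<cj : 0# < c (π ⟨$⟩ʳ suc zero))
               (≤Hcj : ∀ i → c i ≤ H * c (π ⟨$⟩ʳ suc zero))
               (-Hcj≤ : ∀ i → - (H * c (π ⟨$⟩ʳ suc zero)) ≤ c i) where
        abstract
          cj u e lo hi : Carrier
          cj = c (π ⟨$⟩ʳ suc zero)
          u = proj₁ (1/Rκ zero)
          -- e is the increment of the parameter that raises the radial coefficient by 1; this
          -- coefficient is -1 at `lo` and 1 at `hi`.
          e = proj₁ (reciprocal (cj * u) (0<-* 0<cj (proj₁ (proj₂ (1/Rκ zero)))))
          lo = (♯ 4 * H - 1#) * e
          hi = (♯ 4 * H + 1#) * e

          0<e : 0# < e
          0<e = proj₁ (proj₂ (reciprocal (cj * u) (0<-* 0<cj (proj₁ (proj₂ (1/Rκ zero))))))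

          cju-e : cj * u * e ≈ 1#
          cju-e = proj₂ (proj₂ (reciprocal (cj * u) (0<-* 0<cj (proj₁ (proj₂ (1/Rκ zero))))))

          0<lo : 0# < lo
          0<lo = 0<-* (<-≤-trans (0<♯ 2) (by-≤ (♯ 4 * (H - 1#)) (0≤-* (<⇒≤ (0<♯ 3)) (diff-≤ 1≤H))
                   (solve 1 (λ h → :♯ 4 :* h :- :1 :- :♯ 3 := :♯ 4 :* (h :- :1)) refl H))) 0<e

          lo≤hi : lo ≤ hi
          lo≤hi = by-≤ (♯ 2 * e) (0≤-* (<⇒≤ (0<♯ 1)) (<⇒≤ 0<e))
            (solve 2 (λ h e → (:♯ 4 :* h :+ :1) :* e :- (:♯ 4 :* h :- :1) :* e := :♯ 2 :* e) refl H e)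

          e-cj≈R : e * cj ≈ R
          e-cj≈R = begin
            e * cj                  ≈⟨ sym (*-identityʳ _) ⟩
            e * cj * 1#             ≈⟨ *-congˡ (sym (proj₂ (proj₂ (1/Rκ zero)))) ⟩
            e * cj * (R * 1# * u)   ≈⟨ solve 4 (λ e c r u → e :* c :* (r :* :1 :* u) := r :* (c :* u :* e)) refl e cj R u ⟩
            R * (cj * u * e)        ≈⟨ trans (*-congˡ cju-e) (*-identityʳ R) ⟩
            R                       ∎

          -- This identity dictates K: by the parameter `hi`, a lateral coordinate of the largest
          -- size H c j has moved its coefficient by exactly 1.
          hi-scale : ∀ {u} → R * K * u ≈ 1# → u * (hi * (H * cj)) ≈ 1#
          hi-scale {u} RKu≈1 = begin
            u * ((♯ 4 * H + 1#) * e * (H * cj))   ≈⟨ solve 5 (λ u q e h c → u :* (q :* e :* (h :* c)) := u :* (h :* q) :* (e :* c)) refl u (♯ 4 * H + 1#) e H cj ⟩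
            u * (H * (♯ 4 * H + 1#)) * (e * cj)   ≈⟨ *-cong (*-congˡ (sym K≈)) e-cj≈R ⟩
            u * K * R                             ≈⟨ solve 3 (λ u k r → u :* k :* r := r :* k :* u) refl u K R ⟩
            R * K * u                             ≈⟨ RKu≈1 ⟩
            1#                                    ∎

          slope-bound : ∀ {u t b} → 0# < u → R * K * u ≈ 1# → lo ≤ t → t ≤ hi → b ≤ H * cj → t * (b * u) ≤ 1#
          slope-bound {u} {t} {b} 0<u RKu≈1 lo≤t t≤hi b≤ = by-≤
            (u * ((hi - t) * (H * cj) + t * (H * cj - b)))
            (0≤-* (<⇒≤ 0<u) (0≤-+ (0≤-* (diff-≤ t≤hi) (<⇒≤ (0<-* 0<H 0<cj))) (0≤-* (≤-trans (<⇒≤ 0<lo) lo≤t) (diff-≤ b≤))))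
            (trans (+-congʳ (sym (hi-scale RKu≈1)))
              (solve 5 (λ u h g t b → u :* (h :* g) :- t :* (b :* u) := u :* ((h :- t) :* g :+ t :* (g :- b))) refl u hi (H * cj) t b))

          coefficient-bounds : ∀ k {t} → Within lo hi t →
            ♯ 2 ≤ at (coefficient c (suc k)) t × at (coefficient c (suc k)) t ≤ ♯ 6
          coefficient-bounds k {t} (lo≤t , t≤hi) =
            by-≤ ((1# - t * (- b * w)) + 1#) (0≤-+ (diff-≤ (slope-bound 0<w RKw≈1 lo≤t t≤hi
                  (by-≤ _ (diff-≤ (-Hcj≤ (π ⟨$⟩ʳ suc (suc k)))) (solve 2 (λ g b → g :- :- b := b :- :- g) refl (H * cj) b)))) 0≤1)
              (solve 3 (λ t b w → :♯ 4 :+ t :* (b :* w) :- :♯ 2 := (:1 :- t :* (:- b :* w)) :+ :1) refl t b w) ,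
            by-≤ ((1# - t * (b * w)) + 1#) (0≤-+ (diff-≤ (slope-bound 0<w RKw≈1 lo≤t t≤hi (≤Hcj (π ⟨$⟩ʳ suc (suc k))))) 0≤1)
              (solve 3 (λ t b w → :♯ 6 :- (:♯ 4 :+ t :* (b :* w)) := (:1 :- t :* (b :* w)) :+ :1) refl t b w)
            where
            b w : Carrier
            b = c (π ⟨$⟩ʳ suc (suc k))
            w = proj₁ (1/Rκ (suc k))
            0<w : 0# < w
            0<w = proj₁ (proj₂ (1/Rκ (suc k)))
            RKw≈1 : R * K * w ≈ 1#
            RKw≈1 = proj₂ (proj₂ (1/Rκ (suc k)))

          at-lo : at (coefficient c zero) lo ≈ - 1#
          at-lo = begin
            - (♯ 4 * H) + (♯ 4 * H - 1#) * e * (cj * u)    ≈⟨ +-congˡ (trans (*-assoc _ _ _) (*-congˡ (trans (*-comm e (cj * u)) cju-e))) ⟩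
            - (♯ 4 * H) + (♯ 4 * H - 1#) * 1#              ≈⟨ solve 1 (λ h → :- (:♯ 4 :* h) :+ (:♯ 4 :* h :- :1) :* :1 := :- :1) refl H ⟩
            - 1#                                           ∎

          at-hi : at (coefficient c zero) hi ≈ 1#
          at-hi = begin
            - (♯ 4 * H) + (♯ 4 * H + 1#) * e * (cj * u)    ≈⟨ +-congˡ (trans (*-assoc _ _ _) (*-congˡ (trans (*-comm e (cj * u)) cju-e))) ⟩
            - (♯ 4 * H) + (♯ 4 * H + 1#) * 1#              ≈⟨ solve 1 (λ h → :- (:♯ 4 :* h) :+ (:♯ 4 :* h :+ :1) :* :1 := :1) refl H ⟩
            1#                                             ∎

          path : ∃[ lo ] ∃[ hi ] (0# < lo × ∀ σ → Path c lo hi σ)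
          path = lo , hi , 0<lo , every-itinerary (coefficient c zero) (coefficient c ∘ suc) coefficient-bounds
            (lo≤hi , ≤-refl) (≤-refl , lo≤hi) (≤-reflexive (sym at-hi)) (≤-reflexive at-lo)

  abstract
    -- The system is triangular: the last level vanishes, then the one before it, and so on.
    levels-zero : ∀ {m} (σ : Fin m → Fin 2) (X : ℝ^ m) →
      (∀ k → sign (σ k) * X k + ♯ 7 * shift 0# X k ≈ 0#) → X ≋ 𝟎
    levels-zero {suc m} σ X h (suc k) = levels-zero (σ ∘ suc) (X ∘ suc) (h ∘ suc) k
    levels-zero {suc m} σ X h zero = trans (sym (sign-cancel (σ zero) (X zero)))
      (trans (*-congˡ (trans (sym (+-identityʳ _)) (trans (+-congˡ (sym (trans (*-congˡ (head≈0 m (X ∘ suc) (levels-zero (σ ∘ suc) (X ∘ suc) (h ∘ suc)))) (zeroʳ (♯ 7))))) (h zero)))) (zeroʳ _))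
      where
      head≈0 : ∀ m (X : ℝ^ m) → X ≋ 𝟎 → headOr 0# X ≈ 0#
      head≈0 zero X X≋0 = refl
      head≈0 (suc m) X X≋0 = X≋0 zero

    sum≤0⇒≈0 : ∀ {n} {x : ℝ^ n} → (∀ i → 0# ≤ x i) → sum x ≤ 0# → ∀ i → x i ≈ 0#
    sum≤0⇒≈0 0≤x Σ≤0 i = antisym (≤-trans (term≤sum 0≤x i) Σ≤0) (0≤x i)

    +≤0⇒ˡ : ∀ {x y} → 0# ≤ y → x + y ≤ 0# → x ≤ 0#
    +≤0⇒ˡ {x} {y} 0≤y x+y≤0 = ≤-trans (by-≤ y 0≤y (solve 2 (λ x y → x :+ y :- x := y) refl x y)) x+y≤0

  -- Vertices and facet points of one cluster

  module Corner (m : ℕ) (π : Permutation′ (suc (suc m))) (R : Carrier) (0<R : CompleteOrderedField.0# ℝ < R) where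
    open Frame m hiding (module Adapted)
    open Frame.Adapted m π R 0<R

    bound : Ineq d → Carrier
    bound cap        = 0#
    bound (wall k s) = H * height d k

    abstract
      0≤bound : ∀ q → 0# ≤ bound q
      0≤bound cap        = ≤-refl
      0≤bound (wall k s) = 0≤-* (<⇒≤ 0<H) (≤-trans 0≤1 (1≤height d k))

      wall-value : ∀ {x y X} → capNormal · x ≈ y → (∀ k → level k · x ≈ X k) → ∀ k s →
        normal (wall k s) · x ≈ H * (sign s * X k + ♯ 7 * shift 0# X k) + y
      wall-value {x} x₀ xs k s = trans (wall-· k s x)
        (+-cong (*-congˡ (+-cong (*-congˡ (xs k)) (*-congˡ (shift-resp xs k)))) x₀)

      corner-value-≤ : ∀ {x} σ → capNormal · x ≈ 0# → (∀ k → level k · x ≈ corner d σ k) →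
        ∀ q → normal q · x ≤ bound q
      corner-value-≤ σ x₀ xs cap = ≤-reflexive x₀
      corner-value-≤ {x} σ x₀ xs (wall k s) = by-≤ _ (0≤-* (<⇒≤ 0<H) (diff-≤ (corner-inside d σ k s)))
        (trans (+-congˡ (-‿cong (wall-value {x} x₀ xs k s)))
          (solve 3 (λ h b y → h :* b :- (h :* y :+ :0) := h :* (b :- y)) refl H (height d k) (sign s * corner d σ k + ♯ 7 * shift 0# (corner d σ) k)))

      corner-wall : ∀ {x} σ → capNormal · x ≈ 0# → (∀ k → level k · x ≈ corner d σ k) →
        ∀ k → normal (wall k (σ k)) · x ≈ bound (wall k (σ k))
      corner-wall {x} σ x₀ xs k = trans (wall-value {x} x₀ xs k (σ k))
        (trans (+-identityʳ _) (*-congˡ (corner-tight d σ k)))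

    record CornerPoint (σ : Fin d → Fin 2) : Set (a ⊔ ℓ₁ ⊔ ℓ₂) where
      field
        point    : ℝ^ n
        inside   : ∀ q → normal q · point ≤ bound q
        on-cap   : capNormal · point ≈ 0#
        on-wall  : ∀ k → normal (wall k (σ k)) · point ≈ bound (wall k (σ k))
        positive : ∀ k → 0# < sign (σ k) * (level k · point)

    record FacetPoint (q : Ineq d) : Set (a ⊔ ℓ₁ ⊔ ℓ₂) where
      field
        point  : ℝ^ n
        tight  : normal q · point ≈ bound q
        strict : ∀ q′ → q′ ≢ q → normal q′ · point < bound q′

    abstract
      cornerPoint : ∀ σ → CornerPoint σ
      cornerPoint σ = build (point-with 0# (corner d σ))
        where
        build : ∃[ x ] (capNormal · x ≈ 0# × ∀ k → level k · x ≈ corner d σ k) → CornerPoint σ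
        build (x , x₀ , xs) = record
          { point = x ; inside = corner-value-≤ {x} σ x₀ xs ; on-cap = x₀ ; on-wall = corner-wall {x} σ x₀ xs
          ; positive = λ k → <-cong refl (*-congˡ (sym (xs k))) (corner-positive d σ k) }

      <-scale : ∀ {y h} → y < h + 1# → H * y + - H < H * h
      <-scale {y} {h} y<h+1 = by-< _ (0<-* 0<H (diff-< y<h+1))
        (solve 3 (λ k y h → k :* h :- (k :* y :+ :- k) := k :* (h :+ :1 :- y)) refl H y h)

      -- The cap has the point with all levels 0, because the heights are positive. For a wall,
      -- dropping X∗ to - H frees the point from the cap and widens each wall by one unit.
      facetPoint : ∀ q → FacetPoint q
      facetPoint cap = build (point-with 0# (λ _ → 0#))
        where
        build : ∃[ x ] (capNormal · x ≈ 0# × ∀ k → level k · x ≈ 0#) → FacetPoint cap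
        build (x , x₀ , xs) = record
          { point = x ; tight = x₀
          ; strict = λ { cap ≢ → ⊥-elim (≢ ≡.refl) ; (wall k s) _ → strict k s } }
          where
          strict : ∀ k s → normal (wall k s) · x < H * height d k
          strict k s = <-cong (sym (trans (wall-value {x} x₀ xs k s) (trans (+-congʳ (*-congˡ (+-congˡ (*-congˡ (shift-𝟎 {d} k)))))
            (solve 2 (λ h s → h :* (s :* :0 :+ :♯ 7 :* :0) :+ :0 := :0) refl H (sign s))))) refl
            (0<-* 0<H (<-≤-trans 0<1 (1≤height d k)))
      facetPoint (wall k s) = build (point-with (- H) (axis d k s))
        where
        build : ∃[ x ] (capNormal · x ≈ - H × ∀ i → level i · x ≈ axis d k s i) → FacetPoint (wall k s)
        build (x , x₀ , xs) = record
          { point = x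
          ; tight = trans (wall-value {x} x₀ xs k s) (trans (+-congʳ (*-congˡ (axis-tight d k s)))
              (solve 2 (λ h y → h :* (y :+ :1) :+ :- h := h :* y) refl H (height d k)))
          ; strict = λ { cap _ → <-cong (sym x₀) refl (by-< H 0<H (solve 1 (λ h → :0 :- :- h := h) refl H))
                       ; (wall i t) ≢ → strict i t (i Fin.≟ k) ≢ } }
          where
          strict : ∀ i t → Dec (i ≡ k) → wall i t ≢ wall k s → normal (wall i t) · x < H * height d i
          strict i t (yes ≡.refl) ≢ = <-cong (sym (wall-value {x} x₀ xs i t)) refl
            (<-scale (axis-opposite d k s t (≢ ∘ ≡.cong (wall k))))
          strict i t (no i≢k) ≢ = <-cong (sym (wall-value {x} x₀ xs i t)) refl
            (<-scale (axis-other d k s i t i≢k))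

    -- The point x is compared with v only in the d + 1 inequalities tight at the corner. The
    -- certificate, applied to v - x, writes the gain in the objective as a combination of their
    -- slacks with positive weights.
    module Optimal (c : ℝ^ n) {lo hi σ} (Σc≈0 : sum c ≈ 0#) (I : Path c lo hi σ) (v x : ℝ^ n)
                   (cap≤ : capNormal · x ≤ capNormal · v)
                   (wall≤ : ∀ k → normal (wall k (σ k)) · x ≤ normal (wall k (σ k)) · v) where
      open Itinerary I
      private
        Δ u : ℝ^ n
        Δ = v +ᵥ (- 1#) *ᵥ x
        u = 𝟏 +ᵥ t *ᵥ c
        cone : Fin d → Carrier
        cone k = μ k * (normal (wall k (σ k)) · Δ)

      abstract
        0≤Δ : ∀ (w : ℝ^ n) → w · x ≤ w · v → 0# ≤ w · Δ
        0≤Δ w h = ≤-cong refl (sym (·-difference w v x)) (diff-≤ h)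

        0≤cone : ∀ k → 0# ≤ cone k
        0≤cone k = 0≤-* (<⇒≤ (0<μ k)) (0≤Δ (normal (wall k (σ k))) (wall≤ k))

        0≤capΔ : 0# ≤ (H - sum μ) * (capNormal · Δ)
        0≤capΔ = 0≤-* (<⇒≤ (0<H-Σμ c I)) (0≤Δ capNormal cap≤)

        optimal : u · x ≤ u · v
        optimal = by-≤ (u · Δ) (*-cancelˡ-0≤ 0<H (≤-cong refl (sym (certificate c Σc≈0 I Δ)) (0≤-+ (0≤sum 0≤cone) 0≤capΔ)))
          (sym (·-difference u v x))

        -- Equality forces v - x to lie in the trivial lineality space of the cone.
        uniquely-optimal : u · v ≤ u · x → x ≋ v
        uniquely-optimal h i = trans (solve 2 (λ x v → x := v :- (v :+ :- :1 :* x)) refl (x i) (v i))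
          (trans (+-congˡ (-‿cong (Δ≋0 i))) (trans (+-congˡ -0#≈0#) (+-identityʳ (v i))))
          where
          total≤0 : sum cone + (H - sum μ) * (capNormal · Δ) ≤ 0#
          total≤0 = ≤-cong (certificate c Σc≈0 I Δ) refl (by-≤ (H * (u · x - u · v)) (0≤-* (<⇒≤ 0<H) (diff-≤ h))
            (trans (+-congˡ (-‿cong (*-congˡ (·-difference u v x))))
              (solve 3 (λ h a b → :0 :- h :* (b :- a) := h :* (a :- b)) refl H (u · x) (u · v))))
          wall≈0 : ∀ k → normal (wall k (σ k)) · Δ ≈ 0#
          wall≈0 k = *-cancel-0 (<⇒≉ (0<μ k)) (sum≤0⇒≈0 0≤cone (+≤0⇒ˡ 0≤capΔ total≤0) k)
          cap≈0 : capNormal · Δ ≈ 0#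
          cap≈0 = *-cancel-0 (<⇒≉ (0<H-Σμ c I)) (antisym (+≤0⇒ˡ (0≤sum 0≤cone) (≤-cong (+-comm _ _) refl total≤0)) 0≤capΔ)
          level≈0 : ∀ k → level k · Δ ≈ 0#
          level≈0 = levels-zero σ (λ k → level k · Δ) λ k → *-cancel-0 (<⇒≉ 0<H)
            (trans (sym (trans (+-congˡ cap≈0) (+-identityʳ _))) (trans (sym (wall-· k (σ k) Δ)) (wall≈0 k)))
          Δ≋0 : Δ ≋ 𝟎
          Δ≋0 = rows-injective Δ λ { zero → cap≈0 ; (suc k) → level≈0 k }

    -- T, Q and Q′ stand for the products Pᵢ Pⱼ, Pᵢ² and Pⱼ² of scales, D for the
    -- vector from the apex i to the apex j, and y for the coordinates of δ j.
    module Foreign (T Q Q′ : Carrier) (0≤T : 0# ≤ T) (0≤Q : 0# ≤ Q) (0≤Q′ : 0# ≤ Q′)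
                   (separated : ♯ 12 * K * T < Q + Q′) (D : ℝ^ n) (y : Fin n → Carrier)
                   (0≤y : ∀ k → 0# ≤ y k) (y≤1 : ∀ k → y k ≤ 1#)
                   (D₀ : level zero · D ≈ - (T * y zero + Q))
                   (Dₖ : ∀ k → level (suc k) · D ≈ K * T * (y (suc (suc k)) - y zero))
                   (ΣD : sum D ≈ ♯ 2 * H * (Q - Q′)) where
      private
        S : Carrier
        S = Q + Q′
        X : ℝ^ d
        X k = level k · D

      abstract
        0≤KT : 0# ≤ K * T
        0≤KT = 0≤-* (<⇒≤ 0<K) 0≤T

        X-lateral≤ : ∀ k → X (suc k) ≤ K * T
        X-lateral≤ k = by-≤ (K * T * ((1# - y (suc (suc k))) + y zero)) (0≤-* 0≤KT (0≤-+ (diff-≤ (y≤1 (suc (suc k)))) (0≤y zero)))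
          (trans (+-congˡ (-‿cong (Dₖ k))) (solve 3 (λ c a b → c :- c :* (a :- b) := c :* ((:1 :- a) :+ b)) refl (K * T) (y (suc (suc k))) (y zero)))

        -X-lateral≤ : ∀ k → - (K * T) ≤ X (suc k)
        -X-lateral≤ k = by-≤ (K * T * ((1# - y zero) + y (suc (suc k)))) (0≤-* 0≤KT (0≤-+ (diff-≤ (y≤1 zero)) (0≤y (suc (suc k)))))
          (trans (+-congʳ (Dₖ k)) (solve 3 (λ c a b → c :* (a :- b) :- :- c := c :* ((:1 :- b) :+ a)) refl (K * T) (y (suc (suc k))) (y zero)))

        0≤T*y₀ : 0# ≤ T * y zero
        0≤T*y₀ = 0≤-* 0≤T (0≤y zero)

        radial-≤ : T * y zero + Q ≤ S + K * T
        radial-≤ = by-≤ (Q′ + ((K - 1#) * T + T * (1# - y zero)))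
          (0≤-+ 0≤Q′ (0≤-+ (0≤-* (diff-≤ 1≤K) 0≤T) (0≤-* 0≤T (diff-≤ (y≤1 zero)))))
          (solve 5 (λ q r k t y → q :+ r :+ k :* t :- (t :* y :+ q) := r :+ ((k :- :1) :* t :+ t :* (:1 :- y))) refl Q Q′ K T (y zero))

        0≤S : 0# ≤ S
        0≤S = 0≤-+ 0≤Q 0≤Q′

        0≤radial : 0# ≤ T * y zero + Q
        0≤radial = 0≤-+ 0≤T*y₀ 0≤Q

        X≤ : ∀ k → X k ≤ S + K * T
        X≤ zero = ≤-trans (by-≤ (T * y zero + Q) 0≤radial (trans (+-congˡ (-‿cong D₀)) (solve 1 (λ r → :0 :- :- r := r) refl (T * y zero + Q))))
          (0≤-+ 0≤S 0≤KT)
        X≤ (suc k) = ≤-trans (X-lateral≤ k) (by-≤ S 0≤S (solve 2 (λ s k → s :+ k :- k := s) refl S (K * T)))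

        -X≤ : ∀ k → - (S + K * T) ≤ X k
        -X≤ zero = by-≤ _ (diff-≤ radial-≤) (trans (+-congʳ D₀) (solve 2 (λ r s → :- r :- :- s := s :- r) refl (T * y zero + Q) (S + K * T)))
        -X≤ (suc k) = ≤-trans (by-≤ S 0≤S (solve 2 (λ s k → :- k :- :- (s :+ k) := s) refl S (K * T))) (-X-lateral≤ k)

        ιm≤H : ι m ≤ H
        ιm≤H = ≤-trans (by-≤ 1# 0≤1 (solve 1 (λ i → :1 :+ i :- i := :1) refl (ι m)))
          (≤-cong refl 1+ιd≈H (by-≤ 1# 0≤1 (solve 1 (λ i → :1 :+ i :- i := :1) refl (ι d))))

        lateral-sum : - (H * (K * T)) ≤ sum (X ∘ suc)
        lateral-sum = ≤-trans (by-≤ ((H - ι m) * (K * T)) (0≤-* (diff-≤ ιm≤H) 0≤KT)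
            (trans (+-congʳ (sum-const m (- (K * T)))) (solve 3 (λ h i k → i :* :- k :- :- (h :* k) := (h :- i) :* k) refl H (ι m) (K * T))))
          (sum-mono {x = λ _ → - (K * T)} {y = X ∘ suc} -X-lateral≤)

        -- The sum of D contributes 2 H (Q - Q′) and the radial level at most -4 H Q, in total -2 H
        -- (Q + Q′). The lateral levels cost at most 4 H K T.
        cap-≤ : capNormal · D ≤ - (♯ 2 * H * S) + ♯ 4 * (H * (K * T))
        cap-≤ = by-≤ (♯ 4 * (H * (T * y zero)) + ♯ 4 * (sum (X ∘ suc) - - (H * (K * T))))
          (0≤-+ (0≤-* (<⇒≤ (0<♯ 3)) (0≤-* (<⇒≤ 0<H) 0≤T*y₀)) (0≤-* (<⇒≤ (0<♯ 3)) (diff-≤ lateral-sum)))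
          (trans (+-congˡ (-‿cong cap-value))
            (solve 6 (λ h q r z w s → :- (:♯ 2 :* h :* (q :+ r)) :+ :♯ 4 :* w :- (:♯ 2 :* h :* (q :- r) :- (:- (:♯ 4 :* h) :* :- (z :+ q) :+ :♯ 4 :* s)) :=
                                      :♯ 4 :* (h :* z) :+ :♯ 4 :* (s :- :- w)) refl H Q Q′ (T * y zero) (H * (K * T)) (sum (X ∘ suc))))
          where
          cap-value : capNormal · D ≈ ♯ 2 * H * (Q - Q′) - (- (♯ 4 * H) * - (T * y zero + Q) + ♯ 4 * sum (X ∘ suc))
          cap-value = trans (cap-· D) (+-cong ΣD (-‿cong (+-cong (*-congˡ D₀) (sum-* (♯ 4) (X ∘ suc)))))

        -- A wall adds at most H (S + K T) + 7 H K T to the bound -2 H S + 4 H K T of the cap. The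
        -- total is H (12 K T - S), which is the origin of the 12 in B.
        foreign : ∀ q → normal q · D < 0#
        foreign cap = ≤-<-trans cap-≤ (by-< (♯ 2 * H * ((S - ♯ 12 * K * T) + ♯ 10 * (K * T)))
          (0<-* (0<-* (0<♯ 1) 0<H) (0<-+ (diff-< separated) (0≤-* (<⇒≤ (0<♯ 9)) 0≤KT)))
          (solve 4 (λ h s k t → :0 :- (:- (:♯ 2 :* h :* s) :+ :♯ 4 :* (h :* (k :* t))) := :♯ 2 :* h :* ((s :- :♯ 12 :* k :* t) :+ :♯ 10 :* (k :* t))) refl H S K T))
        foreign (wall k s) = by-< (H * ((S + K * T) - sign s * X k) + ♯ 7 * H * (K * T - shift 0# X k) + ((- (♯ 2 * H * S) + ♯ 4 * (H * (K * T))) - capNormal · D) + H * (S - ♯ 12 * K * T))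
          (0<-+ʳ (0≤-+ (0≤-+ (0≤-* (<⇒≤ 0<H) (diff-≤ (sign*≤ s (-X≤ k) (X≤ k))))
                             (0≤-* (0≤-* (<⇒≤ (0<♯ 6)) (<⇒≤ 0<H)) (diff-≤ (shift-≤ X 0≤KT X-lateral≤ k))))
                       (diff-≤ cap-≤))
                 (0<-* 0<H (diff-< separated)))
          (trans (+-congˡ (-‿cong (wall-· k s D))) (rearrange H S K T (sign s * X k) (shift 0# X k) (capNormal · D)))
          where
          rearrange : ∀ h s k t x z c → 0# - (h * (x + ♯ 7 * z) + c) ≈
            h * ((s + k * t) - x) + ♯ 7 * h * (k * t - z) + ((- (♯ 2 * h * s) + ♯ 4 * (h * (k * t))) - c) + h * (s - ♯ 12 * k * t)
          rearrange = solve 7 (λ h s k t x z c → :0 :- (h :* (x :+ :♯ 7 :* z) :+ c) :=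
            h :* ((s :+ k :* t) :- x) :+ :♯ 7 :* h :* (k :* t :- z) :+ ((:- (:♯ 2 :* h :* s) :+ :♯ 4 :* (h :* (k :* t))) :- c) :+ h :* (s :- :♯ 12 :* k :* t)) refl

  -- The arrangement of the clusters

  data GlobalIneq (n d : ℕ) : Set where
    floor : GlobalIneq n d
    local : Fin n → Ineq d → GlobalIneq n d

  private
    -- The bracketing of the sum type copies the expression (2 d + 1) (d + 1) + 1.
    ineq↔ : ∀ {n d} → ((((Fin 2 × Fin d) ⊎ Fin 1) × Fin n) ⊎ Fin 1) ↔ GlobalIneq n d
    ineq↔ = mk↔ₛ′
      (λ { (inj₁ (inj₁ (s , k) , j)) → local j (wall k s) ; (inj₁ (inj₂ _ , j)) → local j cap ; (inj₂ _) → floor })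
      (λ { floor → inj₂ zero ; (local j cap) → inj₁ (inj₂ zero , j) ; (local j (wall k s)) → inj₁ (inj₁ (s , k) , j) })
      (λ { floor → ≡.refl ; (local j cap) → ≡.refl ; (local j (wall k s)) → ≡.refl })
      (λ { (inj₁ (inj₁ (s , k) , j)) → ≡.refl ; (inj₁ (inj₂ zero , j)) → ≡.refl ; (inj₂ zero) → ≡.refl })

    cast↔ : ∀ d → Fin (d ℕ.+ 1) ↔ Fin (suc d)
    cast↔ d = ≡.subst (λ k → Fin (d ℕ.+ 1) ↔ Fin k) (ℕ.+-comm d 1) (↔-id _)

  abstract
    enumeration : ∀ d → Fin ((2 ℕ.* d ℕ.+ 1) ℕ.* (d ℕ.+ 1) ℕ.+ 1) ↔ GlobalIneq (suc d) d
    enumeration d =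
      ineq↔ ↔-∘ ((((rows ×-↔ cast↔ d) ↔-∘ Fin.*↔×) ⊎-↔ ↔-id (Fin 1)) ↔-∘ Fin.+↔⊎)
      where
      rows : Fin (2 ℕ.* d ℕ.+ 1) ↔ ((Fin 2 × Fin d) ⊎ Fin 1)
      rows = (Fin.*↔× ⊎-↔ ↔-id (Fin 1)) ↔-∘ Fin.+↔⊎

    eventually-× : ∀ {p q} {P : Pred Carrier p} {Q : Pred Carrier q} →
                   Eventually P → Eventually Q → Eventually (λ ε → P ε × Q ε)
    eventually-× (ε₁ , 0<ε₁ , h₁) (ε₂ , 0<ε₂ , h₂) with total ε₁ ε₂
    ... | inj₁ ε₁≤ε₂ = ε₁ , 0<ε₁ , λ ε 0<ε ε≤ → h₁ ε 0<ε ε≤ , h₂ ε 0<ε (≤-trans ε≤ ε₁≤ε₂)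
    ... | inj₂ ε₂≤ε₁ = ε₂ , 0<ε₂ , λ ε 0<ε ε≤ → h₁ ε 0<ε (≤-trans ε≤ ε₂≤ε₁) , h₂ ε 0<ε ε≤

    eventually-ineq : ∀ {q d} {Q : Ineq d → Pred Carrier q} →
                      (∀ i → Eventually (Q i)) → Eventually (λ ε → ∀ i → Q i ε)
    eventually-ineq {Q = Q} h = collect (eventually-× (h cap) (eventually-∀ λ k → eventually-∀ λ s → h (wall k s)))
      where
      collect : Eventually (λ ε → Q cap ε × ∀ k s → Q (wall k s) ε) → Eventually (λ ε → ∀ i → Q i ε)
      collect (ε₀ , 0<ε₀ , h) = ε₀ , 0<ε₀ , λ { ε 0<ε ε≤ cap → proj₁ (h ε 0<ε ε≤) ; ε 0<ε ε≤ (wall k s) → proj₂ (h ε 0<ε ε≤) k s }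

    -- A large M is the reciprocal of a small e, so `Eventually` also serves to find upper bounds.
    below-reciprocal : ∀ {e M u} → 0# < e → e * M ≈ 1# → e * u < 1# → u < M
    below-reciprocal {e} {M} {u} 0<e eM≈1 eu<1 = by-< (M - u) (0<-cancel 0<e
      (<-cong refl (trans (+-congʳ (sym eM≈1)) (solve 3 (λ e m u → e :* m :- e :* u := e :* (m :- u)) refl e M u)) (diff-< eu<1))) refl

    maximum : ∀ {k} (c : ℝ^ suc k) → ∃[ j ] (∀ i → c i ≤ c j)
    maximum {zero} c = zero , λ { zero → ≤-refl }
    maximum {suc k} c = choose (maximum (c ∘ suc))
      where
      choose : ∃[ j ] (∀ i → c (suc i) ≤ c (suc j)) → ∃[ j ] (∀ i → c i ≤ c j)
      choose (j , max) with total (c zero) (c (suc j))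
      ... | inj₁ c₀≤ = suc j , λ { zero → c₀≤ ; (suc i) → max i }
      ... | inj₂ ≤c₀ = zero , λ { zero → ≤-refl ; (suc i) → ≤-trans (max i) ≤c₀ }

    sum-δ : ∀ {k} (j : Fin k) → sum (δ j) ≈ 1#
    sum-δ j = trans (sum-cong λ i → sym (*-identityʳ (δ j i))) (δ-· j (λ _ → 1#))

    0≤δ : ∀ {k} (i j : Fin k) → 0# ≤ δ i j
    0≤δ zero zero = 0≤1
    0≤δ zero (suc j) = ≤-refl
    0≤δ (suc i) zero = ≤-refl
    0≤δ (suc i) (suc j) = 0≤δ i j

    δ≤1 : ∀ {k} (i j : Fin k) → δ i j ≤ 1#
    δ≤1 zero zero = ≤-refl
    δ≤1 zero (suc j) = 0≤1
    δ≤1 (suc i) zero = 0≤1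
    δ≤1 (suc i) (suc j) = δ≤1 i j

    permutation-injective : ∀ {k} (π : Permutation′ k) {i j} → π ⟨$⟩ʳ i ≡ π ⟨$⟩ʳ j → i ≡ j
    permutation-injective π eq = ≡.trans (≡.sym (inverseˡ π)) (≡.trans (≡.cong (π ⟨$⟩ˡ_) eq) (inverseˡ π))

    finToFun-injective : ∀ {k b} (r s : Fin (b ℕ.^ k)) → (∀ i → Fin.finToFun {b} {k} r i ≡ Fin.finToFun {b} {k} s i) → r ≡ s
    finToFun-injective {k} {b} r s h = ≡.trans (≡.sym (Fin.funToFin-finToFin {k} {b} r))
      (≡.trans (funToFin-cong h) (Fin.funToFin-finToFin {k} {b} s))
      where
      funToFin-cong : ∀ {k b} {f g : Fin k → Fin b} → (∀ i → f i ≡ g i) → Fin.funToFin f ≡ Fin.funToFin g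
      funToFin-cong {zero} h = ≡.refl
      funToFin-cong {suc k} h = ≡.cong₂ Fin.combine (h zero) (funToFin-cong (h ∘ suc))

    sign-unique : ∀ s t {x} → 0# < sign s * x → 0# < sign t * x → s ≡ t
    sign-unique zero zero _ _ = ≡.refl
    sign-unique zero (suc zero) {x} p q = ⊥-elim (0<-+ p (<⇒≤ q) (≤-reflexive (solve 1 (λ x → :1 :* x :+ :- :1 :* x := :0) refl x)))
    sign-unique (suc zero) zero {x} p q = ⊥-elim (0<-+ p (<⇒≤ q) (≤-reflexive (solve 1 (λ x → :- :1 :* x :+ :1 :* x := :0) refl x)))
    sign-unique (suc zero) (suc zero) _ _ = ≡.refl

  module Assembly (m : ℕ) where
    open Frame m hiding (module Adapted)

    power : ℕ → Carrier
    power zero    = 1#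
    power (suc k) = B * power k

    scale : Fin n → Carrier
    scale j = power (toℕ j)

    abstract
      0<B : 0# < B
      0<B = <-≤-trans 0<1 1≤B

      0<power : ∀ k → 0# < power k
      0<power zero = 0<1
      0<power (suc k) = 0<-* 0<B (0<power k)

      0<scale : ∀ j → 0# < scale j
      0<scale j = 0<power (toℕ j)

      power-gap : ∀ {k l} → k ℕ.< l → B * power k ≤ power l
      power-gap {k} {suc l} (ℕ.s≤s k≤l) = by-≤ (B * (power l - power k)) (0≤-* (<⇒≤ 0<B) (diff-≤ (mono k≤l)))
        (solve 3 (λ b x y → b :* x :- b :* y := b :* (x :- y)) refl B (power l) (power k))
        where
        mono : ∀ {k l} → k ℕ.≤ l → power k ≤ power l
        mono {zero} {zero} _ = ≤-refl
        mono {zero} {suc l} _ = ≤-trans (mono {zero} {l} ℕ.z≤n) (by-≤ ((B - 1#) * power l) (0≤-* (diff-≤ 1≤B) (<⇒≤ (0<power l)))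
          (solve 2 (λ b x → b :* x :- x := (b :- :1) :* x) refl B (power l)))
        mono {suc k} {suc l} (ℕ.s≤s k≤l) = by-≤ (B * (power l - power k)) (0≤-* (<⇒≤ 0<B) (diff-≤ (mono k≤l)))
          (solve 3 (λ b x y → b :* x :- b :* y := b :* (x :- y)) refl B (power l) (power k))

      -- The larger square does it: y y ≥ B x y = 12 K x y + x y.
      separated-by : ∀ {x y} → 0# < x → 0# < y → B * x ≤ y → ♯ 12 * K * (x * y) < x * x + y * y
      separated-by {x} {y} 0<x 0<y Bx≤y = by-< (x * y + (y * (y - B * x) + x * x))
        (0<-+ (0<-* 0<x 0<y) (0≤-+ (0≤-* (<⇒≤ 0<y) (diff-≤ Bx≤y)) (<⇒≤ (0<-* 0<x 0<x))))
        (trans (solve 3 (λ k x y → x :* x :+ y :* y :- :♯ 12 :* k :* (x :* y) := x :* y :+ (y :* (y :- (:♯ 12 :* k :+ :1) :* x) :+ x :* x)) refl K x y)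
          (+-congˡ (+-congʳ (*-congˡ (+-congˡ (-‿cong (*-congʳ (sym B≈))))))))

      scales-separated : ∀ i j → i ≢ j → ♯ 12 * K * (scale i * scale j) < scale i * scale i + scale j * scale j
      scales-separated i j i≢j with ℕ.<-cmp (toℕ i) (toℕ j)
      ... | tri< i<j _ _ = separated-by (0<scale i) (0<scale j) (power-gap i<j)
      ... | tri≈ _ i≡j _ = ⊥-elim (i≢j (Fin.toℕ-injective i≡j))
      ... | tri> _ _ j<i = <-cong (*-congˡ (*-comm (scale j) (scale i))) (+-comm _ _)
                             (separated-by (0<scale j) (0<scale i) (power-gap j<i))

      1/H : Carrier
      1/H = proj₁ (reciprocal H 0<H)

      H*1/H : H * 1/H ≈ 1#
      H*1/H = proj₂ (proj₂ (reciprocal H 0<H))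

    -- Sends the radial position 1 to the coordinate j.
    perm : Fin n → Permutation′ n
    perm j = transpose (suc zero) j

    module A (j : Fin n) = Frame.Adapted m (perm j) (scale j) (0<scale j)
    module C (j : Fin n) = Corner m (perm j) (scale j) (0<scale j)

    -- Chosen so that sum (apex j) is -2 H (scale j)², which puts each apex strictly
    -- inside the cones at the others.
    translation : Fin n → Carrier
    translation j = (- (♯ 2 * H * (scale j * scale j)) - scale j) * 1/H

    apex : Fin n → ℝ^ n
    apex j = scale j *ᵥ δ j +ᵥ translation j *ᵥ 𝟏

    abstract
      sum-linear : ∀ s t (x y : ℝ^ n) → sum (s *ᵥ x +ᵥ t *ᵥ y) ≈ s * sum x + t * sum y
      sum-linear s t x y = trans (sum-+ (s *ᵥ x) (t *ᵥ y)) (+-cong (sum-* s x) (sum-* t y))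

      sum-𝟏 : sum (𝟏 {n}) ≈ H
      sum-𝟏 = sym H≈ι

      sum-apex : ∀ j → sum (apex j) ≈ - (♯ 2 * H * (scale j * scale j))
      sum-apex j = begin
        sum (apex j)                                   ≈⟨ sum-linear (scale j) (translation j) (δ j) 𝟏 ⟩
        scale j * sum (δ j) + translation j * sum (𝟏 {n})  ≈⟨ +-cong (*-congˡ (sum-δ j)) (*-congˡ sum-𝟏) ⟩
        scale j * 1# + (z - scale j) * 1/H * H         ≈⟨ solve 4 (λ p z i h → p :* :1 :+ (z :- p) :* i :* h := p :+ (z :- p) :* (h :* i)) refl (scale j) z 1/H H ⟩
        scale j + (z - scale j) * (H * 1/H)            ≈⟨ +-congˡ (trans (*-congˡ H*1/H) (*-identityʳ _)) ⟩
        scale j + (z - scale j)                        ≈⟨ solve 2 (λ p z → p :+ (z :- p) := z) refl (scale j) z ⟩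
        z                                              ∎
        where
        z : Carrier
        z = - (♯ 2 * H * (scale j * scale j))

      apex-foreign : ∀ i j → i ≢ j → ∀ q → A.normal i q · (apex j +ᵥ (- 1#) *ᵥ apex i) < 0#
      apex-foreign i j i≢j = Corner.Foreign.foreign m (perm i) (scale i) (0<scale i)
        (pᵢ * pⱼ) (pᵢ * pᵢ) (pⱼ * pⱼ)
        (<⇒≤ (0<-* (0<scale i) (0<scale j))) (0≤x*x _) (0≤x*x _)
        (scales-separated i j i≢j) D (λ k → δ j (perm i ⟨$⟩ʳ k)) (λ k → 0≤δ j _) (λ k → δ≤1 j _)
        (trans (A.level-· i zero D) (trans (*-congˡ (difference (suc zero) (δ-off (i≢j ∘ ≡.sym)) (δ-diag i)))
          (solve 3 (λ p r y → p :* :1 :* (r :* (:0 :- y) :- p :* :1) := :- (p :* r :* y :+ p :* p)) refl pᵢ pⱼ (δ j (perm i ⟨$⟩ʳ zero)))))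
        (λ k → trans (A.level-· i (suc k) D) (trans (*-congˡ (difference (suc (suc k)) refl (δ-off λ eq → other k (permutation-injective (perm i) {suc zero} {suc (suc k)} eq))))
          (solve 5 (λ p r y x l → p :* l :* (r :* (x :- y) :- p :* :0) := l :* (p :* r) :* (x :- y)) refl pᵢ pⱼ (δ j (perm i ⟨$⟩ʳ zero)) (δ j (perm i ⟨$⟩ʳ suc (suc k))) K)))
        (trans (sum-+ (apex j) ((- 1#) *ᵥ apex i)) (trans (+-cong (sum-apex j) (trans (sum-* (- 1#) (apex i)) (*-congˡ (sum-apex i))))
          (solve 3 (λ h x y → :- (:♯ 2 :* h :* y) :+ :- :1 :* :- (:♯ 2 :* h :* x) := :♯ 2 :* h :* (x :- y)) refl H (pᵢ * pᵢ) (pⱼ * pⱼ))))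
        where
        pᵢ pⱼ : Carrier
        pᵢ = scale i
        pⱼ = scale j
        D : ℝ^ n
        D = apex j +ᵥ (- 1#) *ᵥ apex i
        other : ∀ (k : Fin m) → suc zero ≢ Fin.suc (Fin.suc k)
        other k ()
        -- The translations along 𝟏 cancel in differences of coordinates, and δ i vanishes at the
        -- position 0 because i sits at the position 1.
        difference : ∀ k {x y} → δ j (perm i ⟨$⟩ʳ k) ≈ x → δ i (perm i ⟨$⟩ʳ k) ≈ y →
          D (perm i ⟨$⟩ʳ k) - D (perm i ⟨$⟩ʳ zero) ≈ pⱼ * (x - δ j (perm i ⟨$⟩ʳ zero)) - pᵢ * y
        difference k {x} {y} x≈ y≈ = begin
          D (perm i ⟨$⟩ʳ k) - D (perm i ⟨$⟩ʳ zero)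
            ≈⟨ +-cong (+-cong (+-congʳ (*-congˡ x≈)) (*-congˡ (+-congʳ (*-congˡ y≈))))
                 (-‿cong (+-congˡ (*-congˡ (+-congʳ (*-congˡ (δ-off λ eq → 1≢0 (permutation-injective (perm i) {suc zero} {zero} eq))))))) ⟩
          pⱼ * x + translation j * 1# + - 1# * (pᵢ * y + translation i * 1#) - (pⱼ * x₀ + translation j * 1# + - 1# * (pᵢ * 0# + translation i * 1#))
            ≈⟨ cancel pⱼ pᵢ x y x₀ (translation j) (translation i) ⟩
          pⱼ * (x - x₀) - pᵢ * y ∎
          where
          x₀ : Carrier
          x₀ = δ j (perm i ⟨$⟩ʳ zero)
          1≢0 : Fin.suc (zero {m}) ≢ zero
          1≢0 ()
          cancel : ∀ p r x y x₀ s t → p * x + s * 1# + - 1# * (r * y + t * 1#) - (p * x₀ + s * 1# + - 1# * (r * 0# + t * 1#)) ≈ p * (x - x₀) - r * y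
          cancel = solve 7 (λ p r x y x₀ s t → p :* x :+ s :* :1 :+ :- :1 :* (r :* y :+ t :* :1) :- (p :* x₀ :+ s :* :1 :+ :- :1 :* (r :* :0 :+ t :* :1)) := p :* (x :- x₀) :- r :* y) refl

      apex-strict : ∀ i j → i ≢ j → ∀ q → A.normal i q · apex j < A.normal i q · apex i
      apex-strict i j i≢j q = by-< (0# - A.normal i q · (apex j +ᵥ (- 1#) *ᵥ apex i)) (diff-< (apex-foreign i j i≢j q))
        (trans (solve 2 (λ x y → y :- x := :0 :- (x :- y)) refl (A.normal i q · apex j) (A.normal i q · apex i))
          (+-congˡ (-‿cong (sym (·-difference (A.normal i q) (apex j) (apex i))))))

      -- Since levels vanish on 𝟏, moving against 𝟏 relaxes all inequalities of all clusters at the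
      -- same rate H. This provides the interior point and the witness of the floor.
      normal-𝟏 : ∀ i q → A.normal i q · 𝟏 ≈ H
      normal-𝟏 i q = value q
        where
        level-𝟏 : ∀ k → A.level i k · 𝟏 ≈ 0#
        level-𝟏 k = trans (A.level-· i k 𝟏) (trans (*-congˡ (-‿inverseʳ 1#)) (zeroʳ _))
        cap-𝟏 : A.capNormal i · 𝟏 ≈ H
        cap-𝟏 = trans (A.cap-· i 𝟏) (trans (+-cong sum-𝟏 (-‿cong (sum-0 λ k → trans (*-congˡ (level-𝟏 k)) (zeroʳ (ω k)))))
          (trans (+-congˡ -0#≈0#) (+-identityʳ H)))
        value : ∀ q → A.normal i q · 𝟏 ≈ H
        value cap = cap-𝟏
        value (wall k s) = trans (C.wall-value i {𝟏} {H} {𝟎} cap-𝟏 level-𝟏 k s)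
          (trans (+-congʳ (*-congˡ (+-congˡ (*-congˡ (shift-𝟎 {d} k)))))
            (solve 2 (λ h s → h :* (s :* :0 :+ :♯ 7 :* :0) :+ h := h) refl H (sign s)))

  -- The polytope and its long shadow paths

  module Construction (m : ℕ) where
    open Frame m hiding (module Adapted)
    open Assembly m

    σ : Fin (2 ℕ.^ d) → Fin d → Fin 2
    σ = Fin.finToFun {2} {d}

    corner-point : ∀ j → Fin (2 ℕ.^ d) → ℝ^ n
    corner-point j r = C.CornerPoint.point (C.cornerPoint j (σ r))

    facet-point : ∀ j → Ineq d → ℝ^ n
    facet-point j q = C.FacetPoint.point (C.facetPoint j q)

    -- Right-hand sides after the cluster i has been shrunk by ε and its origin moved to the apex.
    offset : Carrier → Fin n → Ineq d → Carrier
    offset ε i q = A.normal i q · apex i + ε * C.bound i q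

    place : Carrier → Fin n → ℝ^ n → ℝ^ n
    place ε j y = apex j +ᵥ ε *ᵥ y

    Far : Carrier → Fin n → ℝ^ n → Set ℓ₂
    Far ε j y = ∀ i q → i ≢ j → A.normal i q · place ε j y < offset ε i q

    -- Finitely many points must be strict in the inequalities of the other clusters and in the
    -- floor. M is chosen after ε, since its depth depends on where the shrunken clusters lie.
    record Scales : Set (a ⊔ ℓ₁ ⊔ ℓ₂) where
      field
        ε M          : Carrier
        0<ε          : 0# < ε
        far-corner   : ∀ j r → Far ε j (corner-point j r)
        far-facet    : ∀ j q → Far ε j (facet-point j q)
        deep-corner  : ∀ j r → - sum (place ε j (corner-point j r)) < M
        deep-facet   : ∀ j q → - sum (place ε j (facet-point j q)) < M
        deep-base    : ∀ i q → 1# - offset ε i q < M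

    abstract
      -- The gap between the apexes i and j does not depend on ε, while the displacement ε y changes
      -- the value by O(ε); the bounds are nonnegative and only help.
      eventually-far : ∀ j y → Eventually (λ ε → Far ε j y)
      eventually-far j y = eventually-∀ λ i → eventually-ineq λ q → step i q (i Fin.≟ j)
        where
        step : ∀ i q → Dec (i ≡ j) → Eventually (λ ε → i ≢ j → A.normal i q · place ε j y < offset ε i q)
        step i q (yes i≡j) = eventually-pure λ ε _ i≢j → ⊥-elim (i≢j i≡j)
        step i q (no i≢j) = bound (eventually-linear (A.normal i q · y) (diff-< (apex-strict i j i≢j q)))
          where
          bound : Eventually (λ ε → ε * (A.normal i q · y) < A.normal i q · apex i - A.normal i q · apex j) →
                  Eventually (λ ε → i ≢ j → A.normal i q · place ε j y < offset ε i q)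
          bound (ε₀ , 0<ε₀ , small) = ε₀ , 0<ε₀ , λ ε 0<ε ε≤ _ → by-< _
            (0<-+ (diff-< (small ε 0<ε ε≤)) (0≤-* (<⇒≤ 0<ε) (C.0≤bound i q)))
            (trans (+-congˡ (-‿cong (·-step (A.normal i q) (apex j) y ε)))
              (solve 4 (λ x b z w → x :+ b :- (z :+ w) := (x :- z :- w) :+ b) refl (A.normal i q · apex i) (ε * C.bound i q) (A.normal i q · apex j) (ε * (A.normal i q · y))))

      scales : Scales
      scales = choose-ε (eventually-∃ (eventually-×
          (eventually-∀ λ j → eventually-∀ λ r → eventually-far j (corner-point j r))
          (eventually-∀ λ j → eventually-ineq λ q → eventually-far j (facet-point j q))))
        where
        choose-ε : ∃[ ε ] (0# < ε × (∀ j r → Far ε j (corner-point j r)) × (∀ j q → Far ε j (facet-point j q))) → Scales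
        choose-ε (ε , 0<ε , far-c , far-f) = choose-M (eventually-∃ (eventually-×
            (eventually-∀ λ j → eventually-∀ λ r → eventually-linear (- sum (place ε j (corner-point j r))) 0<1)
            (eventually-×
              (eventually-∀ λ j → eventually-ineq λ q → eventually-linear (- sum (place ε j (facet-point j q))) 0<1)
              (eventually-∀ λ i → eventually-ineq λ q → eventually-linear (1# - offset ε i q) 0<1))))
          where
          choose-M : ∃[ e ] (0# < e × (∀ j r → e * (- sum (place ε j (corner-point j r))) < 1#) ×
                       (∀ j q → e * (- sum (place ε j (facet-point j q))) < 1#) ×
                       (∀ i q → e * (1# - offset ε i q) < 1#)) → Scales
          choose-M (e , 0<e , h₁ , h₂ , h₃) = record
            { ε = ε ; M = proj₁ r ; 0<ε = 0<ε ; far-corner = far-c ; far-facet = far-f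
            ; deep-corner = λ j r → below-reciprocal 0<e eM≈1 (h₁ j r)
            ; deep-facet  = λ j q → below-reciprocal 0<e eM≈1 (h₂ j q)
            ; deep-base   = λ i q → below-reciprocal 0<e eM≈1 (h₃ i q) }
            where
            r : ∃[ M ] (0# < M × e * M ≈ 1#)
            r = reciprocal e 0<e
            eM≈1 : e * proj₁ r ≈ 1#
            eM≈1 = proj₂ (proj₂ r)

    open Scales scales

    global-normal : GlobalIneq n d → ℝ^ n
    global-normal floor       = (- 1#) *ᵥ 𝟏
    global-normal (local j q) = A.normal j q

    global-offset : GlobalIneq n d → Carrier
    global-offset floor       = M
    global-offset (local j q) = offset ε j q

    Inside : ℝ^ n → Set ℓ₂
    Inside x = ∀ q → global-normal q · x ≤ global-offset q

    abstract
      floor-· : ∀ x → global-normal floor · x ≈ - sum x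
      floor-· x = trans (·-*ˡ (- 1#) 𝟏 x) (trans (*-congˡ (𝟏-· x)) (solve 1 (λ s → :- :1 :* s := :- s) refl (sum x)))

      local-tight : ∀ j q y → A.normal j q · y ≈ C.bound j q → A.normal j q · place ε j y ≈ offset ε j q
      local-tight j q y h = trans (·-step (A.normal j q) (apex j) y ε) (+-congˡ (*-congˡ h))

      local-≤ : ∀ j q y → A.normal j q · y ≤ C.bound j q → A.normal j q · place ε j y ≤ offset ε j q
      local-≤ j q y h = by-≤ _ (0≤-* (<⇒≤ 0<ε) (diff-≤ h)) (trans (+-congˡ (-‿cong (·-step (A.normal j q) (apex j) y ε)))
        (solve 4 (λ x e b z → x :+ e :* b :- (x :+ e :* z) := e :* (b :- z)) refl (A.normal j q · apex j) ε (C.bound j q) (A.normal j q · y)))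

      local-< : ∀ j q y → A.normal j q · y < C.bound j q → A.normal j q · place ε j y < offset ε j q
      local-< j q y h = by-< _ (0<-* 0<ε (diff-< h)) (trans (+-congˡ (-‿cong (·-step (A.normal j q) (apex j) y ε)))
        (solve 4 (λ x e b z → x :+ e :* b :- (x :+ e :* z) := e :* (b :- z)) refl (A.normal j q · apex j) ε (C.bound j q) (A.normal j q · y)))

      corner∈P : ∀ j r → Inside (place ε j (corner-point j r))
      corner∈P j r floor = <⇒≤ (<-cong (sym (floor-· (place ε j (corner-point j r)))) refl (deep-corner j r))
      corner∈P j r (local i q) = at-structure (i Fin.≟ j)
        where
        at-structure : Dec (i ≡ j) → A.normal i q · place ε j (corner-point j r) ≤ offset ε i q
        at-structure (yes ≡.refl) = local-≤ j q (corner-point j r) (C.CornerPoint.inside (C.cornerPoint j (σ r)) q)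
        at-structure (no i≢j) = <⇒≤ (far-corner j r i q i≢j)

      -- On the line through 𝟏, normalised so that every cluster inequality has the value s. The
      -- choice s = 1 - M gives an interior point, and s = - M a point on the floor alone.
      base : Carrier → ℝ^ n
      base s = (s * 1/H) *ᵥ 𝟏

      base-local : ∀ s i q → A.normal i q · base s ≈ s
      base-local s i q = trans (·-*ʳ (s * 1/H) (A.normal i q) 𝟏) (trans (*-congˡ (normal-𝟏 i q))
        (trans (solve 3 (λ s i h → s :* i :* h := s :* (h :* i)) refl s 1/H H) (trans (*-congˡ H*1/H) (*-identityʳ s))))

      base-floor : ∀ s → global-normal floor · base s ≈ - s
      base-floor s = trans (floor-· (base s)) (-‿cong (trans (sum-* {n} (s * 1/H) 𝟏) (trans (*-congˡ sum-𝟏)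
        (trans (solve 3 (λ s i h → s :* i :* h := s :* (h :* i)) refl s 1/H H) (trans (*-congˡ H*1/H) (*-identityʳ s))))))

      base-strict : ∀ s → s ≤ 1# - M → ∀ i q → A.normal i q · base s < offset ε i q
      base-strict s s≤ i q = <-cong (sym (base-local s i q)) refl (≤-<-trans s≤
        (by-< _ (diff-< (deep-base i q)) (solve 2 (λ o m → o :- (:1 :- m) := m :- (:1 :- o)) refl (offset ε i q) M)))

      interior : ∀ q → global-normal q · base (1# - M) < global-offset q
      interior floor = <-cong (sym (base-floor (1# - M))) refl (by-< 1# 0<1 (solve 1 (λ m → m :- (:- (:1 :- m)) := :1) refl M))
      interior (local i q) = base-strict (1# - M) ≤-refl i q

      witness : ∀ q → ∃[ x ] (global-normal q · x ≈ global-offset q × ∀ q′ → q′ ≢ q → global-normal q′ · x < global-offset q′)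
      witness floor = base (- M) , trans (base-floor (- M)) (-‿involutive M) ,
        λ { floor floor≢ → ⊥-elim (floor≢ ≡.refl) ; (local i q) _ → base-strict (- M) (by-≤ 1# 0≤1 (solve 1 (λ m → :1 :- m :- :- m := :1) refl M)) i q }
      witness (local j q) = place ε j y , local-tight j q y (C.FacetPoint.tight F) ,
        λ { floor _ → <-cong (sym (floor-· (place ε j y))) refl (deep-facet j q) ; (local i q′) q′≢q → strict i q′ q′≢q (i Fin.≟ j) }
        where
        F : C.FacetPoint j q
        F = C.facetPoint j q
        y : ℝ^ n
        y = facet-point j q
        strict : ∀ i q′ → local i q′ ≢ local j q → Dec (i ≡ j) → A.normal i q′ · place ε j y < offset ε i q′
        strict i q′ q′≢q (yes ≡.refl) = local-< j q′ y (C.FacetPoint.strict F q′ (q′≢q ∘ ≡.cong (local j)))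
        strict i q′ _ (no i≢j) = far-facet j q i q′ i≢j

    -- Distinct unique maximizers at positive parameters: the field `complete` places each of them
    -- on every shadow path, so the path has at least that many vertices.
    record LongPath (c : ℝ^ n) : Set (a ⊔ ℓ₁ ⊔ ℓ₂) where
      field
        vertex   : Fin (2 ℕ.^ d) → ℝ^ n
        time     : Fin (2 ℕ.^ d) → Carrier
        0<time   : ∀ r → 0# < time r
        inside   : ∀ r → Inside (vertex r)
        optimal  : ∀ r x → Inside x → (𝟏 +ᵥ time r *ᵥ c) · x ≤ (𝟏 +ᵥ time r *ᵥ c) · vertex r
        unique   : ∀ r x → Inside x → (𝟏 +ᵥ time r *ᵥ c) · vertex r ≤ (𝟏 +ᵥ time r *ᵥ c) · x → x ≋ vertex r
        distinct : ∀ r s → vertex r ≋ vertex s → r ≡ s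

    abstract
      corner-distinct : ∀ j r s → place ε j (corner-point j r) ≋ place ε j (corner-point j s) → r ≡ s
      corner-distinct j r s eq = finToFun-injective {d} {2} r s λ k → sign-unique (σ r k) (σ s k)
        (C.CornerPoint.positive (C.cornerPoint j (σ r)) k)
        (<-cong refl (*-congˡ (sym (same-level k))) (C.CornerPoint.positive (C.cornerPoint j (σ s)) k))
        where
        same : corner-point j r ≋ corner-point j s
        same i = trans (solve 2 (λ x y → x := (x :- y) :+ y) refl (corner-point j r i) (corner-point j s i))
          (trans (+-congʳ (*-cancel-0 (<⇒≉ 0<ε) (begin
            ε * (corner-point j r i - corner-point j s i)
              ≈⟨ solve 4 (λ e x y z → e :* (x :- y) := (z :+ e :* x) :- (z :+ e :* y)) refl ε (corner-point j r i) (corner-point j s i) (apex j i) ⟩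
            place ε j (corner-point j r) i - place ε j (corner-point j s) i   ≈⟨ +-congʳ (eq i) ⟩
            place ε j (corner-point j s) i - place ε j (corner-point j s) i   ≈⟨ -‿inverseʳ _ ⟩
            0# ∎))) (+-identityˡ _))
        same-level : ∀ k → A.level j k · corner-point j r ≈ A.level j k · corner-point j s
        same-level k = ·-congʳ (A.level j k) same

      long-path-at : ∀ c → sum c ≈ 0# → ∀ j → 0# < c j → (∀ i → c i ≤ H * c j) → (∀ i → - (H * c j) ≤ c i) → LongPath c
      long-path-at c Σc≈0 j 0<cj ≤Hcj -Hcj≤ = build (Frame.Adapted.Ray.path m (perm j) (scale j) (0<scale j) c 0<cj ≤Hcj -Hcj≤)
        where
        build : ∃[ lo ] ∃[ hi ] (0# < lo × ∀ σ → A.Path j c lo hi σ) → LongPath c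
        build (lo , hi , 0<lo , path) = record
          { vertex   = v
          ; time     = λ r → Itinerary.t (path (σ r))
          ; 0<time   = λ r → <-≤-trans 0<lo (proj₁ (Itinerary.within (path (σ r))))
          ; inside   = corner∈P j
          ; optimal  = λ r x x∈P → C.Optimal.optimal j c Σc≈0 (path (σ r)) (v r) x (cap≤ r x x∈P) (wall≤ r x x∈P)
          ; unique   = λ r x x∈P → C.Optimal.uniquely-optimal j c Σc≈0 (path (σ r)) (v r) x (cap≤ r x x∈P) (wall≤ r x x∈P)
          ; distinct = corner-distinct j
          }
          where
          v : Fin (2 ℕ.^ d) → ℝ^ n
          v r = place ε j (corner-point j r)
          cap≤ : ∀ r x → Inside x → A.capNormal j · x ≤ A.capNormal j · v r
          cap≤ r x x∈P = ≤-trans (x∈P (local j cap))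
            (≤-reflexive (sym (local-tight j cap (corner-point j r) (C.CornerPoint.on-cap (C.cornerPoint j (σ r))))))
          wall≤ : ∀ r x → Inside x → ∀ k → A.normal j (wall k (σ r k)) · x ≤ A.normal j (wall k (σ r k)) · v r
          wall≤ r x x∈P k = ≤-trans (x∈P (local j (wall k (σ r k))))
            (≤-reflexive (sym (local-tight j (wall k (σ r k)) (corner-point j r) (C.CornerPoint.on-wall (C.cornerPoint j (σ r)) k))))

      long-path : ∀ c → ¬ (c ≋ 𝟎) → sum c ≈ 0# → LongPath c
      long-path c c≉0 Σc≈0 = long-path-at c Σc≈0 j 0<cj (λ i → ≤-trans (max i) cj≤Hcj) -Hcj≤
        where
        j : Fin n
        j = proj₁ (maximum c)
        max : ∀ i → c i ≤ c j
        max = proj₂ (maximum c)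
        -- The gaps c j - c i are nonnegative with sum n c j = H c j, as c sums to zero; so each
        -- single gap is at most H c j.
        -Hcj+cj≤ : ∀ i → c j - c i ≤ H * c j
        -Hcj+cj≤ i = ≤-cong (sym (minus i)) Σgaps
            (term≤sum {x = λ i → c j + - 1# * c i} (λ i → ≤-cong refl (minus i) (diff-≤ (max i))) i)
          where
          minus : ∀ i → c j - c i ≈ c j + - 1# * c i
          minus i = solve 2 (λ x y → x :- y := x :+ :- :1 :* y) refl (c j) (c i)
          Σgaps : sum (λ i → c j + - 1# * c i) ≈ H * c j
          Σgaps = trans (sum-+ {n} (λ _ → c j) (λ i → - 1# * c i)) (trans (+-cong (trans (sum-const n (c j)) (*-congʳ (sym H≈ι)))
            (trans (sum-* (- 1#) c) (trans (*-congˡ Σc≈0) (zeroʳ _)))) (+-identityʳ _))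
        -- If c j ≤ 0, then c i ≤ c j ≤ 0 for all i, while the gap bound gives c i ≥ (1 - H) c j ≥
        -- 0; so c would vanish.
        0<cj : 0# < c j
        0<cj cj≤0 = c≉0 λ i → antisym (≤-trans (max i) cj≤0)
          (by-≤ ((H - 1#) * (- c j) + (H * c j - (c j - c i))) (0≤-+ (0≤-* (diff-≤ 1≤H) (0≤-neg cj≤0)) (diff-≤ (-Hcj+cj≤ i)))
            (solve 3 (λ h x y → y :- :0 := (h :- :1) :* (:- x) :+ (h :* x :- (x :- y))) refl H (c j) (c i)))
        cj≤Hcj : c j ≤ H * c j
        cj≤Hcj = by-≤ ((H - 1#) * c j) (0≤-* (diff-≤ 1≤H) (<⇒≤ 0<cj)) (solve 2 (λ h x → h :* x :- x := (h :- :1) :* x) refl H (c j))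
        -Hcj≤ : ∀ i → - (H * c j) ≤ c i
        -Hcj≤ i = by-≤ ((H * c j - (c j - c i)) + c j) (0≤-+ (diff-≤ (-Hcj+cj≤ i)) (<⇒≤ 0<cj))
          (solve 3 (λ h x y → y :- :- (h :* x) := (h :* x :- (x :- y)) :+ x) refl H (c j) (c i))

      -- Here z is the sum of x and y is `spike i · x`. The floor bounds z from below; with that,
      -- the two objectives z + t y and z - t′ y bound y on both sides, and the first then bounds z
      -- from above.
      squeeze : ∀ {t t′ r r′ V V′ z y} → 0# < t → 0# < r → t * r ≈ 1# → 0# < r′ → t′ * r′ ≈ 1# →
        - M ≤ z → z + t * y ≤ V → z - t′ * y ≤ V′ →
        (- ((V′ + M) * r′) - M ≤ y + z) × (y + z ≤ (V + M) * r + (V + t * ((V′ + M) * r′)))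
      squeeze {t} {t′} {r} {r′} {V} {V′} {z} {y} 0<t 0<r tr≈1 0<r′ t′r′≈1 -M≤z ≤V ≤V′ =
        by-≤ (((V′ + M) * r′ - - y) + (z - - M)) (0≤-+ (diff-≤ -y≤) (diff-≤ -M≤z))
          (solve 4 (λ a m y z → (y :+ z) :- (:- a :- m) := (a :- :- y) :+ (z :- :- m)) refl ((V′ + M) * r′) M y z) ,
        by-≤ (((V + M) * r - y) + ((V - (z + t * y)) + t * ((V′ + M) * r′ - - y)))
          (0≤-+ (diff-≤ y≤) (0≤-+ (diff-≤ ≤V) (0≤-* (<⇒≤ 0<t) (diff-≤ -y≤))))
          (solve 6 (λ a v t b y z → a :+ (v :+ t :* b) :- (y :+ z) := (a :- y) :+ ((v :- (z :+ t :* y)) :+ t :* (b :- :- y)))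
            refl ((V + M) * r) V t ((V′ + M) * r′) y z)
        where
        y≤ : y ≤ (V + M) * r
        y≤ = by-≤ (r * ((V - (z + t * y)) + (z - - M))) (0≤-* (<⇒≤ 0<r) (0≤-+ (diff-≤ ≤V) (diff-≤ -M≤z)))
          (trans (+-congˡ (-‿cong (sym (trans (*-congʳ tr≈1) (*-identityˡ y)))))
            (solve 6 (λ v m r t y z → (v :+ m) :* r :- t :* r :* y := r :* ((v :- (z :+ t :* y)) :+ (z :- :- m))) refl V M r t y z))
        -y≤ : - y ≤ (V′ + M) * r′
        -y≤ = by-≤ (r′ * ((V′ - (z - t′ * y)) + (z - - M))) (0≤-* (<⇒≤ 0<r′) (0≤-+ (diff-≤ ≤V′) (diff-≤ -M≤z)))
          (trans (+-congˡ (-‿cong (-‿cong (sym (trans (*-congʳ t′r′≈1) (*-identityˡ y))))))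
            (solve 6 (λ v m r t y z → (v :+ m) :* r :- :- (t :* r :* y) := r :* ((v :- (z :- t :* y)) :+ (z :- :- m))) refl V′ M r′ t′ y z))

      -- A direction orthogonal to 𝟏 that isolates one coordinate: H x i is its value at x plus the
      -- sum of x.
      spike : Fin n → ℝ^ n
      spike i = H *ᵥ δ i +ᵥ (- 1#) *ᵥ 𝟏

      sum-spike : ∀ i → sum (spike i) ≈ 0#
      sum-spike i = trans (sum-linear H (- 1#) (δ i) 𝟏) (trans (+-cong (*-congˡ (sum-δ i)) (*-congˡ sum-𝟏))
        (solve 1 (λ h → h :* :1 :+ :- :1 :* h := :0) refl H))

      spike-nonzero : ∀ i → ¬ (spike i ≋ 𝟎)
      spike-nonzero i h = <⇒≉ {0#} {H - 1#} (<-≤-trans 0<1 (≤-cong refl (trans (solve 1 (λ x → x := :1 :+ x :- :1) refl (ι d)) (+-congʳ 1+ιd≈H)) (1≤ι m)))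
        (trans (trans (solve 1 (λ h → h :- :1 := h :* :1 :+ :- :1 :* :1) refl H) (+-congʳ (*-congˡ (sym (δ-diag i))))) (h i))

      spike-· : ∀ i x → spike i · x ≈ H * x i - sum x
      spike-· i x = trans (·-+ˡ (H *ᵥ δ i) ((- 1#) *ᵥ 𝟏) x) (+-cong (trans (·-*ˡ H (δ i) x) (*-congˡ (δ-· i x))) (floor-· x))

      -- Any one vertex of the long path is a maximizer, so its objective value bounds the
      -- polyhedron in a direction 𝟏 + t c with t > 0.
      objective-bound : ∀ c → ¬ (c ≋ 𝟎) → sum c ≈ 0# →
        ∃[ t ] ∃[ V ] (0# < t × ∀ x → Inside x → sum x + t * (c · x) ≤ V)
      objective-bound c c≉0 Σc≈0 = read (long-path c c≉0 Σc≈0)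
        where
        some : Fin (2 ℕ.^ d)
        some = Fin.funToFin {d} {2} (λ _ → zero)
        read : LongPath c → ∃[ t ] ∃[ V ] (0# < t × ∀ x → Inside x → sum x + t * (c · x) ≤ V)
        read L = time some , (𝟏 +ᵥ time some *ᵥ c) · vertex some , 0<time some , λ x x∈P →
          ≤-cong (trans (·-+ˡ 𝟏 (time some *ᵥ c) x) (+-cong (𝟏-· x) (·-*ˡ (time some) c x))) refl (optimal some x x∈P)
          where open LongPath L

      coordinate-bound : ∀ i → ∃[ L ] ∃[ U ] (∀ x → Inside x → (L ≤ x i) × (x i ≤ U))
      coordinate-bound i = combine (objective-bound (spike i) (spike-nonzero i) (sum-spike i))
          (objective-bound ((- 1#) *ᵥ spike i) minus-nonzero (trans (sum-* (- 1#) (spike i)) (trans (*-congˡ (sum-spike i)) (zeroʳ (- 1#)))))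
        where
        minus-nonzero : ¬ ((- 1#) *ᵥ spike i ≋ 𝟎)
        minus-nonzero h = spike-nonzero i λ k → trans (solve 1 (λ x → x := :- :1 :* (:- :1 :* x)) refl (spike i k)) (trans (*-congˡ (h k)) (zeroʳ (- 1#)))
        0<1/H : 0# < 1/H
        0<1/H = 0<-cancel 0<H (<-cong refl (sym H*1/H) 0<1)
        scaled : ∀ x → 1/H * (H * x) ≈ x
        scaled x = trans (solve 3 (λ i h x → i :* (h :* x) := h :* i :* x) refl 1/H H x) (trans (*-congʳ H*1/H) (*-identityˡ x))
        split : ∀ x → H * x i ≈ (H * x i - sum x) + sum x
        split x = solve 2 (λ a b → a := (a :- b) :+ b) refl (H * x i) (sum x)
        *-mono : ∀ {x y} → x ≤ y → 1/H * x ≤ 1/H * y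
        *-mono {x} {y} h = by-≤ (1/H * (y - x)) (0≤-* (<⇒≤ 0<1/H) (diff-≤ h)) (solve 3 (λ i x y → i :* y :- i :* x := i :* (y :- x)) refl 1/H x y)
        combine : ∃[ t ] ∃[ V ] (0# < t × ∀ x → Inside x → sum x + t * (spike i · x) ≤ V) →
                  ∃[ t ] ∃[ V ] (0# < t × ∀ x → Inside x → sum x + t * (((- 1#) *ᵥ spike i) · x) ≤ V) →
                  ∃[ L ] ∃[ U ] (∀ x → Inside x → (L ≤ x i) × (x i ≤ U))
        combine (t , V , 0<t , ≤V) (t′ , V′ , 0<t′ , ≤V′) = with-reciprocals (reciprocal t 0<t) (reciprocal t′ 0<t′)
          where
          with-reciprocals : ∃[ r ] (0# < r × t * r ≈ 1#) → ∃[ r ] (0# < r × t′ * r ≈ 1#) →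
                             ∃[ L ] ∃[ U ] (∀ x → Inside x → (L ≤ x i) × (x i ≤ U))
          with-reciprocals (r , 0<r , tr≈1) (r′ , 0<r′ , t′r′≈1) =
            1/H * (- ((V′ + M) * r′) - M) , 1/H * ((V + M) * r + (V + t * ((V′ + M) * r′))) , λ x x∈P →
              ≤-cong refl (trans (*-congˡ (sym (split x))) (scaled (x i))) (*-mono (proj₁ (both x x∈P))) ,
              ≤-cong (trans (*-congˡ (sym (split x))) (scaled (x i))) refl (*-mono (proj₂ (both x x∈P)))
            where
            both : ∀ x → Inside x → (- ((V′ + M) * r′) - M ≤ (H * x i - sum x) + sum x) ×
                                    ((H * x i - sum x) + sum x ≤ (V + M) * r + (V + t * ((V′ + M) * r′)))
            both x x∈P = squeeze 0<t 0<r tr≈1 0<r′ t′r′≈1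
              (by-≤ (M - - sum x) (diff-≤ (≤-cong (floor-· x) refl (x∈P floor))) (solve 2 (λ s m → s :- :- m := m :- :- s) refl (sum x) M))
              (≤-cong (+-congˡ (*-congˡ (spike-· i x))) refl (≤V x x∈P))
              (≤-cong (+-congˡ (trans (*-congˡ (trans (·-*ˡ (- 1#) (spike i) x) (*-congˡ (spike-· i x))))
                (solve 2 (λ t y → t :* (:- :1 :* y) := :- (t :* y)) refl t′ (H * x i - sum x)))) refl (≤V′ x x∈P))

      bounded-inside : ∃[ b ] (∀ x → Inside x → ∀ i → (- b ≤ x i) × (x i ≤ b))
      bounded-inside = choose (eventually-∃ (eventually-∀ λ i → eventually-×
          (eventually-linear (- proj₁ (coordinate-bound i)) 0<1) (eventually-linear (proj₁ (proj₂ (coordinate-bound i))) 0<1)))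
        where
        choose : ∃[ e ] (0# < e × ∀ i → e * (- proj₁ (coordinate-bound i)) < 1# × e * proj₁ (proj₂ (coordinate-bound i)) < 1#) →
                 ∃[ b ] (∀ x → Inside x → ∀ i → (- b ≤ x i) × (x i ≤ b))
        choose (e , 0<e , small) = proj₁ r , λ x x∈P i →
            ≤-trans (by-≤ (proj₁ r - (- proj₁ (coordinate-bound i))) (diff-≤ (<⇒≤ (below-reciprocal 0<e (proj₂ (proj₂ r)) (proj₁ (small i)))))
              (solve 2 (λ l b → l :- :- b := b :- :- l) refl (proj₁ (coordinate-bound i)) (proj₁ r))) (proj₁ (proj₂ (proj₂ (coordinate-bound i)) x x∈P)) ,
            ≤-trans (proj₂ (proj₂ (proj₂ (coordinate-bound i)) x x∈P)) (<⇒≤ (below-reciprocal 0<e (proj₂ (proj₂ r)) (proj₂ (small i))))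
          where
          r : ∃[ b ] (0# < b × e * b ≈ 1#)
          r = reciprocal e 0<e

    private
      N : ℕ
      N = (2 ℕ.* d ℕ.+ 1) ℕ.* (d ℕ.+ 1) ℕ.+ 1

      ineq : Fin N → GlobalIneq n d
      ineq = Inverse.to (enumeration d)

      index : GlobalIneq n d → Fin N
      index = Inverse.from (enumeration d)

    abstract
      all-ineq : ∀ {x : ℝ^ n} → (∀ k → global-normal (ineq k) · x ≤ global-offset (ineq k)) → Inside x
      all-ineq {x} h q = ≡.subst (λ q → global-normal q · x ≤ global-offset q) (Inverse.strictlyInverseˡ (enumeration d) q) (h (index q))

      ineq-injective : ∀ {k l} → ineq k ≡ ineq l → k ≡ l
      ineq-injective {k} {l} eq = ≡.trans (≡.sym (Inverse.strictlyInverseʳ (enumeration d) k))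
        (≡.trans (≡.cong index eq) (Inverse.strictlyInverseʳ (enumeration d) l))

    polytope : Polytope n
    polytope = record
      { size = N ; normal = global-normal ∘ ineq ; offset = global-offset ∘ ineq
      ; bounded = proj₁ bounded-inside , λ x x∈P → proj₂ bounded-inside x (all-ineq {x} x∈P) }

    abstract
      polytope-interior : ∃ (StrictlyInside polytope)
      polytope-interior = base (1# - M) , λ k → interior (ineq k)

      polytope-witness : ∀ k → ∃ (FacetWitness polytope k)
      polytope-witness k = proj₁ (witness (ineq k)) , proj₁ (proj₂ (witness (ineq k))) ,
        λ l l≢k → proj₂ (proj₂ (witness (ineq k))) (ineq l) (l≢k ∘ ineq-injective)

      path-length : ∀ c → ¬ (c ≋ 𝟎) → Orthogonal c 𝟏 → ∀ len → ShadowPath polytope 𝟏 c len → 2 ℕ.^ (d ℕ.∸ 1) ℕ.∸ 1 ℕ.≤ len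
      path-length c c≉0 c⊥𝟏 len path = count (long-path c c≉0 (trans (sum-cong λ i → sym (*-identityʳ (c i))) c⊥𝟏))
        where
        open ShadowPath path using (complete) renaming (vertex to path-vertex)
        count : LongPath c → 2 ℕ.^ m ℕ.∸ 1 ℕ.≤ len
        -- The path has len + 1 vertices, and 2 ^ d of them are distinct maximizers; 2 ^ m ≤ 2 ^ d,
        -- where d = m + 1, brings this to the stated form.
        count L = ℕ.∸-monoˡ-≤ 1 (ℕ.≤-trans (ℕ.^-monoʳ-≤ 2 (ℕ.n≤1+n m)) (Fin.injective⇒≤ position-injective))
          where
          open LongPath L
          visited : ∀ r → ∃[ i ] (path-vertex i ≋ vertex r)
          visited r = complete (time r) (vertex r) (<⇒≤ (0<time r))
            (((λ k → inside r (ineq k)) , (λ x x∈P → optimal r x (all-ineq {x} x∈P))) ,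
             λ { x (x∈P , x-max) → unique r x (all-ineq {x} x∈P) (x-max (vertex r) (λ k → inside r (ineq k))) })
          position-injective : ∀ {r s} → proj₁ (visited r) ≡ proj₁ (visited s) → r ≡ s
          position-injective {r} {s} eq = distinct r s λ i → trans (sym (proj₂ (visited r) i))
            (trans (reflexive (≡.cong (λ k → path-vertex k i) eq)) (proj₂ (visited s) i))

open import Data.Nat.Base using (_+_; _*_; _∸_; _^_; _≤_)

corollary1p3 : ∀ {a ℓ₁ ℓ₂} (ℝ : CompleteOrderedField a ℓ₁ ℓ₂) →
    let open Geometry ℝ in
    ∀ (d : ℕ) → 3 ≤ d →
    Σ (Polytope (suc d)) λ P → Σ (ℝ^ (suc d)) λ w →
    HasDimension ⟦ P ⟧ (suc d) ×
    NumberOfFaces P d ((2 * d + 1) * (d + 1) + 1) ×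
    ¬ (w ≋ 𝟎) ×
    (∀ (c : ℝ^ (suc d)) → ¬ (c ≋ 𝟎) → Orthogonal c w →
    ∀ (len : ℕ) → ShadowPath P w c len → 2 ^ (d ∸ 1) ∸ 1 ≤ len)
corollary1p3 ℝ (suc m) _ =
  polytope , 𝟏 , fullDimensional polytope polytope-interior ,
  numberOfFacets polytope polytope-interior polytope-witness ,
  (λ 𝟏≋𝟎 → 0≉1 (sym (𝟏≋𝟎 zero))) , path-length
  where
  open CompleteOrderedField ℝ using (sym; 0≉1)
  open Development ℝ
  open Construction m
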